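{- Let $m\geqslant 2$, $k\geqslant 2$ and let $n\in[2m^{k-1},2m^k)$. (1) If $n=\nu\, m^{k-1}$ for some $\nu\in\{2,\ldots,2m-1\}$, then $b^{(k)}_{\mathbf{t}_m}(\nu m^{k-1})=(m^{k-1}-1)\, e_m(\nu)+b^{(1)}_{\mathbf{t}_m}(\nu)$. (2) If $n=\nu\, m^{k-1}+\mu$ for some $\nu\in\{2,\ldots,2m-1\}$ and $0<\mu<m^{k-1}$, then $b^{(k)}_{\mathbf{t}_m}(\nu m^{k-1}+\mu)=(\mu-1)\, e_m(\nu+1)+(m^{k-1}-\mu-1)\, e_m(\nu)+y_m(\nu)$, where for a positive integer $\nu$, $e_m(\nu)=m(1+\nu m-\nu)$ if $\nu<m$ and $e_m(\nu)=m^3-m^2+m$ otherwise, and $y_m(\nu)=2m(1+\nu m-\nu)-m\nu(\nu-1)$ if $\nu<m$ and $y_m(\nu)=m^3-m^2+2m$ otherwise.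
   Context: Let $\mathcal{A}_m=\{0,1,\ldots,m-1\}$, identified with $\mathbb{Z}/m\mathbb{Z}$ (all letter arithmetic is modulo $m$). Let $\sigma_m(i)=i\,(i+1)\cdots(i+m-1)$ define a morphism on $\mathcal{A}_m^*$, and let $\mathbf{t}_m=\lim_{j\to\infty}\sigma_m^j(0)$. For words $u,w$, $\binom{u}{w}$ denotes the number of occurrences of $w$ as a (not necessarily contiguous) subword of $u$. Words $u,v$ are $k$-binomially equivalent, $u\sim_k v$, if $\binom{u}{x}=\binom{v}{x}$ for all words $x$ of length at most $k$; $\sim_1$ is abelian equivalence (same number of occurrences of each letter). $b^{(k)}_{\mathbf{t}_m}(n)$ denotes the number of $\sim_k$-classes among the factors (contiguous blocks) of length $n$ of $\mathbf{t}_m$; $b^{(1)}_{\mathbf{t}_m}$ is the abelian complexity. -}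

module Defs where

open import Data.Nat using (ℕ; zero; suc; _+_; _*_; _∸_; _^_; _≤_; _<_; _≡ᵇ_)
open import Data.Nat.DivMod using (_%_)
open import Data.Bool using (if_then_else_)
open import Data.List using (List; []; _∷_; map; concatMap; upTo; length)
open import Data.List.Relation.Unary.All using (All)
open import Data.List.Relation.Unary.Any using (Any)
open import Data.List.Relation.Unary.AllPairs using (AllPairs)
open import Data.Product using (Σ; _×_)
open import Relation.Binary.PropositionalEquality using (_≡_)
open import Relation.Nullary using (¬_)

-- Letters of 𝒜_m are the naturals 0,…,m-1; letter arithmetic is modulo m.
addMod : ℕ → ℕ → ℕ → ℕ
addMod zero    a b = 0            -- unused dummy case (m ≥ 2 in the theorem)
addMod (suc m) a b = (a + b) % suc m

σ : ℕ → List ℕ → List ℕ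
σ m = concatMap (λ i → map (λ j → addMod m i j) (upTo m))

σ^ : ℕ → ℕ → List ℕ
σ^ m zero    = 0 ∷ []
σ^ m (suc j) = σ m (σ^ m j)

nth : List ℕ → ℕ → ℕ
nth []      _       = 0
nth (a ∷ _) zero    = a
nth (_ ∷ w) (suc i) = nth w i

-- t_m(i): since σ_m^j(0) is a prefix of σ_m^{j+1}(0) of length m^j > j (m ≥ 2),
-- the i-th letter of the limit t_m equals the i-th letter of σ_m^{i+1}(0).
t : ℕ → ℕ → ℕ
t m i = nth (σ^ m (suc i)) i

factor : ℕ → ℕ → ℕ → List ℕ
factor m n i = map (λ j → t m (i + j)) (upTo n)

binom : List ℕ → List ℕ → ℕ
binom u       []      = 1
binom []      (_ ∷ _) = 0
binom (a ∷ u) (x ∷ w) = (if a ≡ᵇ x then binom u w else 0) + binom u (x ∷ w)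

BinEq : ℕ → ℕ → List ℕ → List ℕ → Set
BinEq m k u v = ∀ (x : List ℕ) → length x ≤ k → All (_< m) x → binom u x ≡ binom v x

NumClasses : (List ℕ → List ℕ → Set) → (ℕ → List ℕ) → ℕ → Set
NumClasses R f N =
  Σ (List ℕ) λ ps →
    (length ps ≡ N) ×
    (AllPairs (λ i j → ¬ R (f i) (f j)) ps) ×
    (∀ i → Any (λ p → R (f i) (f p)) ps)

BinComplexity : ℕ → ℕ → ℕ → ℕ → Set
BinComplexity m k n N = NumClasses (BinEq m k) (factor m n) N

e : ℕ → ℕ → ℕ
e m ν = if ν Data.Nat.<ᵇ m then m * (1 + ν * m ∸ ν) else m ^ 3 ∸ m ^ 2 + m

y : ℕ → ℕ → ℕ
y m ν = if ν Data.Nat.<ᵇ m then 2 * m * (1 + ν * m ∸ ν) ∸ m * ν * (ν ∸ 1)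
        else m ^ 3 ∸ m ^ 2 + 2 * m

{-# OPTIONS --safe #-}
module Submission where

open import Defs
open import Data.Nat
open import Data.Nat.Properties
open import Data.Nat.DivMod
open import Data.Nat.Tactic.RingSolver using (solve-∀)
open import Data.Bool using (true; false; if_then_else_)
open import Data.Empty using (⊥)
open import Data.Fin using (Fin; splitAt; _↑ˡ_; _↑ʳ_; join) renaming (zero to fzero; suc to fsuc)
open import Data.Fin.Properties using (any?; splitAt-↑ˡ; splitAt-↑ʳ; join-splitAt)
open import Data.List using (List; []; _∷_; _++_; map; upTo; length; applyUpTo; tabulate; [_]; _∷ʳ_)
open import Data.List.Properties using (++-identityʳ; concatMap-++; applyUpTo-∷ʳ; map-upTo; length-++; length-map; length-upTo; length-tabulate)
open import Data.List.Relation.Unary.All using (All; []; _∷_)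
open import Data.List.Relation.Unary.All.Properties using (applyUpTo⁺₂; ∷ʳ⁺)
import Data.List.Relation.Unary.Any.Properties as Any
import Data.List.Relation.Unary.AllPairs.Properties as AllPairs
open import Data.List.Relation.Binary.Permutation.Propositional using (_↭_; ↭-refl; ↭-sym; ↭-trans; ↭-reflexive; ↭-prep)
import Data.List.Relation.Binary.Permutation.Propositional as Perm
open import Data.List.Relation.Binary.Permutation.Propositional.Properties using (∷↭∷ʳ; All-resp-↭)
open import Data.Product using (Σ; ∃; _×_; _,_; proj₁; proj₂)
open import Data.Sum using (_⊎_; inj₁; inj₂; [_,_]′)
open import Data.Unit using (⊤; tt)
open import Function using (_∘_)
open import Relation.Binary.Definitions using (tri<; tri≈; tri>)
open import Relation.Binary.PropositionalEquality hiding ([_])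
open import Relation.Nullary
open import Relation.Nullary.Decidable using (dec-true; dec-false; _⊎-dec_)

-- Write M = m^(k-1), and let Ψ count letters.
--
-- Sufficiency.  If u ~_{k-1} v then uv ~_k vu; since σ^{k-1}(a) ~_{k-1} σ^{k-1}(b) for all letters
-- by induction, permuting the letters of z does not change σ^{k-1}(z) up to ~_k.
--
-- Necessity.  Subwords with free letters show that u ~_k v forces, for every letter c and d < k,
-- equal moments Σ p^d over the positions p of c.  In the generating function F_u = Σ g^(u_p) z^p,
-- with g a generator of ℤ/m, one has (gz - 1) F_σ(w)(z) = (z^m - 1) F_w(z^m): each use of this
-- identity strips one σ at the cost of one degree.  For factors of length at least 2m the first
-- moments already determine the phase modulo m and the letters of the partial blocks at both ends,
-- because no cube of a letter occurs in t_m.  Hence two factors of length n ≥ 2M are equivalent iff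
-- they start at the same phase r modulo M, their partial end blocks of size M come from the same
-- letters, and the letters of their whole blocks agree up to order.
--
-- Counting.  Put E(i) = t(⌊i/m⌋).  Then (g - 1) Ψ of the factor on [q, q + D) is
-- [t(q + D)] - [E(q + D)] - [t(q)] + [E(q)], so for each phase the classes are read off from
-- equalities between a few letters.  With both end blocks partial there are e_m classes; with one
-- end aligned the classes are, for each letter at the other end, unordered pairs of letters.

-- The delicate point is the recovery of the phase at the level of one σ. Besides the block letters,
-- the identity for F leaves two boundary terms at the last block, at its letter x and at x + s.
-- Testing them first at x and then at x + s turns any discrepancy into an impossible inequality of
-- lengths, provided that the blocks before the end do not all carry x. This proviso is where cubes
-- and the bound 2m enter. The constants of the count record where a block boundary can fall. Of the
-- m offsets of q in its block, exactly min(D, m) put q and q + D into different blocks. The letters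
-- E(q) and E(q + D) are then free, because D ≤ 2m keeps the two blocks at distance one or two and
-- every pair of letters occurs at both distances. At an aligned end the letter is no longer known
-- by itself, and only a formal sum [α] + [β] - [γ] survives. Cancellation in this sum merges many
-- configurations into one class; the others form unordered pairs whose smaller entry is bounded by
-- the distance to a boundary. Both alignments give the same number, so y_m is twice that number.

-- Subword counts of concatenations and binomial equivalence

pconv : (List ℕ → ℕ) → (List ℕ → ℕ) → List ℕ → ℕ
pconv F G []      = 0
pconv F G (a ∷ x) = F [] * G (a ∷ x) + pconv (F ∘ (a ∷_)) G x

pconv-zero : ∀ G x → pconv (λ _ → 0) G x ≡ 0
pconv-zero G []      = refl
pconv-zero G (a ∷ x) = pconv-zero G x

pconv-+ : ∀ F F′ G x → pconv (λ z → F z + F′ z) G x ≡ pconv F G x + pconv F′ G x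
pconv-+ F F′ G []      = refl
pconv-+ F F′ G (a ∷ x) = trans
  (cong ((F [] + F′ []) * G (a ∷ x) +_) (pconv-+ (F ∘ (a ∷_)) (F′ ∘ (a ∷_)) G x))
  (lemma (F []) (F′ []) (G (a ∷ x)) _ _)
  where
  lemma : ∀ f f′ g p q → (f + f′) * g + (p + q) ≡ f * g + p + (f′ * g + q)
  lemma = solve-∀

-- `pconv` sums over the splittings of `x` with nonempty right piece, so `F` only meets words
-- strictly shorter than `x`. `BinEq-swap` gains its extra degree from this.
pconv-cong : ∀ {m} {F F′ G G′} x → All (_< m) x →
  (∀ z → length z < length x → All (_< m) z → F z ≡ F′ z) →
  (∀ z → length z ≤ length x → All (_< m) z → G z ≡ G′ z) →
  pconv F G x ≡ pconv F′ G′ x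
pconv-cong []      []         _  _  = refl
pconv-cong (a ∷ x) (a<m ∷ ax) hF hG = cong₂ _+_
  (cong₂ _*_ (hF [] (s≤s z≤n) []) (hG (a ∷ x) ≤-refl (a<m ∷ ax)))
  (pconv-cong x ax (λ z z<x az → hF (a ∷ z) (s≤s z<x) (a<m ∷ az))
                   (λ z z≤x → hG z (m≤n⇒m≤1+n z≤x)))

binom-++ : ∀ u v x → binom (u ++ v) x ≡ pconv (binom u) (binom v) x + binom u x
binom-++ [] v []      = refl
binom-++ [] v (a ∷ x) = sym (trans (+-identityʳ _)
  (trans (cong (1 * binom v (a ∷ x) +_) (pconv-zero (binom v) x))
         (trans (+-identityʳ _) (*-identityˡ _))))
binom-++ (a ∷ u) v []      = refl
binom-++ (a ∷ u) v (b ∷ x) with a ≡ᵇ b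
... | true = trans (cong₂ _+_ (binom-++ u v x) (binom-++ u v (b ∷ x)))
  (trans (lemma (pconv (binom u) (binom v) x) (binom u x) (1 * binom v (b ∷ x)) _ _)
         (cong (λ p → 1 * binom v (b ∷ x) + p + (binom u x + binom u (b ∷ x)))
               (sym (pconv-+ (binom u) (binom u ∘ (b ∷_)) (binom v) x))))
  where
  lemma : ∀ p q g p′ q′ → p + q + (g + p′ + q′) ≡ g + (p + p′) + (q + q′)
  lemma = solve-∀
... | false = binom-++ u v (b ∷ x)

module _ {m : ℕ} where

  BinEq-trans : ∀ {k u v w} → BinEq m k u v → BinEq m k v w → BinEq m k u w
  BinEq-trans h₁ h₂ x lx ax = trans (h₁ x lx ax) (h₂ x lx ax)

  BinEq-∷ : ∀ {k u v} a → BinEq m k u v → BinEq m k (a ∷ u) (a ∷ v)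
  BinEq-∷ a h []      _  _ = refl
  BinEq-∷ a h (b ∷ x) lx (b<m ∷ ax) = cong₂ _+_
    (cong (λ z → if a ≡ᵇ b then z else 0) (h x (≤-trans (n≤1+n _) lx) ax))
    (h (b ∷ x) lx (b<m ∷ ax))

  -- Induction on the test word: the occurrences that use the leading `a` are counted by a shorter
  -- word, for which agreement is already known.
  BinEq-cancel-∷ : ∀ {k u v} a → BinEq m k (a ∷ u) (a ∷ v) → BinEq m k u v
  BinEq-cancel-∷ a h []      _  _ = refl
  BinEq-cancel-∷ {u = u} {v} a h (b ∷ x) lx (b<m ∷ ax) =
    +-cancelˡ-≡ (if a ≡ᵇ b then binom u x else 0) _ _
      (trans (h (b ∷ x) lx (b<m ∷ ax))
             (cong (λ z → (if a ≡ᵇ b then z else 0) + binom v (b ∷ x))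
                   (sym (BinEq-cancel-∷ {u = u} {v} a h x (≤-trans (n≤1+n _) lx) ax))))

  BinEq-++ˡ : ∀ {k u v} p → BinEq m k u v → BinEq m k (p ++ u) (p ++ v)
  BinEq-++ˡ []      h = h
  BinEq-++ˡ (a ∷ p) h = BinEq-∷ a (BinEq-++ˡ p h)

  BinEq-cancel-++ˡ : ∀ {k u v} p → BinEq m k (p ++ u) (p ++ v) → BinEq m k u v
  BinEq-cancel-++ˡ []      h = h
  BinEq-cancel-++ˡ (a ∷ p) h = BinEq-cancel-++ˡ p (BinEq-cancel-∷ a h)

  BinEq-++ʳ : ∀ {k u v} p → BinEq m k u v → BinEq m k (u ++ p) (v ++ p)
  BinEq-++ʳ {u = u} {v} p h x lx ax = trans (binom-++ u p x)
    (trans (cong₂ _+_ (pconv-cong x ax (λ z z<x → h z (≤-trans (<⇒≤ z<x) lx)) (λ _ _ _ → refl))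
                      (h x lx ax))
           (sym (binom-++ v p x)))

  -- Splitting an occurrence of x in uv into two proper pieces only involves words shorter than x,
  -- and the two improper splittings are exchanged when u and v are.
  BinEq-swap : ∀ {k u v} → BinEq m k u v → BinEq m (suc k) (u ++ v) (v ++ u)
  BinEq-swap {u = u} {v} h []      _         _          =
    trans (binom-++ u v []) (sym (binom-++ v u []))
  BinEq-swap {u = u} {v} h (a ∷ x) (s≤s lx) (a<m ∷ ax) =
    trans (binom-++ u v (a ∷ x)) (trans
      (trans (cong (λ z → 1 * binom v (a ∷ x) + z + binom u (a ∷ x))
               (pconv-cong x ax (λ z z<x az → h (a ∷ z) (≤-trans z<x lx) (a<m ∷ az))
                                (λ z z≤x az → sym (h z (≤-trans z≤x lx) az))))
             (lemma (binom v (a ∷ x)) _ (binom u (a ∷ x))))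
      (sym (binom-++ v u (a ∷ x))))
    where
    lemma : ∀ p q r → 1 * p + q + r ≡ 1 * r + q + p
    lemma = solve-∀

-- Iterates of σ and permutations of letters

-- The power σ^e, with the innermost σ exposed first: `pow m (suc e) [ a ]` is then `pow m e` of a
-- word that is a permutation of σ(b) for every b.
pow : ℕ → ℕ → List ℕ → List ℕ
pow m zero    w = w
pow m (suc e) w = pow m e (σ m w)

pow-++ : ∀ m e u v → pow m e (u ++ v) ≡ pow m e u ++ pow m e v
pow-++ m zero    u v = refl
pow-++ m (suc e) u v = trans (cong (pow m e) (concatMap-++ _ u v)) (pow-++ m e (σ m u) (σ m v))

addMod≡% : ∀ m .{{_ : NonZero m}} a b → addMod m a b ≡ (a + b) % m
addMod≡% (suc m) a b = refl

rotate : ∀ (f : ℕ → ℕ) n → f n ≡ f 0 → applyUpTo f n ↭ applyUpTo (f ∘ suc) n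
rotate f zero    _ = ↭-refl
rotate f (suc n) h = ↭-trans (∷↭∷ʳ (f 0) (applyUpTo (f ∘ suc) n))
  (↭-reflexive (trans (cong (applyUpTo (f ∘ suc) n ∷ʳ_) (sym h)) (applyUpTo-∷ʳ (f ∘ suc) n)))

applyUpTo-cong : ∀ {f g : ℕ → ℕ} n → (∀ i → i < n → f i ≡ g i) → applyUpTo f n ≡ applyUpTo g n
applyUpTo-cong zero    h = refl
applyUpTo-cong (suc n) h = cong₂ _∷_ (h 0 (s≤s z≤n)) (applyUpTo-cong n (λ i i<n → h (suc i) (s≤s i<n)))

σ-letter : ∀ m a → σ m [ a ] ≡ applyUpTo (addMod m a) m
σ-letter m a = trans (++-identityʳ _) (map-upTo (addMod m a) m)

-- σ(a + 1) is σ(a) with its first letter moved to the end, so all images of letters are rotations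
-- of σ(0).
σ-letter-↭ : ∀ m a → σ m [ a ] ↭ σ m [ 0 ]
σ-letter-↭ m zero    = ↭-refl
σ-letter-↭ m (suc a) = ↭-trans (↭-sym rot) (σ-letter-↭ m a)
  where
  wrap : ∀ m → addMod m a m ≡ addMod m a 0
  wrap zero    = refl
  wrap (suc m) = trans ([m+n]%n≡m%n a (suc m)) (cong (_% suc m) (sym (+-identityʳ a)))
  shift : ∀ m i → addMod m a (suc i) ≡ addMod m (suc a) i
  shift zero    i = refl
  shift (suc m) i = cong (_% suc m) (+-suc a i)
  rot : σ m [ a ] ↭ σ m [ suc a ]
  rot = ↭-trans (↭-reflexive (σ-letter m a)) (↭-trans (rotate (addMod m a) m (wrap m))
    (↭-reflexive (trans (applyUpTo-cong m (λ i _ → shift m i)) (sym (σ-letter m (suc a))))))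

mutual
  pow-letter : ∀ m e a b → BinEq m e (pow m e [ a ]) (pow m e [ b ])
  pow-letter m zero    a b [] _ _ = refl
  pow-letter m (suc e) a b =
    pow-↭ m e (↭-trans (σ-letter-↭ m a) (↭-sym (σ-letter-↭ m b)))

  pow-↭ : ∀ {u v} m e → u ↭ v → BinEq m (suc e) (pow m e u) (pow m e v)
  pow-↭ m e Perm.refl = λ _ _ _ → refl
  pow-↭ m e (Perm.prep {xs} {ys} a p) =
    subst₂ (BinEq m (suc e)) (sym (pow-++ m e [ a ] xs)) (sym (pow-++ m e [ a ] ys))
      (BinEq-++ˡ (pow m e [ a ]) (pow-↭ m e p))
  pow-↭ m e (Perm.swap {xs} {ys} a b p) =
    subst₂ (BinEq m (suc e)) (sym (regroup a b xs)) (sym (regroup b a ys))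
      (BinEq-trans {v = (pow m e [ b ] ++ pow m e [ a ]) ++ pow m e xs}
        (BinEq-++ʳ (pow m e xs) (BinEq-swap {u = pow m e [ a ]} (pow-letter m e a b)))
        (BinEq-++ˡ (pow m e [ b ] ++ pow m e [ a ]) (pow-↭ m e p)))
    where
    regroup : ∀ a b xs → pow m e (a ∷ b ∷ xs) ≡ (pow m e [ a ] ++ pow m e [ b ]) ++ pow m e xs
    regroup a b xs = trans (pow-++ m e (a ∷ b ∷ []) xs) (cong (_++ pow m e xs) (pow-++ m e [ a ] [ b ]))
  pow-↭ m e (Perm.trans {ys = ys} p q) = BinEq-trans {v = pow m e ys} (pow-↭ m e p) (pow-↭ m e q)

-- Finite sums

∑ : ℕ → (ℕ → ℕ) → ℕ
∑ zero    f = 0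
∑ (suc n) f = ∑ n f + f n

∑-cong : ∀ {f g} n → (∀ i → i < n → f i ≡ g i) → ∑ n f ≡ ∑ n g
∑-cong zero    h = refl
∑-cong (suc n) h = cong₂ _+_ (∑-cong n (λ i i<n → h i (m≤n⇒m≤1+n i<n))) (h n ≤-refl)

∑-zero : ∀ {f} n → (∀ i → i < n → f i ≡ 0) → ∑ n f ≡ 0
∑-zero zero    h = refl
∑-zero (suc n) h = cong₂ _+_ (∑-zero n (λ i i<n → h i (m≤n⇒m≤1+n i<n))) (h n ≤-refl)

∑-+ : ∀ f g n → ∑ n (λ i → f i + g i) ≡ ∑ n f + ∑ n g
∑-+ f g zero    = refl
∑-+ f g (suc n) = trans (cong (_+ (f n + g n)) (∑-+ f g n)) (lemma (∑ n f) (∑ n g) (f n) (g n))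
  where
  lemma : ∀ a b c d → a + b + (c + d) ≡ a + c + (b + d)
  lemma = solve-∀

∑-* : ∀ c f n → ∑ n (λ i → c * f i) ≡ c * ∑ n f
∑-* c f zero    = sym (*-zeroʳ c)
∑-* c f (suc n) = trans (cong (_+ c * f n) (∑-* c f n)) (sym (*-distribˡ-+ c (∑ n f) (f n)))

∑-const : ∀ c n → ∑ n (λ _ → c) ≡ n * c
∑-const c zero    = refl
∑-const c (suc n) = trans (cong (_+ c) (∑-const c n)) (+-comm (n * c) c)

∑-split : ∀ f a b → ∑ (a + b) f ≡ ∑ a f + ∑ b (λ i → f (a + i))
∑-split f a zero    = trans (cong (λ n → ∑ n f) (+-identityʳ a)) (sym (+-identityʳ _))
∑-split f a (suc b) = trans (cong (λ n → ∑ n f) (+-suc a b))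
  (trans (cong (_+ f (a + b)) (∑-split f a b)) (+-assoc (∑ a f) _ _))

∑-head : ∀ f n → ∑ (suc n) f ≡ f 0 + ∑ n (f ∘ suc)
∑-head f n = ∑-split f 1 n

∑-mono-≤ : ∀ {f g} n → (∀ i → i < n → f i ≤ g i) → ∑ n f ≤ ∑ n g
∑-mono-≤ zero    h = z≤n
∑-mono-≤ (suc n) h = +-mono-≤ (∑-mono-≤ n (λ i i<n → h i (m≤n⇒m≤1+n i<n))) (h n ≤-refl)

∑-comm : ∀ (f : ℕ → ℕ → ℕ) a b → ∑ a (λ i → ∑ b (f i)) ≡ ∑ b (λ j → ∑ a (λ i → f i j))
∑-comm f zero    b = sym (∑-zero b (λ _ _ → refl))
∑-comm f (suc a) b = trans (cong (_+ ∑ b (f a)) (∑-comm f a b))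
  (sym (∑-+ (λ j → ∑ a (λ i → f i j)) (f a) b))

-- Counting the classes of a relation

-- The predicate `P` allows a count to be assembled from disjoint pieces, and indexing by `Fin N`
-- turns pairwise inequivalence into injectivity.
record ClassesOn (P : ℕ → Set) (R : ℕ → ℕ → Set) (N : ℕ) : Set where
  constructor classes
  field
    rep   : Fin N → ℕ
    rep∈  : ∀ a → P (rep a)
    inj   : ∀ a b → R (rep a) (rep b) → a ≡ b
    cover : ∀ i → P i → ∃ λ a → R i (rep a)

module _ {P Q : ℕ → Set} {R : ℕ → ℕ → Set} where

  restate : ∀ {N} → (∀ i → P i → Q i) → (∀ i → Q i → P i) → ClassesOn P R N → ClassesOn Q R N
  restate f g (classes rep rep∈ inj cover) =
    classes rep (λ a → f _ (rep∈ a)) inj (λ i → cover i ∘ g i)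

  union : ∀ {K N} → (∀ i j → P i → Q j → ¬ R i j) → (∀ i j → Q i → P j → ¬ R i j) →
    ClassesOn P R K → ClassesOn Q R N → ClassesOn (λ i → P i ⊎ Q i) R (K + N)
  union {K} {N} pq qp (classes rep rep∈ inj cover) (classes rep′ rep∈′ inj′ cover′) =
    classes (choose ∘ splitAt K) (λ a → choose∈ (splitAt K a)) inj⁺ cover⁺
    where
    choose : Fin K ⊎ Fin N → ℕ
    choose = [ rep , rep′ ]′
    choose∈ : ∀ a → P (choose a) ⊎ Q (choose a)
    choose∈ (inj₁ a) = inj₁ (rep∈ a)
    choose∈ (inj₂ a) = inj₂ (rep∈′ a)
    choose-inj : ∀ a b → R (choose a) (choose b) → a ≡ b
    choose-inj (inj₁ a) (inj₁ b) r = cong inj₁ (inj a b r)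
    choose-inj (inj₁ a) (inj₂ b) r = contradiction r (pq _ _ (rep∈ a) (rep∈′ b))
    choose-inj (inj₂ a) (inj₁ b) r = contradiction r (qp _ _ (rep∈′ a) (rep∈ b))
    choose-inj (inj₂ a) (inj₂ b) r = cong inj₂ (inj′ a b r)
    inj⁺ : ∀ a b → R (choose (splitAt K a)) (choose (splitAt K b)) → a ≡ b
    inj⁺ a b r = trans (sym (join-splitAt K N a))
      (trans (cong (join K N) (choose-inj (splitAt K a) (splitAt K b) r)) (join-splitAt K N b))
    cover⁺ : ∀ i → P i ⊎ Q i → ∃ λ a → R i (choose (splitAt K a))
    cover⁺ i (inj₁ p) with cover i p
    ... | a , r = a ↑ˡ N , subst (R i ∘ choose) (sym (splitAt-↑ˡ K a N)) r
    cover⁺ i (inj₂ p) with cover′ i p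
    ... | a , r = K ↑ʳ a , subst (R i ∘ choose) (sym (splitAt-↑ʳ K N a)) r

module _ {P : ℕ → Set} {R : ℕ → ℕ → Set} where

  empty : (∀ i → ¬ P i) → ClassesOn P R 0
  empty h = classes (λ ()) (λ ()) (λ ()) (λ i p → contradiction p (h i))

  single : ∀ i → P i → (∀ i j → P i → P j → R i j) → ClassesOn P R 1
  single i p h = classes (λ _ → i) (λ _ → p) (λ { fzero fzero _ → refl }) (λ j q → fzero , h j i q p)

module _ {P : ℕ → Set} {R : ℕ → ℕ → Set} where

  -- No class straddles two fibres of an invariant, so the counts of the fibres add up. The counts
  -- below iterate this with successive invariants.
  partition : (h : ℕ → ℕ) (K : ℕ) (N : ℕ → ℕ) → (∀ i → P i → h i < K) →
    (∀ i j → P i → P j → R i j → h i ≡ h j) →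
    (∀ r → r < K → ClassesOn (λ i → P i × h i ≡ r) R (N r)) → ClassesOn P R (∑ K N)
  partition h K N bound invariant parts =
    restate (λ _ → proj₁) (λ i p → p , bound i p) (go K parts)
    where
    go : ∀ K → (∀ r → r < K → ClassesOn (λ i → P i × h i ≡ r) R (N r)) →
      ClassesOn (λ i → P i × h i < K) R (∑ K N)
    go zero    parts = empty (λ { i (_ , ()) })
    go (suc K) parts = restate
      (λ { i (inj₁ (p , h<K)) → p , m≤n⇒m≤1+n h<K ; i (inj₂ (p , h≡K)) → p , s≤s (≤-reflexive h≡K) })
      (λ { i (p , h≤K) → [ (λ h<K → inj₁ (p , h<K)) , (λ h≡K → inj₂ (p , h≡K)) ]′ (m≤n⇒m<n∨m≡n (≤-pred h≤K)) })
      (union (λ { i j (p , h<K) (q , h≡K) r → <⇒≢ h<K (trans (invariant i j p q r) h≡K) })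
             (λ { i j (p , h≡K) (q , h<K) r → <⇒≢ h<K (trans (sym (invariant i j p q r)) h≡K) })
             (go K (λ r r<K → parts r (m≤n⇒m≤1+n r<K))) (parts K ≤-refl))

  split-by : ∀ {K N} (Q : ℕ → Set) → (∀ i → Dec (Q i)) → (∀ i j → P i → P j → R i j → Q i → Q j) →
    (∀ i j → P i → P j → R i j → Q j → Q i) →
    ClassesOn (λ i → P i × Q i) R K → ClassesOn (λ i → P i × ¬ Q i) R N → ClassesOn P R (K + N)
  split-by Q Q? fwd bwd c c′ = restate (λ { i (inj₁ (p , _)) → p ; i (inj₂ (p , _)) → p }) decide
    (union (λ { i j (p , q) (p′ , ¬q) r → ¬q (fwd i j p p′ r q) })
           (λ { i j (p , ¬q) (p′ , q) r → ¬q (bwd i j p p′ r q) }) c c′)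
    where
    decide : ∀ i → P i → (P i × Q i) ⊎ (P i × ¬ Q i)
    decide i p with Q? i
    ... | yes q = inj₁ (p , q)
    ... | no ¬q = inj₂ (p , ¬q)

reindex : ∀ {P R S N} (f : ℕ → ℕ) → (∀ i → P i → ∃ λ j → i ≡ f j) → (∀ j → P (f j)) →
  (∀ i j → R (f i) (f j) → S i j) → (∀ i j → S i j → R (f i) (f j)) →
  ClassesOn (λ _ → ⊤) S N → ClassesOn P R N
reindex {P} {R} f onto into R⇒S S⇒R (classes rep _ inj cover) =
  classes (f ∘ rep) (λ a → into (rep a)) (λ a b r → inj a b (R⇒S _ _ r)) cover⁺
  where
  cover⁺ : ∀ i → P i → ∃ λ a → R i (f (rep a))
  cover⁺ i p with onto i p
  ... | j , refl with cover j tt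
  ...   | a , s = a , S⇒R j (rep a) s

ClassesOn⇒NumClasses : ∀ {R f N} → ClassesOn (λ _ → ⊤) (λ i j → R (f i) (f j)) N → NumClasses R f N
ClassesOn⇒NumClasses (classes rep _ inj cover) =
  tabulate rep , length-tabulate rep ,
  AllPairs.tabulate⁺ (λ {a} {b} a≢b r → a≢b (inj a b r)) ,
  λ i → Any.tabulate⁺ (proj₁ (cover i tt)) (proj₂ (cover i tt))

-- A redundant finite list of representatives is thinned: an entry is kept only if it is related to
-- none of those after it. This yields the abelian complexity, a number whose value is left open.
finitely-many : ∀ {R : ℕ → ℕ → Set} → (∀ {i} → R i i) → (∀ {i j} → R i j → R j i) → (∀ {i j k} → R i j → R j k → R i k) →
  (∀ i j → Dec (R i j)) → ∀ K (rep : Fin K → ℕ) → ∃ λ N → ClassesOn (λ i → ∃ λ a → R i (rep a)) R N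
finitely-many rfl sm tr R? zero    rep = 0 , empty (λ { i (() , _) })
finitely-many {R} rfl sm tr R? (suc K) rep with finitely-many rfl sm tr R? K (rep ∘ fsuc)
... | N , c with any-R? (rep fzero)
  where
  any-R? : ∀ i → Dec (∃ λ a → R i (rep (fsuc a)))
  any-R? i = any? (λ a → R? i (rep (fsuc a)))
...   | yes (a , r) = N , restate (λ { i (b , s) → fsuc b , s })
          (λ { i (fzero , s) → a , tr s r ; i (fsuc b , s) → b , s }) c
...   | no ¬r = 1 + N , restate
          (λ { i (inj₁ s) → fzero , s ; i (inj₂ (b , s)) → fsuc b , s })
          (λ { i (fzero , s) → inj₁ s ; i (fsuc b , s) → inj₂ (b , s) })
          (union (λ { i j s (b , s′) r → ¬r (b , tr (sm s) (tr r s′)) })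
                 (λ { i j (b , s′) s r → ¬r (b , tr (sm s) (tr (sm r) s′)) })
                 (single (rep fzero) rfl (λ i j s s′ → tr s (sm s′))) c)

module GeneralizedThueMorse (m : ℕ) .{{_ : NonZero m}} (2≤m : 2 ≤ m) where

  -- Congruence modulo m

  infix 4 _≋_
  _≋_ : ℕ → ℕ → Set
  a ≋ b = a % m ≡ b % m

  _≋?_ : ∀ a b → Dec (a ≋ b)
  a ≋? b = a % m ≟ b % m

  0<m : 0 < m
  0<m = ≤-trans (s≤s z≤n) 2≤m

  ≡⇒≋ : ∀ {a b} → a ≡ b → a ≋ b
  ≡⇒≋ = cong (_% m)

  +-cong-≋ : ∀ {a b c d} → a ≋ b → c ≋ d → a + c ≋ b + d
  +-cong-≋ {a} {b} {c} {d} p q = trans (%-distribˡ-+ a c m)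
    (trans (cong₂ (λ x y → (x + y) % m) p q) (sym (%-distribˡ-+ b d m)))

  +-congˡ-≋ : ∀ a {b c} → b ≋ c → a + b ≋ a + c
  +-congˡ-≋ a = +-cong-≋ {a} refl

  +-congʳ-≋ : ∀ {a b} c → a ≋ b → a + c ≋ b + c
  +-congʳ-≋ c p = +-cong-≋ p (refl {x = c % m})

  %-≋ : ∀ a → a % m ≋ a
  %-≋ a = m%n%n≡m%n a m

  +m-≋ : ∀ a → a + m ≋ a
  +m-≋ a = [m+n]%n≡m%n a m

  +km-≋ : ∀ a k → a + k * m ≋ a
  +km-≋ a k = [m+kn]%n≡m%n a k m

  neg : ℕ → ℕ
  neg a = m ∸ a % m

  neg-≋ : ∀ a → neg a + a ≋ 0
  neg-≋ a = trans (+-congˡ-≋ (neg a) (sym (%-≋ a)))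
    (trans (≡⇒≋ (m∸n+n≡m (<⇒≤ (m%n<n a m)))) (+m-≋ 0))

  +-cancelˡ-≋ : ∀ c {a b} → c + a ≋ c + b → a ≋ b
  +-cancelˡ-≋ c {a} {b} p = trans (sym (undo a)) (trans (+-congˡ-≋ (neg c) p) (undo b))
    where
    undo : ∀ x → neg c + (c + x) ≋ x
    undo x = trans (≡⇒≋ (sym (+-assoc (neg c) c x))) (+-congʳ-≋ x (neg-≋ c))

  +-cancelʳ-≋ : ∀ c {a b} → a + c ≋ b + c → a ≋ b
  +-cancelʳ-≋ c {a} {b} p =
    +-cancelˡ-≋ c (trans (≡⇒≋ (+-comm c a)) (trans p (≡⇒≋ (+-comm b c))))

  ≋⇒≡ : ∀ {a b} → a < m → b < m → a ≋ b → a ≡ b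
  ≋⇒≡ a<m b<m p = trans (sym (m<n⇒m%n≡m a<m)) (trans p (m<n⇒m%n≡m b<m))

  -- The coefficient at c of [x] in the group ring of ℤ/m. Formal sums of letters are compared
  -- coefficientwise, with negative terms moved across the equation.
  δ : ℕ → ℕ → ℕ
  δ x c = if does (x ≋? c) then 1 else 0

  δ-yes : ∀ {x c} → x ≋ c → δ x c ≡ 1
  δ-yes {x} {c} p = cong (if_then 1 else 0) (dec-true (x ≋? c) p)

  δ-no : ∀ {x c} → ¬ x ≋ c → δ x c ≡ 0
  δ-no {x} {c} p = cong (if_then 1 else 0) (dec-false (x ≋? c) p)

  δ≡1⇒≋ : ∀ {x c} → δ x c ≡ 1 → x ≋ c
  δ≡1⇒≋ {x} {c} p with x ≋? c
  ... | yes q = q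
  ... | no  q = contradiction (trans (sym p) (δ-no {x} {c} q)) λ ()

  δ≤1 : ∀ x c → δ x c ≤ 1
  δ≤1 x c with x ≋? c
  ... | yes p = ≤-reflexive (δ-yes {x} {c} p)
  ... | no ¬p = ≤-trans (≤-reflexive (δ-no {x} {c} ¬p)) z≤n

  δ-congˡ : ∀ {x y} c → x ≋ y → δ x c ≡ δ y c
  δ-congˡ c p = cong (λ z → if does (z ≟ c % m) then 1 else 0) p

  δ-congʳ : ∀ x {c d} → c ≋ d → δ x c ≡ δ x d
  δ-congʳ x p = cong (λ z → if does (x % m ≟ z) then 1 else 0) p

  δ-⇔ : ∀ {x c y d} → (x ≋ c → y ≋ d) → (y ≋ d → x ≋ c) → δ x c ≡ δ y d
  δ-⇔ {x} {c} {y} {d} f g with x ≋? c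
  ... | yes p = trans (δ-yes {x} {c} p) (sym (δ-yes {y} {d} (f p)))
  ... | no ¬p = trans (δ-no {x} {c} ¬p) (sym (δ-no {y} {d} (¬p ∘ g)))

  -- Multiplication by the generator g; `c + pred m` stands for c - 1.
  δ-pred : ∀ x c → δ (suc x) c ≡ δ x (c + pred m)
  δ-pred x c = δ-⇔ {suc x} {c} {x} {c + pred m}
    (λ p → trans (sym (+m-≋ x)) (trans (≡⇒≋ (shift x)) (+-congʳ-≋ (pred m) p)))
    (λ p → +-cancelʳ-≋ (pred m) (trans (≡⇒≋ (sym (shift x))) (trans (+m-≋ x) p)))
    where
    shift : ∀ x → x + m ≡ suc x + pred m
    shift x = trans (cong (x +_) (sym (suc-pred m))) (+-suc x (pred m))

  -- Letters of the fixed point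

  nth-++ˡ : ∀ u v {i} → i < length u → nth (u ++ v) i ≡ nth u i
  nth-++ˡ (a ∷ u) v {zero}  _         = refl
  nth-++ˡ (a ∷ u) v {suc i} (s≤s i<u) = nth-++ˡ u v i<u

  nth-++ʳ : ∀ u v i → nth (u ++ v) (length u + i) ≡ nth v i
  nth-++ʳ []      v i = refl
  nth-++ʳ (a ∷ u) v i = nth-++ʳ u v i

  nth-applyUpTo : ∀ f {n i} → i < n → nth (applyUpTo f n) i ≡ f i
  nth-applyUpTo f {suc n} {zero}  _         = refl
  nth-applyUpTo f {suc n} {suc i} (s≤s i<n) = nth-applyUpTo (f ∘ suc) i<n

  σ-block : ℕ → List ℕ
  σ-block a = map (addMod m a) (upTo m)

  length-σ-block : ∀ a → length (σ-block a) ≡ m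
  length-σ-block a = trans (length-map _ (upTo m)) (length-upTo m)

  length-σ : ∀ w → length (σ m w) ≡ length w * m
  length-σ []      = refl
  length-σ (a ∷ w) = trans (length-++ (σ-block a)) (cong₂ _+_ (length-σ-block a) (length-σ w))

  nth-σ : ∀ w q {j} → q < length w → j < m → nth (σ m w) (q * m + j) ≡ (nth w q + j) % m
  nth-σ (a ∷ w) zero {j} _ j<m =
    trans (nth-++ˡ (σ-block a) (σ m w) (subst (j <_) (sym (length-σ-block a)) j<m))
    (trans (cong (λ u → nth u j) (map-upTo (addMod m a) m))
    (trans (nth-applyUpTo (addMod m a) j<m) (addMod≡% m a j)))
  nth-σ (a ∷ w) (suc q) {j} (s≤s q<w) j<m =
    trans (cong (nth (σ m (a ∷ w))) (trans (+-assoc m (q * m) j)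
                                    (cong (_+ (q * m + j)) (sym (length-σ-block a)))))
    (trans (nth-++ʳ (σ-block a) (σ m w) (q * m + j)) (nth-σ w q q<w j<m))

  length-σ^ : ∀ K → length (σ^ m K) ≡ m ^ K
  length-σ^ zero    = refl
  length-σ^ (suc K) = trans (length-σ (σ^ m K)) (trans (cong (_* m) (length-σ^ K)) (*-comm (m ^ K) m))

  divMod≡ : ∀ i → i ≡ i / m * m + i % m
  divMod≡ i = trans (m≡m%n+[m/n]*n i m) (+-comm (i % m) _)

  /-< : ∀ {i} K → i < m ^ suc K → i / m < m ^ K
  /-< {i} K i< = m<n*o⇒m/o<n (subst (i <_) (*-comm m (m ^ K)) i<)

  nth-σ^-suc : ∀ K {i} → i < m ^ suc K → nth (σ^ m (suc K)) i ≡ (nth (σ^ m K) (i / m) + i % m) % m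
  nth-σ^-suc K {i} i< = trans (cong (nth (σ^ m (suc K))) (divMod≡ i))
    (nth-σ (σ^ m K) (i / m) (subst (i / m <_) (sym (length-σ^ K)) (/-< K i<)) (m%n<n i m))

  m^>0 : ∀ K → 0 < m ^ K
  m^>0 K = m^n>0 m K

  nth-σ^-zero : ∀ K → nth (σ^ m K) 0 ≡ 0
  nth-σ^-zero zero    = refl
  nth-σ^-zero (suc K) = trans (nth-σ^-suc K (m^>0 (suc K)))
    (trans (cong₂ (λ x y → (nth (σ^ m K) x + y) % m) (0/n≡0 m) (m<n⇒m%n≡m 0<m))
    (trans (cong (λ x → (x + 0) % m) (nth-σ^-zero K)) (m<n⇒m%n≡m 0<m)))

  σ^-prefix : ∀ K K′ {i} → i < m ^ K → i < m ^ K′ → nth (σ^ m K) i ≡ nth (σ^ m K′) i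
  σ^-prefix zero    K′       {zero} _ _ = sym (nth-σ^-zero K′)
  σ^-prefix zero    K′       {suc i} (s≤s ()) _
  σ^-prefix (suc K) zero     {zero} _ _ = nth-σ^-zero (suc K)
  σ^-prefix (suc K) zero     {suc i} _ (s≤s ())
  σ^-prefix (suc K) (suc K′) {i} p q = trans (nth-σ^-suc K p)
    (trans (cong (λ x → (x + i % m) % m) (σ^-prefix K K′ (/-< K p) (/-< K′ q))) (sym (nth-σ^-suc K′ q)))

  n<m^n : ∀ n → n < m ^ n
  n<m^n zero    = s≤s z≤n
  n<m^n (suc n) = begin-strict
    suc n               ≤⟨ n<m^n n ⟩
    m ^ n               <⟨ m<m+n (m ^ n) (m^>0 n) ⟩
    m ^ n + m ^ n       ≡⟨ cong (m ^ n +_) (sym (+-identityʳ _)) ⟩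
    2 * m ^ n           ≤⟨ *-monoˡ-≤ (m ^ n) 2≤m ⟩
    m * m ^ n           ∎
    where open ≤-Reasoning

  n<m^[1+n] : ∀ n → n < m ^ suc n
  n<m^[1+n] n = ≤-trans (n<m^n n) (m≤n*m (m ^ n) m)

  t-/ : ∀ i → t m i ≡ (t m (i / m) + i % m) % m
  t-/ i = trans (nth-σ^-suc i i<)
    (cong (λ x → (x + i % m) % m) (σ^-prefix i (suc (i / m)) (/-< i i<) (n<m^[1+n] (i / m))))
    where
    i< : i < m ^ suc i
    i< = n<m^[1+n] i

  -- Sealing `τ` keeps the iterates of σ from being unfolded. By `τ-/` and `τ-zero` it is the sum of
  -- the base-m digits modulo m.
  abstract
    τ : ℕ → ℕ
    τ = t m

    τ≡t : ∀ i → τ i ≡ t m i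
    τ≡t i = refl

    τ-/ : ∀ i → τ i ≡ (τ (i / m) + i % m) % m
    τ-/ = t-/

    τ-zero : τ 0 ≡ 0
    τ-zero = nth-σ^-zero 1

  τ<m : ∀ i → τ i < m
  τ<m i = subst (_< m) (sym (τ-/ i)) (m%n<n _ m)

  /-unique : ∀ M .{{_ : NonZero M}} q {j} → j < M → (q * M + j) / M ≡ q
  /-unique M q {j} j<M = trans (cong (_/ M) (+-comm (q * M) j))
    (trans (+-distrib-/ j (q * M) (subst (_< M) (sym (trans (cong₂ _+_ (m<n⇒m%n≡m j<M) (m*n%n≡0 q M)) (+-identityʳ j))) j<M))
    (cong₂ _+_ (m<n⇒m/n≡0 j<M) (m*n/n≡m q M)))

  %-unique : ∀ M .{{_ : NonZero M}} q {j} → j < M → (q * M + j) % M ≡ j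
  %-unique M q {j} j<M = trans (cong (_% M) (+-comm (q * M) j))
    (trans ([m+kn]%n≡m%n j q M) (m<n⇒m%n≡m j<M))

  τ-block : ∀ q {j} → j < m → τ (q * m + j) ≡ (τ q + j) % m
  τ-block q {j} j<m = trans (τ-/ (q * m + j))
    (cong₂ (λ x y → (τ x + y) % m) (/-unique m q j<m) (%-unique m q j<m))

  τ-block-≋ : ∀ q {j} → j < m → τ (q * m + j) ≋ τ q + j
  τ-block-≋ q {j} j<m = trans (≡⇒≋ (τ-block q j<m)) (%-≋ (τ q + j))

  τ-cong : ∀ {i j} → τ i ≋ τ j → τ i ≡ τ j
  τ-cong {i} {j} = ≋⇒≡ (τ<m i) (τ<m j)

  -- Digit sums add when the addition has no carries.
  τ-pow : ∀ e q {j} → j < m ^ e → τ (q * m ^ e + j) ≋ τ q + τ j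
  τ-pow zero q {zero} _ = ≡⇒≋ (trans (cong τ (trans (+-identityʳ _) (*-identityʳ q)))
    (trans (sym (+-identityʳ (τ q))) (cong (τ q +_) (sym τ-zero))))
  τ-pow zero q {suc j} (s≤s ())
  τ-pow (suc e) q {j} j< = trans (≡⇒≋ (cong τ regroup))
    (trans (τ-block-≋ (q * m ^ e + j / m) (m%n<n j m))
    (trans (+-congʳ-≋ (j % m) (τ-pow e q (/-< e j<)))
    (trans (≡⇒≋ (+-assoc (τ q) _ _))
           (+-congˡ-≋ (τ q) (trans (sym (τ-block-≋ (j / m) (m%n<n j m))) (≡⇒≋ (cong τ (sym (divMod≡ j)))))))))
    where
    lemma : ∀ q m p x y → q * (m * p) + (x * m + y) ≡ (q * p + x) * m + y
    lemma = solve-∀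
    regroup : q * (m * m ^ e) + j ≡ (q * m ^ e + j / m) * m + j % m
    regroup = trans (cong (q * (m * m ^ e) +_) (divMod≡ j)) (lemma q m (m ^ e) (j / m) (j % m))

  E : ℕ → ℕ
  E i = τ (i / m)

  -- The block of x reads x, x + 1, ..., x - 1. Either i + 1 stays in the block of i, or it opens a
  -- new block with that block's own letter while i carries x - 1.
  τ-step : ∀ i → (τ (suc i) ≋ suc (τ i) × E (suc i) ≡ E i) ⊎ (τ (suc i) ≡ E (suc i) × E i ≋ suc (τ i))
  τ-step i with suc (i % m) <? m
  ... | yes j<m = inj₁ (trans (≡⇒≋ (cong τ next)) (trans (τ-block-≋ (i / m) j<m)
          (trans (≡⇒≋ (+-suc _ _)) (+-congˡ-≋ 1 (trans (sym (%-≋ _)) (≡⇒≋ (sym (τ-/ i))))))) ,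
        cong τ (trans (cong (_/ m) next) (/-unique m (i / m) j<m)))
    where
    next : suc i ≡ i / m * m + suc (i % m)
    next = trans (cong suc (divMod≡ i)) (sym (+-suc _ _))
  ... | no j≮m = inj₂ (
        trans (cong τ next) (trans (τ-block (suc (i / m)) 0<m)
          (trans (cong (_% m) (+-identityʳ _)) (trans (m<n⇒m%n≡m (τ<m _))
          (cong τ (sym (trans (cong (_/ m) next) (/-unique m (suc (i / m)) 0<m))))))) ,
        trans (sym (+m-≋ (E i))) (trans (≡⇒≋ (trans (cong (E i +_) (sym last)) (+-suc _ _)))
          (+-congˡ-≋ 1 (trans (sym (%-≋ _)) (≡⇒≋ (sym (τ-/ i)))))))
    where
    last : suc (i % m) ≡ m
    last = ≤-antisym (m%n<n i m) (≮⇒≥ j≮m)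
    next : suc i ≡ suc (i / m) * m + 0
    next = trans (cong suc (divMod≡ i)) (trans (sym (+-suc _ _))
      (trans (cong (i / m * m +_) last) (trans (+-comm _ m) (sym (+-identityʳ _)))))

  ∑-single : ∀ f n {a} → a < n → (∀ b → b < n → b ≢ a → f b ≡ 0) → ∑ n f ≡ f a
  ∑-single f (suc n) {a} a<1+n h with a ≟ n
  ... | yes refl = cong (_+ f n) (∑-zero n (λ b b<n → h b (m≤n⇒m≤1+n b<n) (<⇒≢ b<n)))
  ... | no a≢n = trans (cong₂ _+_ (∑-single f n (≤∧≢⇒< (≤-pred a<1+n) a≢n) (λ b b<n → h b (m≤n⇒m≤1+n b<n))) (h n ≤-refl (a≢n ∘ sym)))
                       (+-identityʳ (f a))

  -- Subwords with free letters, and moments of positions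

  ∑words : ℕ → (List ℕ → ℕ) → ℕ
  ∑words zero    g = g []
  ∑words (suc d) g = ∑ m (λ a → ∑words d (g ∘ (a ∷_)))

  ∑words-cong : ∀ d {g h} → (∀ x → length x ≡ d → All (_< m) x → g x ≡ h x) → ∑words d g ≡ ∑words d h
  ∑words-cong zero    p = p [] refl []
  ∑words-cong (suc d) p = ∑-cong m (λ a a<m → ∑words-cong d (λ x lx ax → p (a ∷ x) (cong suc lx) (a<m ∷ ax)))

  ∑words-+ : ∀ d g h → ∑words d (λ x → g x + h x) ≡ ∑words d g + ∑words d h
  ∑words-+ zero    g h = refl
  ∑words-+ (suc d) g h = trans (∑-cong m (λ a _ → ∑words-+ d (g ∘ (a ∷_)) (h ∘ (a ∷_)))) (∑-+ _ _ m)

  ∑words-zero : ∀ d {g} → (∀ x → g x ≡ 0) → ∑words d g ≡ 0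
  ∑words-zero zero    p = p []
  ∑words-zero (suc d) p = ∑-zero m (λ a _ → ∑words-zero d (λ x → p (a ∷ x)))

  -- With the first d letters free, an occurrence of c at position p is the end of binomial(p, d)
  -- subwords; `wild≡Mom` makes this a moment over the positions of c.
  wild : List ℕ → ℕ → ℕ → ℕ
  wild u d c = ∑words d (λ x → binom u (x ∷ʳ c))

  binom-[]-∷ʳ : ∀ x c → binom [] (x ∷ʳ c) ≡ 0
  binom-[]-∷ʳ []      c = refl
  binom-[]-∷ʳ (a ∷ x) c = refl

  ≡ᵇ-refl : ∀ a → (a ≡ᵇ a) ≡ true
  ≡ᵇ-refl zero    = refl
  ≡ᵇ-refl (suc a) = ≡ᵇ-refl a

  ≢⇒≡ᵇ-false : ∀ a b → a ≢ b → (a ≡ᵇ b) ≡ false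
  ≢⇒≡ᵇ-false a b a≢b = dec-false (a ≟ b) a≢b

  wild-suc : ∀ {a} u d c → a < m → wild (a ∷ u) (suc d) c ≡ wild u d c + wild u (suc d) c
  wild-suc {a} u d c a<m = trans
    (∑-cong m (λ b _ → ∑words-+ d (λ x → if a ≡ᵇ b then binom u (x ∷ʳ c) else 0) _))
    (trans (∑-+ (λ b → ∑words d (λ x → if a ≡ᵇ b then binom u (x ∷ʳ c) else 0)) _ m)
    (cong (_+ wild u (suc d) c)
      (trans (∑-single _ m a<m (λ b _ b≢a → ∑words-zero d (λ x →
               cong (if_then binom u (x ∷ʳ c) else 0) (≢⇒≡ᵇ-false a b (b≢a ∘ sym)))))
             (∑words-cong d (λ x _ _ → cong (if_then binom u (x ∷ʳ c) else 0) (≡ᵇ-refl a))))))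

  ch : ℕ → ℕ → ℕ
  ch p       zero    = 1
  ch zero    (suc d) = 0
  ch (suc p) (suc d) = ch p d + ch p (suc d)

  *-ch : ∀ p d → p * ch p d ≡ suc d * ch p (suc d) + d * ch p d
  *-ch zero    zero    = refl
  *-ch zero    (suc d) = sym (cong₂ _+_ (*-zeroʳ d) (*-zeroʳ d))
  *-ch (suc p) zero    = trans (cong suc (*-ch p zero)) (lemma (ch p 1))
    where
    lemma : ∀ x → suc (1 * x + 0 * 1) ≡ 1 * (1 + x) + 0 * 1
    lemma = solve-∀
  *-ch (suc p) (suc d) = trans (expand p (ch p d) (ch p (suc d)))
    (trans (cong₂ (λ a b → ch p d + ch p (suc d) + (a + b)) (*-ch p d) (*-ch p (suc d)))
           (lemma d (ch p d) (ch p (suc d)) (ch p (suc (suc d)))))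
    where
    expand : ∀ p a b → suc p * (a + b) ≡ a + b + (p * a + p * b)
    expand = solve-∀
    lemma : ∀ d a b c → a + b + (suc d * b + d * a + (suc (suc d) * c + suc d * b))
                      ≡ suc (suc d) * (b + c) + suc d * (a + b)
    lemma = solve-∀

  Mom : (ℕ → ℕ) → ℕ → ℕ → (ℕ → ℕ) → ℕ
  Mom a n c f = ∑ n (λ p → δ (a p) c * f p)

  Mom-head : ∀ a n c f → Mom a (suc n) c f ≡ δ (a 0) c * f 0 + Mom (a ∘ suc) n c (f ∘ suc)
  Mom-head a n c f = ∑-head (λ p → δ (a p) c * f p) n

  Mom-+ : ∀ a n c f g → Mom a n c (λ p → f p + g p) ≡ Mom a n c f + Mom a n c g
  Mom-+ a n c f g = trans (∑-cong n (λ p _ → *-distribˡ-+ (δ (a p) c) (f p) (g p))) (∑-+ _ _ n)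

  Mom-* : ∀ a n c s f → Mom a n c (λ p → s * f p) ≡ s * Mom a n c f
  Mom-* a n c s f = trans (∑-cong n (λ p _ → lemma (δ (a p) c) s (f p))) (∑-* s _ n)
    where
    lemma : ∀ x y z → x * (y * z) ≡ y * (x * z)
    lemma = solve-∀

  Mom-cong : ∀ a n c {f g} → (∀ p → f p ≡ g p) → Mom a n c f ≡ Mom a n c g
  Mom-cong a n c h = ∑-cong n (λ p _ → cong (δ (a p) c *_) (h p))

  ind≡δ : ∀ {a c} → a < m → c < m → (if a ≡ᵇ c then 1 else 0) ≡ δ a c
  ind≡δ a<m c<m = cong₂ (λ x y → if x ≡ᵇ y then 1 else 0) (sym (m<n⇒m%n≡m a<m)) (sym (m<n⇒m%n≡m c<m))

  wild≡Mom : ∀ a n d {c} → (∀ p → a p < m) → c < m → wild (applyUpTo a n) d c ≡ Mom a n c (λ p → ch p d)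
  wild≡Mom a zero    d       {c} _  _   = ∑words-zero d (λ x → binom-[]-∷ʳ x c)
  wild≡Mom a (suc n) zero    {c} am c<m = trans
    (cong₂ _+_ (trans (ind≡δ (am 0) c<m) (sym (*-identityʳ _))) (wild≡Mom (a ∘ suc) n 0 (am ∘ suc) c<m))
    (sym (Mom-head a n c (λ p → ch p 0)))
  wild≡Mom a (suc n) (suc d) {c} am c<m = trans (wild-suc (applyUpTo (a ∘ suc) n) d c (am 0))
    (trans (cong₂ _+_ (wild≡Mom (a ∘ suc) n d (am ∘ suc) c<m) (wild≡Mom (a ∘ suc) n (suc d) (am ∘ suc) c<m))
    (trans (sym (Mom-+ (a ∘ suc) n c (λ p → ch p d) (λ p → ch p (suc d))))
    (sym (trans (Mom-head a n c (λ p → ch p (suc d)))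
                (cong (_+ Mom (a ∘ suc) n c (λ p → ch (suc p) (suc d))) (*-zeroʳ (δ (a 0) c)))))))

  module Moments (a b : ℕ → ℕ) (n : ℕ) where

    SameMom : (ℕ → ℕ) → Set
    SameMom f = ∀ c → Mom a n c f ≡ Mom b n c f

    same-cong : ∀ {f g} → (∀ p → f p ≡ g p) → SameMom f → SameMom g
    same-cong h s c = trans (sym (Mom-cong a n c h)) (trans (s c) (Mom-cong b n c h))

    same-+ : ∀ {f g} → SameMom f → SameMom g → SameMom (λ p → f p + g p)
    same-+ {f} {g} p q c = trans (Mom-+ a n c f g) (trans (cong₂ _+_ (p c) (q c)) (sym (Mom-+ b n c f g)))

    same-* : ∀ {f} s → SameMom f → SameMom (λ p → s * f p)
    same-* {f} s p c = trans (Mom-* a n c s f) (trans (cong (s *_) (p c)) (sym (Mom-* b n c s f)))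

    same-cancel-+ : ∀ {f g} → SameMom (λ p → f p + g p) → SameMom g → SameMom f
    same-cancel-+ {f} {g} p q c = +-cancelʳ-≡ (Mom a n c g) _ _
      (trans (sym (Mom-+ a n c f g)) (trans (p c) (trans (Mom-+ b n c f g) (cong (Mom b n c f +_) (sym (q c))))))

    same-cancel-* : ∀ {f} s .{{_ : NonZero s}} → SameMom (λ p → s * f p) → SameMom f
    same-cancel-* {f} s p c = *-cancelˡ-≡ _ _ s (trans (sym (Mom-* a n c s f)) (trans (p c) (Mom-* b n c s f)))

    Same< : ℕ → Set
    Same< k = ∀ {d} → d < k → SameMom (_^ d)

    -- By `*-ch`, p times binomial(p, d) is a natural combination of binomial(p, d + 1) and
    -- binomial(p, d). Each factor p therefore costs one degree.
    ch⇒pow : ∀ {k} → (∀ {d} → d < k → SameMom (λ p → ch p d)) → Same< k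
    ch⇒pow {k} h {d} d<k = same-cong (λ p → *-identityʳ (p ^ d))
      (go d 0 (subst (_< k) (sym (+-identityʳ d)) d<k))
      where
      go : ∀ e d → e + d < k → SameMom (λ p → p ^ e * ch p d)
      go zero    d h′ = same-cong (λ p → sym (*-identityˡ _)) (h h′)
      go (suc e) d h′ = same-cong eq
        (same-+ (same-* (suc d) (go e (suc d) (subst (_< k) (sym (+-suc e d)) h′)))
                (same-* d (go e d (≤-trans (n≤1+n _) h′))))
        where
        rearrange : ∀ d x u v → suc d * (x * u) + d * (x * v) ≡ x * (suc d * u + d * v)
        rearrange = solve-∀
        rearrange′ : ∀ p x v → x * (p * v) ≡ p * x * v
        rearrange′ = solve-∀
        eq : ∀ p → suc d * (p ^ e * ch p (suc d)) + d * (p ^ e * ch p d) ≡ p ^ suc e * ch p d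
        eq p = trans (rearrange d (p ^ e) (ch p (suc d)) (ch p d))
          (trans (cong (p ^ e *_) (sym (*-ch p d))) (rearrange′ p (p ^ e) (ch p d)))

    -- A product of d linear factors with natural coefficients is a natural combination of powers.
    pow⇒product : ∀ {k} → Same< k → (s : ℕ → ℕ) → (Q : ℕ → ℕ → ℕ) → (∀ p → Q 0 p ≡ 1) →
      (∀ d p → Q (suc d) p ≡ (p + s d) * Q d p) → ∀ {d} → d < k → SameMom (Q d)
    pow⇒product {k} h s Q Q0 Qs {d} d<k = same-cong (λ p → *-identityˡ (Q d p)) (go d 0 d<k′)
      where
      d<k′ : d + 0 < k
      d<k′ = subst (_< k) (sym (+-identityʳ d)) d<k
      go : ∀ d e → d + e < k → SameMom (λ p → p ^ e * Q d p)
      go zero    e h′ = same-cong (λ p → sym (trans (cong (p ^ e *_) (Q0 p)) (*-identityʳ _))) (h h′)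
      go (suc d) e h′ = same-cong eq
        (same-+ (go d (suc e) (subst (_< k) (sym (+-suc d e)) h′)) (same-* (s d) (go d e (≤-trans (n≤1+n _) h′))))
        where
        rearrange : ∀ p s x q → p * x * q + s * (x * q) ≡ x * ((p + s) * q)
        rearrange = solve-∀
        eq : ∀ p → p ^ suc e * Q d p + s d * (p ^ e * Q d p) ≡ p ^ e * Q (suc d) p
        eq p = trans (rearrange p (s d) (p ^ e) (Q d p)) (cong (p ^ e *_) (sym (Qs d p)))

    -- A power is a product minus terms of lower degree; the subtraction is carried out by
    -- cancelling moments already known to agree.
    product⇒pow : ∀ {k} → (s : ℕ → ℕ) → (Q : ℕ → ℕ → ℕ) → (∀ p → Q 0 p ≡ 1) →
      (∀ d p → Q (suc d) p ≡ (p + s d) * Q d p) → (∀ {d} → d < k → SameMom (Q d)) → Same< k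
    product⇒pow {k} s Q Q0 Qs h {d} d<k =
      same-cong (λ p → trans (cong (p ^ d *_) (Q0 p)) (*-identityʳ _))
        (go d 0 (subst (_< k) (sym (+-identityʳ d)) d<k))
      where
      go : ∀ e d → e + d < k → SameMom (λ p → p ^ e * Q d p)
      go zero    d h′ = same-cong (λ p → sym (*-identityˡ _)) (h h′)
      go (suc e) d h′ = same-cancel-+ {g = λ p → s d * (p ^ e * Q d p)}
        (same-cong eq (go e (suc d) (subst (_< k) (sym (+-suc e d)) h′)))
        (same-* (s d) (go e d (≤-trans (n≤1+n _) h′)))
        where
        rearrange : ∀ p s x q → x * ((p + s) * q) ≡ p * x * q + s * (x * q)
        rearrange = solve-∀
        eq : ∀ p → p ^ e * Q (suc d) p ≡ p ^ suc e * Q d p + s d * (p ^ e * Q d p)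
        eq p = trans (cong (p ^ e *_) (Qs d p)) (rearrange p (s d) (p ^ e) (Q d p))

    same-%⇒same : ∀ {f} → (∀ c → c < m → Mom a n c f ≡ Mom b n c f) → SameMom f
    same-%⇒same {f} h c = trans (reduce a) (trans (h (c % m) (m%n<n c m)) (sym (reduce b)))
      where
      reduce : ∀ a → Mom a n c f ≡ Mom a n (c % m) f
      reduce a = ∑-cong n (λ p _ → cong (_* f p) (δ-congʳ (a p) (sym (%-≋ c))))

    BinEq⇒Same< : ∀ {k} → (∀ p → a p < m) → (∀ p → b p < m) →
      BinEq m k (applyUpTo a n) (applyUpTo b n) → Same< k
    BinEq⇒Same< {k} am bm h = ch⇒pow (λ {d} d<k → same-%⇒same (λ c c<m →
      trans (sym (wild≡Mom a n d am c<m))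
      (trans (∑words-cong d (λ x lx ax → h (x ∷ʳ c)
                (≤-trans (≤-reflexive (trans (length-++ x) (trans (cong (_+ 1) lx) (+-comm d 1)))) d<k)
                (∷ʳ⁺ ax c<m)))
             (wild≡Mom b n d bm c<m))))

    Same<⇒BinEq1 : (∀ p → a p < m) → (∀ p → b p < m) → Same< 1 → BinEq m 1 (applyUpTo a n) (applyUpTo b n)
    Same<⇒BinEq1 am bm h []          _  _            = refl
    Same<⇒BinEq1 am bm h (c ∷ [])    _  (c<m ∷ [])   =
      trans (wild≡Mom a n 0 am c<m) (trans (h (s≤s z≤n) c) (sym (wild≡Mom b n 0 bm c<m)))
    Same<⇒BinEq1 am bm h (_ ∷ _ ∷ _) (s≤s ()) _

  occurs : ∀ a v → 0 < binom v [ a ] → ∃ λ w → v ↭ a ∷ w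
  occurs a []      ()
  occurs a (b ∷ v) h with b ≟ a
  ... | yes refl = v , ↭-refl
  ... | no b≢a with occurs a v (subst (λ z → 0 < (if z then 1 else 0) + binom v [ a ]) (≢⇒≡ᵇ-false b a b≢a) h)
  ...   | w , p = b ∷ w , ↭-trans (↭-prep b p) (Perm.swap b a ↭-refl)

  binom-head>0 : ∀ a u → 0 < binom (a ∷ u) [ a ]
  binom-head>0 a u = subst (λ z → 0 < (if z then 1 else 0) + binom u [ a ]) (sym (≡ᵇ-refl a)) (s≤s z≤n)

  BinEq1⇒↭ : ∀ {u v} → All (_< m) u → All (_< m) v → BinEq m 1 u v → u ↭ v
  BinEq1⇒↭ {[]} {[]}    _ _          h = ↭-refl
  BinEq1⇒↭ {[]} {b ∷ v} _ (b<m ∷ _) h =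
    contradiction (subst (0 <_) (sym (h [ b ] ≤-refl (b<m ∷ []))) (binom-head>0 b v)) λ ()
  BinEq1⇒↭ {a ∷ u} {v} (a<m ∷ au) av h
    with occurs a v (subst (0 <_) (h [ a ] ≤-refl (a<m ∷ [])) (binom-head>0 a u))
  ... | w , p with All-resp-↭ p av
  ...   | _ ∷ aw = ↭-trans (↭-prep a (BinEq1⇒↭ au aw (BinEq-cancel-∷ {u = u} {v = w} a
                     (BinEq-trans {u = a ∷ u} {v = v} {w = a ∷ w} h (pow-↭ m 0 p))))) (↭-sym p)

  -- Necessity: moments determine the block structure

  -- Equal neighbours are separated by a block boundary, so the middle letter of a cube would be a
  -- whole block, against m ≥ 2.
  τ-no-cube : ∀ j → τ j ≋ τ (suc j) → τ (suc j) ≋ τ (suc (suc j)) → ⊥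
  τ-no-cube j p q = go (τ-step j) (τ-step (suc j))
    where
    x≋̸1+x : ∀ x → ¬ x ≋ suc x
    x≋̸1+x x h = contradiction (≋⇒≡ 0<m 2≤m (+-cancelˡ-≋ x
      (trans (≡⇒≋ (+-identityʳ x)) (trans h (≡⇒≋ (+-comm 1 x)))))) λ ()
    go : _ → _ → ⊥
    go (inj₁ (h , _)) _               = x≋̸1+x (τ j) (trans p h)
    go (inj₂ _)       (inj₁ (h , _)) = x≋̸1+x (τ (suc j)) (trans q h)
    go (inj₂ (h , _)) (inj₂ (_ , h′)) = x≋̸1+x (τ (suc j)) (trans (≡⇒≋ h) h′)

  ∑-mono-< : ∀ {f g} n {j} → (∀ i → i < n → f i ≤ g i) → j < n → f j < g j → ∑ n f < ∑ n g
  ∑-mono-< (suc n) {j} h j<1+n fj<gj with j ≟ n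
  ... | yes refl = +-mono-≤-< (∑-mono-≤ n (λ i i<n → h i (m≤n⇒m≤1+n i<n))) fj<gj
  ... | no j≢n = +-mono-<-≤ (∑-mono-< n (λ i i<n → h i (m≤n⇒m≤1+n i<n)) (≤∧≢⇒< (≤-pred j<1+n) j≢n) fj<gj)
                            (h n ≤-refl)

  -- Raising letter and position together by one fixes the interior of each block. The sum
  -- telescopes to the block letter x at the start of the block and x + m = x at its end, and to x
  -- and x + s for the last piece. The bound `s ≤ m` includes m so that the induction can pass from
  -- (ℓ, m) to (ℓ + 1, 0).
  block-sum : ∀ q c f ℓ s → s ≤ m →
    ∑ (ℓ * m + s) (λ P → δ (suc (τ (q * m + P))) c * f (suc P)) +
      (∑ ℓ (λ J → δ (τ (q + J)) c * f (J * m)) + δ (τ (q + ℓ)) c * f (ℓ * m))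
    ≡ ∑ (ℓ * m + s) (λ P → δ (τ (q * m + P)) c * f P) +
      (∑ ℓ (λ J → δ (τ (q + J)) c * f (suc J * m)) + δ (τ (q + ℓ) + s) c * f (ℓ * m + s))
  block-sum q c f zero    zero    _   =
    cong (λ z → 0 + (0 + z * f 0)) (δ-congˡ c (≡⇒≋ (sym (+-identityʳ (τ (q + 0))))))
  block-sum q c f (suc ℓ) zero    _   = trans
    (cong₂ (λ N y → ∑ N S⁺ + (B + y)) N≡ refl)
    (trans (sym (+-assoc (∑ (ℓ * m + m) S⁺) B Y))
    (trans (cong (_+ Y) (block-sum q c f ℓ m ≤-refl))
    (trans (+-assoc (∑ (ℓ * m + m) S) _ Y)
    (cong₂ _+_ (cong (λ N → ∑ N S) (sym N≡))
      (cong₂ _+_ (cong (∑ ℓ (λ J → δ (τ (q + J)) c * f (suc J * m)) +_)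
                       (cong₂ _*_ (δ-congˡ c (+m-≋ (τ (q + ℓ)))) (cong f (+-comm (ℓ * m) m))))
                 (cong₂ _*_ (δ-congˡ c (≡⇒≋ (sym (+-identityʳ _)))) (cong f (sym (+-identityʳ _)))))))))
    where
    S⁺ = λ P → δ (suc (τ (q * m + P))) c * f (suc P)
    S  = λ P → δ (τ (q * m + P)) c * f P
    B = ∑ ℓ (λ J → δ (τ (q + J)) c * f (J * m)) + δ (τ (q + ℓ)) c * f (ℓ * m)
    Y = δ (τ (q + suc ℓ)) c * f (suc ℓ * m)
    N≡ : suc ℓ * m + 0 ≡ ℓ * m + m
    N≡ = trans (+-identityʳ _) (+-comm m (ℓ * m))
  block-sum q c f ℓ       (suc s) s<m = trans
    (cong (λ N → ∑ N S⁺ + B) (+-suc (ℓ * m) s))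
    (trans (swap₁ (∑ (ℓ * m + s) S⁺) (S⁺ (ℓ * m + s)) B)
    (trans (cong (_+ S⁺ (ℓ * m + s)) (block-sum q c f ℓ s (<⇒≤ s<m)))
    (trans (swap₂ (∑ (ℓ * m + s) S) C′ (δ (τ (q + ℓ) + s) c * f (ℓ * m + s)) (S⁺ (ℓ * m + s)))
    (cong₂ _+_ (trans (cong (∑ (ℓ * m + s) S +_) (cong (_* f (ℓ * m + s)) (δ-congˡ c (sym letter))))
                      (cong (λ N → ∑ N S) (sym (+-suc (ℓ * m) s))))
               (cong (C′ +_) (cong₂ _*_ (δ-congˡ c (trans (+-congˡ-≋ 1 letter) (≡⇒≋ (sym (+-suc _ s)))))
                                        (cong f (sym (+-suc (ℓ * m) s)))))))))
    where
    S⁺ = λ P → δ (suc (τ (q * m + P))) c * f (suc P)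
    S  = λ P → δ (τ (q * m + P)) c * f P
    B = ∑ ℓ (λ J → δ (τ (q + J)) c * f (J * m)) + δ (τ (q + ℓ)) c * f (ℓ * m)
    C′ = ∑ ℓ (λ J → δ (τ (q + J)) c * f (suc J * m))
    swap₁ : ∀ a x b → a + x + b ≡ a + b + x
    swap₁ = solve-∀
    swap₂ : ∀ a b d x → a + (b + d) + x ≡ a + d + (b + x)
    swap₂ = solve-∀
    regroup : ∀ q ℓ m s → q * m + (ℓ * m + s) ≡ (q + ℓ) * m + s
    regroup = solve-∀
    letter : τ (q * m + (ℓ * m + s)) ≋ τ (q + ℓ) + s
    letter = trans (≡⇒≋ (cong τ (regroup q ℓ m s))) (τ-block-≋ (q + ℓ) s<m)

  -- The ℓ blocks include the first one, even when r ≠ 0 and only its last M - r letters lie in the factor.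
  record Match (M n i i′ : ℕ) : Set where
    constructor mkMatch
    field
      q q′ r ℓ s : ℕ
      start  : i ≡ q * M + r
      start′ : i′ ≡ q′ * M + r
      length≡ : r + n ≡ ℓ * M + s
      r<M : r < M
      s<M : s < M
      first : r ≢ 0 → τ q ≡ τ q′
      last  : s ≢ 0 → τ (q + ℓ) ≡ τ (q′ + ℓ)
      middle : ∀ c → ∑ ℓ (λ J → δ (τ (q + J)) c) ≡ ∑ ℓ (λ J → δ (τ (q′ + J)) c)

  -- With the weight P ↦ P ∸ r, which vanishes on the r positions before the factor, block-sum
  -- turns the first moments of a factor into an equation between its block letters.
  module Base (q r ℓ s n : ℕ) (r<m : r < m) (s<m : s < m) (len : r + n ≡ ℓ * m + s) (2m≤n : 2 * m ≤ n) where

    -- How many letters of block `J` lie in the factor: m - r for the first block, m for the others.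
    -- Thus `A c` counts the letters lying in blocks of letter c, and `T` those in all `ℓ` blocks.
    gap : ℕ → ℕ
    gap J = (suc J * m ∸ r) ∸ (J * m ∸ r)

    T : ℕ
    T = ℓ * m ∸ r

    A : ℕ → ℕ
    A c = ∑ ℓ (λ J → δ (τ (q + J)) c * gap J)

    gap-step : ∀ J → suc J * m ∸ r ≡ (J * m ∸ r) + gap J
    gap-step J = sym (m+[n∸m]≡n (∸-monoˡ-≤ r (m≤n+m (J * m) m)))

    gap-suc : ∀ J → gap (suc J) ≡ m
    gap-suc J = trans (cong (_∸ (suc J * m ∸ r)) (+-∸-assoc m (≤-trans (<⇒≤ r<m) (m≤m+n m (J * m)))))
      (m+n∸n≡m m (suc J * m ∸ r))

    gap-zero : gap 0 ≡ m ∸ r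
    gap-zero = cong₂ _∸_ (cong (_∸ r) (+-identityʳ m)) (0∸n≡0 r)

    gap>0 : ∀ J → 0 < gap J
    gap>0 zero    = subst (0 <_) (sym gap-zero) (m<n⇒0<n∸m r<m)
    gap>0 (suc J) = subst (0 <_) (sym (gap-suc J)) 0<m

    ∑gap : ∀ ℓ → ∑ ℓ gap ≡ ℓ * m ∸ r
    ∑gap zero    = sym (0∸n≡0 r)
    ∑gap (suc ℓ) = trans (cong (_+ gap ℓ) (∑gap ℓ)) (sym (gap-step ℓ))

    2≤ℓ : 2 ≤ ℓ
    2≤ℓ = ≮⇒≥ λ ℓ<2 → <-irrefl refl (begin-strict
      r + n           ≡⟨ len ⟩
      ℓ * m + s       <⟨ +-monoʳ-< (ℓ * m) s<m ⟩
      ℓ * m + m       ≤⟨ +-monoˡ-≤ m (*-monoˡ-≤ m (≤-pred ℓ<2)) ⟩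
      1 * m + m       ≡⟨ +-comm (1 * m) m ⟩
      2 * m           ≤⟨ 2m≤n ⟩
      n               ≤⟨ m≤n+m n r ⟩
      r + n           ∎)
      where open ≤-Reasoning

    m≤ℓm : m ≤ ℓ * m
    m≤ℓm = m≤n*m m ℓ {{>-nonZero (≤-trans (s≤s z≤n) 2≤ℓ)}}

    n≡T+s : n ≡ T + s
    n≡T+s = +-cancelˡ-≡ r _ _ (trans len (trans (cong (_+ s) (sym (m+[n∸m]≡n (≤-trans (<⇒≤ r<m) m≤ℓm)))) (+-assoc r T s)))

    A≤T : ∀ c → A c ≤ T
    A≤T c = ≤-trans (∑-mono-≤ ℓ (λ J _ → ≤-trans (*-monoˡ-≤ (gap J) (δ≤1 (τ (q + J)) c)) (≤-reflexive (*-identityˡ _))))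
      (≤-reflexive (∑gap ℓ))

    full⇒≋ : ∀ c → T ≤ A c → ∀ J → J < ℓ → τ (q + J) ≋ c
    full⇒≋ c T≤A J J<ℓ with τ (q + J) ≋? c
    ... | yes p = p
    ... | no ¬p = contradiction T≤A (<⇒≱ (subst (A c <_) (∑gap ℓ) (∑-mono-< ℓ
            (λ J _ → ≤-trans (*-monoˡ-≤ (gap J) (δ≤1 (τ (q + J)) c)) (≤-reflexive (*-identityˡ _)))
            J<ℓ (subst (_< gap J) (sym (cong (_* gap J) (δ-no {τ (q + J)} {c} ¬p))) (gap>0 J)))))

    -- Equality would give all `ℓ` blocks the letter of block q + ℓ; since ℓ ≥ 2, the last two of
    -- them and block q + ℓ would form a cube.
    A<T : A (τ (q + ℓ)) < T
    A<T = ≰⇒> λ T≤A → cube (ℓ ∸ 2) (m+[n∸m]≡n 2≤ℓ) (full⇒≋ _ T≤A)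
      where
      cube : ∀ j → 2 + j ≡ ℓ → (∀ J → J < ℓ → τ (q + J) ≋ τ (q + ℓ)) → ⊥
      cube j refl h = τ-no-cube (q + j)
        (trans (h j (n≤1+n _)) (trans (sym (h (suc j) ≤-refl)) (≡⇒≋ (cong τ (+-suc q j)))))
        (trans (≡⇒≋ (cong τ (sym (+-suc q j)))) (trans (h (suc j) ≤-refl)
          (≡⇒≋ (cong τ (trans (+-suc q (suc j)) (cong suc (+-suc q j)))))))

    U U⁺ : ℕ → ℕ
    U  c = ∑ n (λ p → δ (τ (q * m + r + p)) c * p)
    U⁺ c = ∑ n (λ p → δ (suc (τ (q * m + r + p))) c * suc p)

    balance : ∀ c → U⁺ c + δ (τ (q + ℓ)) c * T ≡ U c + (A c + δ (τ (q + ℓ) + s) c * n)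
    balance c = +-cancelˡ-≡ (∑ ℓ (λ J → δ (τ (q + J)) c * (J * m ∸ r))) _ _
      (trans (swap₁ W (U⁺ c) (δ (τ (q + ℓ)) c * T))
      (trans (cong (_+ (W + δ (τ (q + ℓ)) c * T)) (sym lhs))
      (trans (block-sum q c (_∸ r) ℓ s (<⇒≤ s<m))
      (trans (cong₂ _+_ rhs (cong₂ _+_ increments (cong (δ (τ (q + ℓ) + s) c *_) (trans (cong (_∸ r) (sym len)) (m+n∸m≡n r n)))))
             (swap₂ (U c) W (A c) (δ (τ (q + ℓ) + s) c * n))))))
      where
      W = ∑ ℓ (λ J → δ (τ (q + J)) c * (J * m ∸ r))
      swap₁ : ∀ a b d → a + (b + d) ≡ b + (a + d)
      swap₁ = solve-∀
      swap₂ : ∀ u a b d → u + (a + b + d) ≡ a + (u + (b + d))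
      swap₂ = solve-∀
      lhs : ∑ (ℓ * m + s) (λ P → δ (suc (τ (q * m + P))) c * (suc P ∸ r)) ≡ U⁺ c
      lhs = trans (cong (λ N → ∑ N (λ P → δ (suc (τ (q * m + P))) c * (suc P ∸ r))) (sym len))
        (trans (∑-split _ r n)
        (cong₂ _+_ (∑-zero r (λ P P<r → trans (cong (δ (suc (τ (q * m + P))) c *_) (m≤n⇒m∸n≡0 P<r)) (*-zeroʳ (δ (suc (τ (q * m + P))) c))))
          (∑-cong n (λ p _ → cong₂ _*_ (cong (λ x → δ (suc (τ x)) c) (sym (+-assoc (q * m) r p)))
             (trans (cong (_∸ r) (sym (+-suc r p))) (m+n∸m≡n r (suc p)))))))
      rhs : ∑ (ℓ * m + s) (λ P → δ (τ (q * m + P)) c * (P ∸ r)) ≡ U c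
      rhs = trans (cong (λ N → ∑ N (λ P → δ (τ (q * m + P)) c * (P ∸ r))) (sym len))
        (trans (∑-split _ r n)
        (cong₂ _+_ (∑-zero r (λ P P<r → trans (cong (δ (τ (q * m + P)) c *_) (m≤n⇒m∸n≡0 (<⇒≤ P<r))) (*-zeroʳ (δ (τ (q * m + P)) c))))
          (∑-cong n (λ p _ → cong₂ _*_ (cong (λ x → δ (τ x) c) (sym (+-assoc (q * m) r p)))
             (m+n∸m≡n r p)))))
      increments : ∑ ℓ (λ J → δ (τ (q + J)) c * (suc J * m ∸ r)) ≡ ∑ ℓ (λ J → δ (τ (q + J)) c * (J * m ∸ r)) + A c
      increments = trans (∑-cong ℓ (λ J _ → trans (cong (δ (τ (q + J)) c *_) (gap-step J)) (*-distribˡ-+ (δ (τ (q + J)) c) _ _)))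
        (∑-+ _ _ ℓ)

    -- Restoring the `r` letters before the factor makes every block full. Read modulo m, the
    -- equation betrays the letter of the first block.
    A-count : ∀ c → A c + δ (τ q) c * r ≡ ∑ ℓ (λ J → δ (τ (q + J)) c) * m
    A-count c = subst (λ ℓ → ∑ ℓ (λ J → δ (τ (q + J)) c * gap J) + δ (τ q) c * r ≡ ∑ ℓ (λ J → δ (τ (q + J)) c) * m)
      (m+[n∸m]≡n (≤-trans (s≤s z≤n) 2≤ℓ)) (go (ℓ ∸ 1))
      where
      swap : ∀ a b d → a + b + d ≡ a + d + b
      swap = solve-∀
      go : ∀ j → ∑ (suc j) (λ J → δ (τ (q + J)) c * gap J) + δ (τ q) c * r ≡ ∑ (suc j) (λ J → δ (τ (q + J)) c) * m
      go zero = trans (cong₂ (λ x g → δ (τ x) c * g + δ (τ q) c * r) (+-identityʳ q) gap-zero)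
        (trans (sym (*-distribˡ-+ (δ (τ q) c) (m ∸ r) r))
        (cong₂ (λ x y → δ (τ x) c * y) (sym (+-identityʳ q)) (m∸n+n≡m (<⇒≤ r<m))))
      go (suc j) = trans (swap (∑ (suc j) (λ J → δ (τ (q + J)) c * gap J)) (δ (τ (q + suc j)) c * gap (suc j)) (δ (τ q) c * r))
        (trans (cong₂ _+_ (go j) (cong (δ (τ (q + suc j)) c *_) (gap-suc j)))
               (sym (*-distribʳ-+ m (∑ (suc j) (λ J → δ (τ (q + J)) c)) (δ (τ (q + suc j)) c))))

  +-fixed⇒≡0 : ∀ x {s} → s < m → x + s ≋ x → s ≡ 0
  +-fixed⇒≡0 x s<m h = ≋⇒≡ s<m 0<m (+-cancelˡ-≋ x (trans h (≡⇒≋ (sym (+-identityʳ x)))))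

  -- The equation is tested at c = x, where the term of x + s vanishes because 0 < s < m. If x′
  -- differs from x, it gives A x ≥ T; if x′ = x but s′ = 0, it gives A x + n ≥ T + n.
  end-nonzero : ∀ {A A′ : ℕ → ℕ} {T T′ n s s′ x x′} → n ≡ T′ + s′ → s < m → A x < T →
    (∀ c → A c + δ (x + s) c * n + δ x′ c * T′ ≡ A′ c + δ (x′ + s′) c * n + δ x c * T) →
    s ≢ 0 → x ≋ x′ × s′ ≢ 0
  end-nonzero {A} {A′} {T} {T′} {n} {s} {s′} {x} {x′} n≡ s<m A<T eq s≢0 = go (x′ ≋? x)
    where
    at-x : ∀ {d} → δ x′ x ≡ d → A x + d * T′ ≡ A′ x + δ (x′ + s′) x * n + T
    at-x {d} h = trans (cong₂ (λ a b → a + b * T′)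
        (sym (trans (cong (λ z → A x + z * n) (δ-no {x + s} {x} (s≢0 ∘ +-fixed⇒≡0 x s<m))) (+-identityʳ _))) (sym h))
      (trans (eq x) (cong (A′ x + δ (x′ + s′) x * n +_) (trans (cong (_* T) (δ-yes {x} {x} refl)) (*-identityˡ T))))
    go : Dec (x′ ≋ x) → x ≋ x′ × s′ ≢ 0
    go (no ¬p) = contradiction A<T (≤⇒≯ (≤-trans (m≤n+m T _)
      (≤-reflexive (trans (sym (at-x (δ-no {x′} {x} ¬p))) (+-identityʳ (A x))))))
    go (yes p) = sym p , λ s′≡0 → contradiction A<T (≤⇒≯ (+-cancelʳ-≤ n T (A x)
      (≤-trans (≤-trans (m≤n+m (T + n) (A′ x)) (≤-reflexive (rearrange (A′ x) T n)))
       (≤-reflexive (trans (cong (λ z → A′ x + z + T) (sym (trans (cong (_* n) (δ-yes {x′ + s′} {x} (s′-cong s′≡0))) (*-identityˡ n))))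
         (trans (sym (at-x (δ-yes {x′} {x} p))) (cong (A x +_) (trans (*-identityˡ T′) (sym (n≡T′ s′≡0))))))))))
      where
      rearrange : ∀ a t n → a + (t + n) ≡ a + n + t
      rearrange = solve-∀
      s′-cong : s′ ≡ 0 → x′ + s′ ≋ x
      s′-cong refl = trans (≡⇒≋ (+-identityʳ x′)) p
      n≡T′ : s′ ≡ 0 → n ≡ T′
      n≡T′ refl = trans n≡ (+-identityʳ T′)

  -- Once x = x′ with both remainders nonzero, the test at c = x + s decides: if s′ were different,
  -- then n ≤ A′ c ≤ T′ < T′ + s′ = n.
  ends-agree : ∀ {A A′ : ℕ → ℕ} {T T′ n s s′ x x′} → n ≡ T + s → n ≡ T′ + s′ → s < m → s′ < m →
    (∀ c → A′ c ≤ T′) → A x < T → A′ x′ < T′ →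
    (∀ c → A c + δ (x + s) c * n + δ x′ c * T′ ≡ A′ c + δ (x′ + s′) c * n + δ x c * T) →
    s ≡ s′ × (s ≢ 0 → x ≋ x′)
  ends-agree {A} {A′} {T} {T′} {n} {s} {s′} {x} {x′} n≡ n≡′ s<m s′<m A′≤ A<T A′<T′ eq with s ≟ 0 | s′ ≟ 0
  ... | yes refl | yes refl = refl , λ s≢0 → contradiction refl s≢0
  ... | yes refl | no s′≢0  = contradiction refl
    (proj₂ (end-nonzero {A′} {A} {T′} {T} {n} {s′} {0} {x′} {x} n≡ s′<m A′<T′ (λ c → sym (eq c)) s′≢0))
  ... | no s≢0 | _ with end-nonzero {A} {A′} {T} {T′} {n} {s} {s′} {x} {x′} n≡′ s<m A<T eq s≢0
  ...   | x≋x′ , s′≢0 with (x′ + s′) ≋? (x + s)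
  ...     | yes p = ≋⇒≡ s<m s′<m (+-cancelˡ-≋ x (trans (sym p) (+-congʳ-≋ s′ (sym x≋x′)))) , λ _ → x≋x′
  ...     | no ¬p = contradiction n<n (<-irrefl refl)
    where
    c = x + s
    off : ∀ {z} → z ≋ x → δ z c ≡ 0
    off {z} z≋x = δ-no {z} {c} (λ h → s≢0 (+-fixed⇒≡0 x s<m (trans (sym h) z≋x)))
    at-c : A c + n + 0 ≡ A′ c + 0 + 0
    at-c = trans (sym (cong₂ (λ a b → A c + a + b * T′) (trans (cong (_* n) (δ-yes {c} {c} refl)) (*-identityˡ n)) (off (sym x≋x′))))
      (trans (eq c) (cong₂ (λ a b → A′ c + a * n + b * T) (δ-no {x′ + s′} {c} ¬p) (off refl)))
    n<n : n < n
    n<n = begin-strict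
      n             ≤⟨ m≤n+m n (A c) ⟩
      A c + n       ≡⟨ trans (sym (+-identityʳ _)) (trans at-c (trans (+-identityʳ _) (+-identityʳ _))) ⟩
      A′ c          ≤⟨ A′≤ c ⟩
      T′            <⟨ m<m+n T′ (n≢0⇒n>0 s′≢0) ⟩
      T′ + s′       ≡⟨ n≡′ ⟨
      n             ∎
      where open ≤-Reasoning

  Mom-suc : ∀ a n c f → Mom (suc ∘ a) n c f ≡ Mom a n (c + pred m) f
  Mom-suc a n c f = ∑-cong n (λ p _ → cong (_* f p) (δ-pred (a p) c))

  div-unique : ∀ M .{{_ : NonZero M}} {q r q′ r′} → r < M → r′ < M → q * M + r ≡ q′ * M + r′ → q ≡ q′ × r ≡ r′
  div-unique M {q} {r} {q′} {r′} r<M r′<M h =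
    trans (sym (/-unique M q r<M)) (trans (cong (_/ M) h) (/-unique M q′ r′<M)) ,
    trans (sym (%-unique M q r<M)) (trans (cong (_% M) h) (%-unique M q′ r′<M))

  Same : ℕ → ℕ → ℕ → ℕ → Set
  Same k n i i′ = Moments.Same< (λ p → τ (i + p)) (λ p → τ (i′ + p)) n k

  base-match : ∀ {q r q′ r′ ℓ s ℓ′ s′ n} → r < m → r′ < m → s < m → s′ < m →
    r + n ≡ ℓ * m + s → r′ + n ≡ ℓ′ * m + s′ → 2 * m ≤ n →
    Same 2 n (q * m + r) (q′ * m + r′) → Match m n (q * m + r) (q′ * m + r′)
  base-match {q} {r} {q′} {r′} {ℓ} {s} {ℓ′} {s′} {n} r<m r′<m s<m s′<m len len′ 2m≤n same =
    finish (ends-agree {X.A} {Y.A} X.n≡T+s Y.n≡T+s s<m s′<m Y.A≤T X.A<T Y.A<T eq)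
    where
    module X = Base q r ℓ s n r<m s<m len 2m≤n
    module Y = Base q′ r′ ℓ′ s′ n r′<m s′<m len′ 2m≤n
    a = λ p → τ (q * m + r + p)
    b = λ p → τ (q′ * m + r′ + p)
    open Moments a b n
    id-same : SameMom (λ p → p)
    id-same = same-cong (λ p → *-identityʳ p) (same {1} (s≤s (s≤s z≤n)))
    suc-same : SameMom suc
    suc-same = same-+ {f = λ p → p ^ 0} (same {0} (s≤s z≤n)) id-same
    U≡ : ∀ c → X.U c ≡ Y.U c
    U≡ = id-same
    U⁺≡ : ∀ c → X.U⁺ c ≡ Y.U⁺ c
    U⁺≡ c = trans (Mom-suc a n c suc) (trans (suc-same (c + pred m)) (sym (Mom-suc b n c suc)))
    eq : ∀ c → X.A c + δ (τ (q + ℓ) + s) c * n + δ (τ (q′ + ℓ′)) c * Y.T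
             ≡ Y.A c + δ (τ (q′ + ℓ′) + s′) c * n + δ (τ (q + ℓ)) c * X.T
    eq c = +-cancelˡ-≡ (X.U c) _ _ (trans (assoc₁ (X.U c) _ (δ (τ (q′ + ℓ′)) c * Y.T))
      (trans (cong (_+ δ (τ (q′ + ℓ′)) c * Y.T) (sym (X.balance c)))
      (trans (swap (X.U⁺ c) (δ (τ (q + ℓ)) c * X.T) _)
      (trans (cong (λ z → z + δ (τ (q′ + ℓ′)) c * Y.T + δ (τ (q + ℓ)) c * X.T) (U⁺≡ c))
      (trans (cong (_+ δ (τ (q + ℓ)) c * X.T) (Y.balance c))
      (trans (sym (assoc₁ (Y.U c) _ (δ (τ (q + ℓ)) c * X.T)))
             (cong (_+ (Y.A c + δ (τ (q′ + ℓ′) + s′) c * n + δ (τ (q + ℓ)) c * X.T)) (sym (U≡ c)))))))))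
      where
      assoc₁ : ∀ u x y → u + (x + y) ≡ u + x + y
      assoc₁ = solve-∀
      swap : ∀ u x y → u + x + y ≡ u + y + x
      swap = solve-∀
    finish : s ≡ s′ × (s ≢ 0 → τ (q + ℓ) ≋ τ (q′ + ℓ′)) → Match m n (q * m + r) (q′ * m + r′)
    -- Equal remainders s give ℓ′m + r = ℓm + r′, and uniqueness of division yields both ℓ = ℓ′ and
    -- r = r′.
    finish (refl , last) with div-unique m {ℓ′} {r} {ℓ} {r′} r<m r′<m
        (+-cancelʳ-≡ (s + n) _ _ (trans (rearrange (ℓ′ * m) r s n) (trans (cong₂ _+_ (sym len′) len)
          (sym (trans (rearrange (ℓ * m) r′ s n) (+-comm (ℓ * m + s) (r′ + n)))))))
      where
      rearrange : ∀ a r s n → a + r + (s + n) ≡ a + s + (r + n)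
      rearrange = solve-∀
    ... | refl , refl = record
      { q = q ; q′ = q′ ; r = r ; ℓ = ℓ ; s = s ; start = refl ; start′ = refl ; length≡ = len
      ; r<M = r<m ; s<M = s<m ; first = λ r≢0 → τ-cong (sym (first r≢0)) ; last = λ s≢0 → τ-cong (last s≢0)
      ; middle = λ c → *-cancelʳ-≡ _ _ m (trans (sym (X.A-count c))
          (trans (cong₂ _+_ (A≡ c) (first-δ c)) (Y.A-count c))) }
      where
      drop : ∀ c → δ (τ (q + ℓ) + s) c * n + δ (τ (q′ + ℓ)) c * Y.T
                 ≡ δ (τ (q′ + ℓ) + s) c * n + δ (τ (q + ℓ)) c * X.T
      drop c with s ≟ 0
      ... | yes refl = trans (cong₂ (λ z T → δ z c * n + δ (τ (q′ + ℓ)) c * T) (+-identityʳ _) (sym n≡T))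
        (trans (+-comm (δ (τ (q + ℓ)) c * n) _)
        (cong₂ (λ z T → δ z c * n + δ (τ (q + ℓ)) c * T) (sym (+-identityʳ _)) n≡T))
        where
        n≡T : n ≡ X.T
        n≡T = trans X.n≡T+s (+-identityʳ X.T)
      ... | no s≢0 = cong₂ (λ x y → x * n + y * X.T) (δ-congˡ c (+-congʳ-≋ s (last s≢0))) (δ-congˡ c (sym (last s≢0)))
      A≡ : ∀ c → X.A c ≡ Y.A c
      A≡ c = +-cancelʳ-≡ (δ (τ (q + ℓ) + s) c * n + δ (τ (q′ + ℓ)) c * Y.T) _ _
        (trans (sym (+-assoc (X.A c) _ _)) (trans (eq c) (trans (+-assoc (Y.A c) _ _) (cong (Y.A c +_) (sym (drop c))))))
      -- At c = τ q, `A-count` gives A ≡ -r modulo m for one factor, and A ≡ 0 for the other if its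
      -- first block has a different letter. Then r ≡ 0.
      first : r ≢ 0 → τ q′ ≋ τ q
      first r≢0 with τ q′ ≋? τ q
      ... | yes p = p
      ... | no ¬p = contradiction (trans (sym (m<n⇒m%n≡m r<m)) (trans (sym ([m+kn]%n≡m%n r (∑ ℓ (λ J → δ (τ (q′ + J)) x)) m))
              (trans (cong (_% m) (trans (cong (r +_) (trans (sym (Y.A-count x)) (trans (cong (λ z → Y.A x + z * r) (δ-no {τ q′} {x} ¬p)) (+-identityʳ _))))
                 (trans (+-comm r (Y.A x)) (trans (cong₂ _+_ (sym (A≡ x)) (sym (trans (cong (_* r) (δ-yes {x} {x} refl)) (*-identityˡ r)))) (X.A-count x)))))
                (m*n%n≡0 (∑ ℓ (λ J → δ (τ (q + J)) x)) m)))) r≢0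
        where x = τ q
      first-δ : ∀ c → δ (τ q) c * r ≡ δ (τ q′) c * r
      first-δ c with r ≟ 0
      ... | yes refl = trans (*-zeroʳ (δ (τ q) c)) (sym (*-zeroʳ (δ (τ q′) c)))
      ... | no r≢0 = cong (_* r) (δ-congˡ c (sym (first r≢0)))

  -- Rising factorials and the removal of one σ

  -- The product p(p + h)...(p + (d - 1)h). For h = m its increment over a block is a single rising
  -- factorial of degree one less (`rise-difference`), where a power would leave a sum over all
  -- lower degrees.
  rise : ℕ → ℕ → ℕ → ℕ
  rise h zero    p = 1
  rise h (suc d) p = (p + d * h) * rise h d p

  rise-scale : ∀ d J → rise m d (J * m) ≡ m ^ d * rise 1 d J
  rise-scale zero    J = refl
  rise-scale (suc d) J = trans (cong ((J * m + d * m) *_) (rise-scale d J)) (lemma J d m (m ^ d) (rise 1 d J))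
    where
    lemma : ∀ J d m x y → (J * m + d * m) * (x * y) ≡ m * x * ((J + d * 1) * y)
    lemma = solve-∀

  rise-lower : ∀ d J → rise 1 (suc d) J ≡ J * rise 1 d (suc J)
  rise-lower zero    J = cong (_* 1) (+-identityʳ J)
  rise-lower (suc d) J = trans (cong ((J + suc d * 1) *_) (rise-lower d J)) (lemma J d (rise 1 d (suc J)))
    where
    lemma : ∀ J d x → (J + suc d * 1) * (J * x) ≡ J * ((suc J + d * 1) * x)
    lemma = solve-∀

  rise-difference : ∀ d J → rise m (suc d) (suc J * m) ≡ rise m (suc d) (J * m) + m ^ suc d * suc d * rise 1 d (suc J)
  rise-difference d J = trans (rise-scale (suc d) (suc J))
    (trans (lemma (m ^ suc d) d J (rise 1 d (suc J)))
    (cong (_+ m ^ suc d * suc d * rise 1 d (suc J))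
      (sym (trans (rise-scale (suc d) J) (cong (m ^ suc d *_) (rise-lower d J))))))
    where
    lemma : ∀ x d J y → x * ((suc J + d * 1) * y) ≡ x * (J * y) + x * suc d * y
    lemma = solve-∀

  -- Completing the first block moves every position by `r`, and (r + p)^d involves only moments of
  -- degree at most d.
  extend-prefix : ∀ {k n q q′ r} → (∀ P → P < r → τ (q + P) ≡ τ (q′ + P)) →
    Same k n (q + r) (q′ + r) → Same k (r + n) q q′
  extend-prefix {k} {n} {q} {q′} {r} prefix same {d} d<k c =
    trans (∑-split _ r n) (trans (cong₂ _+_
      (∑-cong r (λ P P<r → cong (λ x → δ x c * P ^ d) (prefix P P<r)))
      (trans (shift-index q) (trans (shifted c) (sym (shift-index q′))))) (sym (∑-split _ r n)))
    where
    open Moments (λ p → τ (q + r + p)) (λ p → τ (q′ + r + p)) n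
    shifted : SameMom (λ p → (r + p) ^ d)
    shifted = pow⇒product same (λ _ → r) (λ d p → (r + p) ^ d) (λ _ → refl)
      (λ d p → cong (_* (r + p) ^ d) (+-comm r p)) d<k
    shift-index : ∀ q → ∑ n (λ p → δ (τ (q + (r + p))) c * (r + p) ^ d) ≡ Mom (λ p → τ (q + r + p)) n c (λ p → (r + p) ^ d)
    shift-index q = ∑-cong n (λ p _ → cong (λ x → δ (τ x) c * (r + p) ^ d) (sym (+-assoc q r p)))

  -- `block-sum` with weight `rise m (suc d)`: the letter moments of degree d + 1 agree, the end
  -- terms agree by `last`, and what is left is a block moment of degree d times the positive factor
  -- m^(d+1) (d + 1).
  desubstitute : ∀ {k q q′ ℓ s} → s < m → (s ≢ 0 → τ (q + ℓ) ≡ τ (q′ + ℓ)) →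
    Same (suc k) (ℓ * m + s) (q * m) (q′ * m) → Same k ℓ q q′
  desubstitute {k} {q} {q′} {ℓ} {s} s<m last same =
    Blocks.product⇒pow suc (λ d J → rise 1 d (suc J)) (λ _ → refl)
      (λ d J → cong (λ x → x * rise 1 d (suc J)) (lemma J d))
      (λ {d} d<k → Blocks.same-cancel-* (m ^ suc d * suc d) {{m*n≢0 (m ^ suc d) (suc d) {{m^n≢0 m (suc d)}}}} (top d<k))
    where
    lemma : ∀ J d → suc J + d * 1 ≡ J + suc d
    lemma = solve-∀
    module Letters = Moments (λ P → τ (q * m + P)) (λ P → τ (q′ * m + P)) (ℓ * m + s)
    module Blocks = Moments (λ J → τ (q + J)) (λ J → τ (q′ + J)) ℓ
    top : ∀ {d} → d < k → Blocks.SameMom (λ J → m ^ suc d * suc d * rise 1 d (suc J))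
    top {d} d<k c = +-cancelʳ-≡ (Z⁺ q + Z q′) _ _ (+-cancelˡ-≡ (S q) _ _
      (trans (rearrange (S q) (D q) (Z⁺ q) (Z q′))
      (trans (cong (_+ Z q′) (trans (sym (collapse q)) (cong (_+ Z q) S⁺≡)))
      (trans (swap (S⁺ q′) (Z q) (Z q′))
      (trans (cong (_+ Z q) (trans (collapse q′) (cong (_+ (D q′ + Z⁺ q′)) (sym S≡))))
      (trans (sym (rearrange (S q) (D q′) (Z⁺ q′) (Z q)))
             (cong (λ z → S q + (D q′ + z)) (sym ends))))))))
      where
      swap : ∀ a b c → a + b + c ≡ a + c + b
      swap = solve-∀
      rearrange : ∀ s d z z′ → s + (d + (z + z′)) ≡ s + (d + z) + z′
      rearrange = solve-∀
      f = rise m (suc d)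
      N = ℓ * m + s
      g = λ J → m ^ suc d * suc d * rise 1 d (suc J)
      S⁺ S D B Z Z⁺ : ℕ → ℕ
      S⁺ q = ∑ N (λ P → δ (suc (τ (q * m + P))) c * f (suc P))
      S  q = ∑ N (λ P → δ (τ (q * m + P)) c * f P)
      D  q = Mom (λ J → τ (q + J)) ℓ c g
      B  q = Mom (λ J → τ (q + J)) ℓ c (λ J → f (J * m))
      Z  q = δ (τ (q + ℓ)) c * f (ℓ * m)
      Z⁺ q = δ (τ (q + ℓ) + s) c * f N
      ends : Z⁺ q + Z q′ ≡ Z⁺ q′ + Z q
      ends with s ≟ 0
      ... | yes s≡0 = trans (cong (_+ Z q′) (zero-end q s≡0)) (trans (+-comm (Z q) (Z q′)) (cong (_+ Z q) (sym (zero-end q′ s≡0))))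
        where
        zero-end : ∀ q → s ≡ 0 → Z⁺ q ≡ Z q
        zero-end q refl = cong₂ _*_ (cong (λ x → δ x c) (+-identityʳ (τ (q + ℓ)))) (cong f (+-identityʳ (ℓ * m)))
      ... | no s≢0 = cong₂ (λ x y → δ (x + s) c * f N + δ y c * f (ℓ * m)) (last s≢0) (sym (last s≢0))
      collapse : ∀ q → S⁺ q + Z q ≡ S q + (D q + Z⁺ q)
      collapse q = +-cancelˡ-≡ (B q) _ _ (trans (flip (B q) (S⁺ q) (Z q))
        (trans (block-sum q c f ℓ s (<⇒≤ s<m))
        (trans (cong (λ z → S q + (z + Z⁺ q)) (trans (Mom-cong (λ J → τ (q + J)) ℓ c (rise-difference d))
                                                     (Mom-+ (λ J → τ (q + J)) ℓ c (λ J → f (J * m)) g)))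
               (flip′ (B q) (S q) (D q) (Z⁺ q)))))
        where
        flip : ∀ b s z → b + (s + z) ≡ s + (b + z)
        flip = solve-∀
        flip′ : ∀ b s d z → s + (b + d + z) ≡ b + (s + (d + z))
        flip′ = solve-∀
      S≡ : S q ≡ S q′
      S≡ = Letters.pow⇒product same (λ d → d * m) (rise m) (λ _ → refl) (λ _ _ → refl) (s≤s d<k) c
      S⁺≡ : S⁺ q ≡ S⁺ q′
      S⁺≡ = trans (Mom-suc (λ P → τ (q * m + P)) N c (λ P → f (suc P)))
        (trans (Letters.pow⇒product same (λ d → suc (d * m)) (λ d P → rise m d (suc P)) (λ _ → refl)
                 (λ d P → cong (_* rise m d (suc P)) (sym (+-suc P (d * m)))) (s≤s d<k) (c + pred m))
               (sym (Mom-suc (λ P → τ (q′ * m + P)) N c (λ P → f (suc P)))))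

  Same-weaken : ∀ {k k′ n i i′} → k′ ≤ k → Same k n i i′ → Same k′ n i i′
  Same-weaken k′≤k same d<k′ = same (≤-trans d<k′ k′≤k)

  descend : ∀ {k n i i′} (μ : Match m n i i′) → let open Match μ in
    Same (suc k) n i i′ → Same k ℓ q q′
  descend {k} {n} (mkMatch q q′ r ℓ s refl refl len r<m s<m first last middle) same =
    desubstitute {k} {q} {q′} {ℓ} {s} s<m last (subst (λ N → Same (suc k) N (q * m) (q′ * m)) len (extend-prefix {suc k} {n} {q * m} {q′ * m} {r} prefix same))
    where
    prefix : ∀ P → P < r → τ (q * m + P) ≡ τ (q′ * m + P)
    prefix P P<r = trans (τ-block q P<m) (trans (cong (λ x → (x + P) % m) (first (m<n⇒n≢0 P<r))) (sym (τ-block q′ P<m)))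
      where P<m = <-trans P<r r<m

  Same-snoc : ∀ {k n i i′} → τ (i + n) ≡ τ (i′ + n) → Same k n i i′ → Same k (suc n) i i′
  Same-snoc {n = n} h same {d} d<k c = cong₂ _+_ (same d<k c) (cong (λ x → δ x c * n ^ d) h)

  Same⇒Match-1 : ∀ {n i i′} → Same 1 n i i′ → Match 1 n i i′
  Same⇒Match-1 {n} {i} {i′} same = record
    { q = i ; q′ = i′ ; r = 0 ; ℓ = n ; s = 0
    ; start = unit i ; start′ = unit i′ ; length≡ = unit n ; r<M = ≤-refl ; s<M = ≤-refl
    ; first = λ 0≢0 → contradiction refl 0≢0 ; last = λ 0≢0 → contradiction refl 0≢0
    ; middle = λ c → trans (sym (count i c)) (trans (same (s≤s z≤n) c) (count i′ c)) }
    where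
    unit : ∀ i → i ≡ i * 1 + 0
    unit = solve-∀
    count : ∀ i c → ∑ n (λ p → δ (τ (i + p)) c * 1) ≡ ∑ n (λ p → δ (τ (i + p)) c)
    count i c = ∑-cong n (λ p _ → *-identityʳ _)

  *m+<m* : ∀ {a b M} → a < M → b < m → a * m + b < m * M
  *m+<m* {a} {b} {M} a<M b<m = begin-strict
    a * m + b   <⟨ +-monoʳ-< (a * m) b<m ⟩
    a * m + m   ≡⟨ +-comm (a * m) m ⟩
    suc a * m   ≤⟨ *-monoˡ-≤ m a<M ⟩
    M * m       ≡⟨ *-comm M m ⟩
    m * M       ∎
    where open ≤-Reasoning

  block-letter : ∀ e {q q′ j} → j < m ^ e → τ (q * m ^ e + j) ≡ τ (q′ * m ^ e + j) → τ q ≡ τ q′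
  block-letter e {q} {q′} {j} j< h = τ-cong (+-cancelʳ-≋ (τ j)
    (trans (sym (τ-pow e q j<)) (trans (≡⇒≋ h) (τ-pow e q′ j<))))

  -- If r₂ = 0, the partial small block opens its large block, so its letter determines that of the
  -- large block.
  first-compose : ∀ e {q q′ r₂ r} → (r ≢ 0 → τ (q * m ^ e + r₂) ≡ τ (q′ * m ^ e + r₂)) →
    (r₂ ≢ 0 → τ q ≡ τ q′) → r₂ * m + r ≢ 0 → τ q ≡ τ q′
  first-compose e {r₂ = r₂} first first₂ h with r₂ ≟ 0
  ... | yes refl = block-letter e (m^>0 e) (first h)
  ... | no r₂≢0  = first₂ r₂≢0

  compose-start : ∀ q M r₂ r → (q * M + r₂) * m + r ≡ q * (m * M) + (r₂ * m + r)
  compose-start q M r₂ r = lemma q M r₂ m r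
    where
    lemma : ∀ q M r₂ m r → (q * M + r₂) * m + r ≡ q * (m * M) + (r₂ * m + r)
    lemma = solve-∀

  compose-aligned : ∀ {e n i i′} (μ : Match m n i i′) → let open Match μ in
    s ≡ 0 → Match (m ^ e) ℓ q q′ → Match (m ^ suc e) n i i′
  compose-aligned {e} {n} (mkMatch _ _ r ℓ s refl refl len r<m s<m first _ _) refl
    (mkMatch q q′ r₂ ℓ₂ s₂ refl refl len₂ r₂< s₂< first₂ last₂ middle₂) = record
    { q = q ; q′ = q′ ; r = r₂ * m + r ; ℓ = ℓ₂ ; s = s₂ * m
    ; start = compose-start q (m ^ e) r₂ r ; start′ = compose-start q′ (m ^ e) r₂ r
    ; length≡ = trans (+-assoc (r₂ * m) r n) (trans (cong (r₂ * m +_) (trans len (+-identityʳ _)))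
        (trans (sym (*-distribʳ-+ m r₂ ℓ)) (trans (cong (_* m) len₂) (regroup ℓ₂ (m ^ e) s₂ m))))
    ; r<M = *m+<m* r₂< r<m
    ; s<M = subst (_< m * m ^ e) (+-identityʳ _) (*m+<m* s₂< 0<m)
    ; first = first-compose e first first₂
    ; last = λ s≢0 → last₂ λ { refl → s≢0 refl }
    ; middle = middle₂ }
    where
    regroup : ∀ ℓ M s m → (ℓ * M + s) * m ≡ ℓ * (m * M) + s * m
    regroup = solve-∀

  -- The block word has been lengthened by the known letter of the partial small block at the end.
  -- If this letter lies in an incomplete large block, it is simply removed again. If it completes a
  -- large block, the factor covers the end of that block only in part, so the block leaves the
  -- count and becomes the new partial end.
  compose-partial : ∀ {e n i i′} (μ : Match m n i i′) → let open Match μ in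
    s ≢ 0 → Match (m ^ e) (suc ℓ) q q′ → Match (m ^ suc e) n i i′
  compose-partial {e} {n} (mkMatch _ _ r ℓ s refl refl len r<m s<m first last _) s≢0
    (mkMatch q q′ r₂ ℓ₂ (suc s₂) refl refl len₂ r₂< s₂< first₂ last₂ middle₂) = record
    { q = q ; q′ = q′ ; r = r₂ * m + r ; ℓ = ℓ₂ ; s = s₂ * m + s
    ; start = compose-start q (m ^ e) r₂ r ; start′ = compose-start q′ (m ^ e) r₂ r
    ; length≡ = +-cancelʳ-≡ m _ _ (trans (cong (_+ m) (+-assoc (r₂ * m) r n)) (trans (cong (λ z → r₂ * m + z + m) len)
        (trans (regroup r₂ m ℓ s) (trans (cong (λ z → z * m + s) len₂) (regroup′ ℓ₂ (m ^ e) s₂ m s)))))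
    ; r<M = *m+<m* r₂< r<m
    ; s<M = *m+<m* (≤-trans (n≤1+n _) s₂<) s<m
    ; first = first-compose e first first₂
    ; last = λ _ → last₂ λ ()
    ; middle = middle₂ }
    where
    regroup : ∀ r m ℓ s → r * m + (ℓ * m + s) + m ≡ (r + suc ℓ) * m + s
    regroup = solve-∀
    regroup′ : ∀ ℓ M s₂ m s → (ℓ * M + suc s₂) * m + s ≡ ℓ * (m * M) + (s₂ * m + s) + m
    regroup′ = solve-∀
  compose-partial {e} {n} (mkMatch _ _ r ℓ s refl refl len r<m s<m first last _) s≢0
    (mkMatch q q′ r₂ zero zero refl refl len₂ r₂< s₂< first₂ last₂ middle₂) =
    contradiction (trans (sym (+-suc r₂ ℓ)) len₂) λ ()
  compose-partial {e} {n} (mkMatch _ _ r ℓ s refl refl len r<m s<m first last _) s≢0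
    (mkMatch q q′ r₂ (suc ℓ₂) zero refl refl len₂ r₂< s₂< first₂ last₂ middle₂) = record
    -- The large block q + ℓ₂ is reached up to M - 1 whole small blocks and `s` further letters.
    { q = q ; q′ = q′ ; r = r₂ * m + r ; ℓ = ℓ₂ ; s = M′ * m + s
    ; start = compose-start q M r₂ r ; start′ = compose-start q′ M r₂ r
    ; length≡ = trans (+-assoc (r₂ * m) r n) (trans (cong (r₂ * m +_) len) (trans (regroup r₂ m ℓ s)
        (trans (cong (λ z → z * m + s) r₂+ℓ) (regroup′ ℓ₂ M M′ m s))))
    ; r<M = *m+<m* r₂< r<m
    ; s<M = *m+<m* M′<M s<m
    ; first = first-compose e first first₂
    ; last = λ _ → end-letter
    ; middle = λ c → +-cancelʳ-≡ (δ (τ (q + ℓ₂)) c) _ _ (trans (middle₂ c)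
        (cong (λ x → ∑ ℓ₂ (λ J → δ (τ (q′ + J)) c) + δ x c) (sym end-letter))) }
    where
    M = m ^ e
    M′ = pred M
    1+M′ : suc M′ ≡ M
    1+M′ = suc-pred M {{m^n≢0 m e}}
    M′<M : M′ < M
    M′<M = ≤-reflexive 1+M′
    regroup : ∀ r m ℓ s → r * m + (ℓ * m + s) ≡ (r + ℓ) * m + s
    regroup = solve-∀
    regroup′ : ∀ ℓ M M′ m s → (ℓ * M + M′) * m + s ≡ ℓ * (m * M) + (M′ * m + s)
    regroup′ = solve-∀
    r₂+ℓ : r₂ + ℓ ≡ ℓ₂ * M + M′
    r₂+ℓ = suc-injective (trans (sym (+-suc r₂ ℓ)) (trans len₂ (trans (+-identityʳ _)
      (trans (+-comm M (ℓ₂ * M)) (trans (cong (ℓ₂ * M +_) (sym 1+M′)) (+-suc (ℓ₂ * M) M′))))))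
    position : ∀ q → q * M + r₂ + ℓ ≡ (q + ℓ₂) * M + M′
    position q = trans (+-assoc (q * M) r₂ ℓ) (trans (cong (q * M +_) r₂+ℓ) (regroup q M ℓ₂ M′))
    end-letter : τ (q + ℓ₂) ≡ τ (q′ + ℓ₂)
    end-letter = block-letter e M′<M (trans (cong τ (sym (position q))) (trans (last s≢0) (cong τ (position q′))))

  -- Each level spends one degree in `descend`, and its length bound divided by m is the bound of
  -- the next level. The two lowest moments, which `base-match` needs, are still available whenever
  -- a level remains.
  Same⇒Match : ∀ e {n i i′} → 2 * m ^ e ≤ n → Same (suc e) n i i′ → Match (m ^ e) n i i′
  Same⇒Match zero    _ same = Same⇒Match-1 same
  Same⇒Match (suc e) {n} {i} {i′} 2M≤n same = go base
    where
    2m≤n : 2 * m ≤ n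
    2m≤n = ≤-trans (*-monoʳ-≤ 2 (m≤m*n m (m ^ e) {{m^n≢0 m e}})) 2M≤n
    base : Match m n i i′
    base = subst₂ (Match m n) (sym (divMod≡ i)) (sym (divMod≡ i′))
      (base-match {i / m} {i % m} {i′ / m} {i′ % m} {(i % m + n) / m} {_} {(i′ % m + n) / m} (m%n<n i m) (m%n<n i′ m) (m%n<n (i % m + n) m) (m%n<n (i′ % m + n) m)
        (divMod≡ (i % m + n)) (divMod≡ (i′ % m + n)) 2m≤n
        (subst₂ (Same 2 n) (divMod≡ i) (divMod≡ i′) (Same-weaken {suc (suc e)} {2} {n} {i} {i′} (s≤s (s≤s z≤n)) same)))
    go : Match m n i i′ → Match (m ^ suc e) n i i′
    go μ with Match.s μ ≟ 0
    ... | yes s≡0 = compose-aligned {e} μ s≡0 (Same⇒Match e (*-cancelʳ-≤ _ _ m (begin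
      2 * m ^ e * m         ≡⟨ rearrange (m ^ e) m ⟩
      2 * m ^ suc e         ≤⟨ 2M≤n ⟩
      n                     ≤⟨ m≤n+m n r ⟩
      r + n                 ≡⟨ length≡ ⟩
      ℓ * m + s             ≡⟨ cong (ℓ * m +_) s≡0 ⟩
      ℓ * m + 0             ≡⟨ +-identityʳ _ ⟩
      ℓ * m                 ∎)) (descend μ same))
      where
      open ≤-Reasoning
      open Match μ
      rearrange : ∀ M m → 2 * M * m ≡ 2 * (m * M)
      rearrange = solve-∀
    ... | no s≢0 = compose-partial {e} μ s≢0 (Same⇒Match e (*-cancelʳ-≤ _ _ m (begin
      2 * m ^ e * m         ≡⟨ rearrange (m ^ e) m ⟩
      2 * m ^ suc e         ≤⟨ 2M≤n ⟩
      n                     ≤⟨ m≤n+m n r ⟩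
      r + n                 ≡⟨ length≡ ⟩
      ℓ * m + s             ≤⟨ +-monoʳ-≤ (ℓ * m) (<⇒≤ s<M) ⟩
      ℓ * m + m             ≡⟨ +-comm (ℓ * m) m ⟩
      suc ℓ * m             ∎)) (Same-snoc {suc e} {ℓ} {q} {q′} (last s≢0) (descend μ same)))
      where
      open ≤-Reasoning
      open Match μ
      rearrange : ∀ M m → 2 * M * m ≡ 2 * (m * M)
      rearrange = solve-∀

  -- Sufficiency

  window : ℕ → ℕ → List ℕ
  window n i = applyUpTo (λ p → τ (i + p)) n

  factor≡window : ∀ n i → factor m n i ≡ window n i
  factor≡window n i = trans (map-upTo (λ j → t m (i + j)) n) (applyUpTo-cong n (λ p _ → sym (τ≡t (i + p))))

  applyUpTo-++ : ∀ (f : ℕ → ℕ) a b → applyUpTo f (a + b) ≡ applyUpTo f a ++ applyUpTo (λ p → f (a + p)) b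
  applyUpTo-++ f zero    b = refl
  applyUpTo-++ f (suc a) b = cong (f 0 ∷_) (applyUpTo-++ (f ∘ suc) a b)

  window-++ : ∀ a b i → window (a + b) i ≡ window a i ++ window b (i + a)
  window-++ a b i = trans (applyUpTo-++ (λ p → τ (i + p)) a b)
    (cong (window a i ++_) (applyUpTo-cong b (λ p _ → cong τ (sym (+-assoc i a p)))))

  window-suc : ∀ n i → window (suc n) i ≡ τ i ∷ window n (suc i)
  window-suc n i = cong₂ _∷_ (cong τ (+-identityʳ i)) (applyUpTo-cong n (λ p _ → cong τ (+-suc i p)))

  σ-window : ∀ ℓ q → σ m (window ℓ q) ≡ window (ℓ * m) (q * m)
  σ-window zero    q = refl
  σ-window (suc ℓ) q = trans (cong (σ m) (window-suc ℓ q)) (trans (cong₂ _++_ block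
      (trans (σ-window ℓ (suc q)) (cong (window (ℓ * m)) (+-comm m (q * m)))))
    (sym (window-++ m (ℓ * m) (q * m))))
    where
    block : map (addMod m (τ q)) (upTo m) ≡ window m (q * m)
    block = trans (map-upTo (addMod m (τ q)) m)
      (applyUpTo-cong m (λ j j<m → trans (addMod≡% m (τ q) j) (sym (τ-block q j<m))))

  pow-window : ∀ e ℓ q → pow m e (window ℓ q) ≡ window (ℓ * m ^ e) (q * m ^ e)
  pow-window zero    ℓ q = cong₂ window (sym (*-identityʳ ℓ)) (sym (*-identityʳ q))
  pow-window (suc e) ℓ q = trans (cong (pow m e) (σ-window ℓ q)) (trans (pow-window e (ℓ * m) (q * m))
    (cong₂ window (*-assoc ℓ m (m ^ e)) (*-assoc q m (m ^ e))))

  window-in-block : ∀ e {q q′ s} → s < m ^ e → (s ≢ 0 → τ q ≡ τ q′) → window s (q * m ^ e) ≡ window s (q′ * m ^ e)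
  window-in-block e {q} {q′} {s} s< h = applyUpTo-cong s (λ p p<s → τ-cong
    (trans (τ-pow e q (<-trans p<s s<)) (trans (≡⇒≋ (cong (_+ τ p) (h (m<n⇒n≢0 p<s)))) (sym (τ-pow e q′ (<-trans p<s s<))))))

  window-letters : ∀ n i → All (_< m) (window n i)
  window-letters n i = applyUpTo⁺₂ _ n (λ p → τ<m (i + p))

  SameCount : ℕ → ℕ → ℕ → Set
  SameCount n i i′ = ∀ c → ∑ n (λ p → δ (τ (i + p)) c) ≡ ∑ n (λ p → δ (τ (i′ + p)) c)

  SameCount⇒BinEq1 : ∀ {n i i′} → SameCount n i i′ → BinEq m 1 (window n i) (window n i′)
  SameCount⇒BinEq1 {n} {i} {i′} h = Moments.Same<⇒BinEq1 _ _ n (λ p → τ<m (i + p)) (λ p → τ<m (i′ + p))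
    λ { {zero} _ c → trans (unit i c) (trans (h c) (sym (unit i′ c))) ; {suc d} (s≤s ()) }
    where
    unit : ∀ i c → ∑ n (λ p → δ (τ (i + p)) c * 1) ≡ ∑ n (λ p → δ (τ (i + p)) c)
    unit i c = ∑-cong n (λ p _ → *-identityʳ _)

  BinEq1⇒SameCount : ∀ {n i i′} → BinEq m 1 (window n i) (window n i′) → SameCount n i i′
  BinEq1⇒SameCount {n} {i} {i′} h c = trans (sym (unit i)) (trans
    (Moments.BinEq⇒Same< (λ p → τ (i + p)) (λ p → τ (i′ + p)) n (λ p → τ<m (i + p)) (λ p → τ<m (i′ + p)) h (s≤s z≤n) c) (unit i′))
    where
    unit : ∀ i → ∑ n (λ p → δ (τ (i + p)) c * 1) ≡ ∑ n (λ p → δ (τ (i + p)) c)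
    unit i = ∑-cong n (λ p _ → *-identityʳ _)

  -- The first block is completed on the left by `r` letters, the same in both words. The blocks are
  -- then σ^e of words with permuted letters, the tails coincide, and the added prefix is cancelled.
  Match⇒BinEq : ∀ e {n i i′} → Match (m ^ e) n i i′ → BinEq m (suc e) (window n i) (window n i′)
  Match⇒BinEq e {n} (mkMatch q q′ r ℓ s refl refl len r<M s<M first last middle) =
    BinEq-cancel-++ˡ (window r (q * M)) (subst₂ (BinEq m (suc e)) (parts q refl) (parts q′ (window-in-block e r<M first)) whole)
    where
    M = m ^ e
    blocks : BinEq m (suc e) (window (ℓ * M) (q * M)) (window (ℓ * M) (q′ * M))
    blocks = subst₂ (BinEq m (suc e)) (pow-window e ℓ q) (pow-window e ℓ q′)
      (pow-↭ m e (BinEq1⇒↭ (window-letters ℓ q) (window-letters ℓ q′) (SameCount⇒BinEq1 middle)))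
    tail : window s ((q + ℓ) * M) ≡ window s ((q′ + ℓ) * M)
    tail = window-in-block e s<M last
    whole : BinEq m (suc e) (window (ℓ * M) (q * M) ++ window s ((q + ℓ) * M))
                            (window (ℓ * M) (q′ * M) ++ window s ((q′ + ℓ) * M))
    whole = subst (λ w → BinEq m (suc e) (window (ℓ * M) (q * M) ++ window s ((q + ℓ) * M)) (window (ℓ * M) (q′ * M) ++ w)) tail
      (BinEq-++ʳ (window s ((q + ℓ) * M)) blocks)
    parts : ∀ x → window r (q * M) ≡ window r (x * M) →
      window (ℓ * M) (x * M) ++ window s ((x + ℓ) * M) ≡ window r (q * M) ++ window n (x * M + r)
    parts x h = trans (cong (λ z → window (ℓ * M) (x * M) ++ window s z) (*-distribʳ-+ M x ℓ))
      (trans (sym (window-++ (ℓ * M) s (x * M))) (trans (cong (λ N → window N (x * M)) (sym len))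
      (trans (window-++ r n (x * M)) (cong (_++ window n (x * M + r)) (sym h)))))

  BinEq⇒Match : ∀ e {n i i′} → 2 * m ^ e ≤ n → BinEq m (suc e) (window n i) (window n i′) → Match (m ^ e) n i i′
  BinEq⇒Match e {n} {i} {i′} 2M≤n h = Same⇒Match e 2M≤n
    (Moments.BinEq⇒Same< (λ p → τ (i + p)) (λ p → τ (i′ + p)) n (λ p → τ<m (i + p)) (λ p → τ<m (i′ + p)) h)

  -- Counting the classes

  Cnt : ℕ → ℕ → ℕ → ℕ
  Cnt n i c = ∑ n (λ p → δ (τ (i + p)) c)

  -- (g - 1)Ψ in the group ring of ℤ/m: only block boundaries contribute, and inner blocks cancel.
  count-derivative : ∀ n i c → Cnt n i (c + pred m) + (δ (E (i + n)) c + δ (τ i) c)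
                             ≡ Cnt n i c + (δ (τ (i + n)) c + δ (E i) c)
  count-derivative zero    i c = subst (λ j → δ (E j) c + δ (τ i) c ≡ δ (τ j) c + δ (E i) c)
    (sym (+-identityʳ i)) (+-comm (δ (E i) c) _)
  count-derivative (suc n) i c = subst (λ j → Cnt (suc n) i (c + pred m) + (δ (E j) c + δ (τ i) c)
                                            ≡ Cnt (suc n) i c + (δ (τ j) c + δ (E i) c)) (sym (+-suc i n))
    (+-cancelʳ-≡ (δ (E (i + n)) c) _ _ (begin
      C⁻ + δ k (c + pred m) + (ε′ + a) + ε   ≡⟨ cong (λ z → C⁻ + z + (ε′ + a) + ε) (sym (δ-pred k c)) ⟩
      C⁻ + δ (suc k) c + (ε′ + a) + ε        ≡⟨ rearrange C⁻ (δ (suc k) c) ε′ a ε ⟩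
      C⁻ + (ε + a) + (δ (suc k) c + ε′)      ≡⟨ cong₂ _+_ (count-derivative n i c) (sym one-step) ⟩
      C + (δ k c + x) + (k′ + ε)             ≡⟨ rearrange′ C (δ k c) x k′ ε ⟩
      C + δ k c + (k′ + x) + ε               ∎))
    where
    open ≡-Reasoning
    C⁻ = Cnt n i (c + pred m)
    C = Cnt n i c
    k = τ (i + n)
    k′ = δ (τ (suc (i + n))) c
    ε = δ (E (i + n)) c
    ε′ = δ (E (suc (i + n))) c
    a = δ (τ i) c
    x = δ (E i) c
    rearrange : ∀ C k f a g → C + k + (f + a) + g ≡ C + (g + a) + (k + f)
    rearrange = solve-∀
    rearrange′ : ∀ C k x l g → C + (k + x) + (l + g) ≡ C + k + (l + x) + g
    rearrange′ = solve-∀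
    one-step : k′ + ε ≡ δ (suc k) c + ε′
    one-step with τ-step (i + n)
    ... | inj₁ (p , q) = cong₂ _+_ (δ-congˡ c p) (cong (λ z → δ z c) (sym q))
    ... | inj₂ (p , q) = trans (cong₂ _+_ (cong (λ z → δ z c) p) (δ-congˡ c q)) (+-comm ε′ (δ (suc k) c))

  -- Equality of the boundary expressions [τ(q + D)] - [E(q + D)] - [τ q] + [E q] for q and q′, with
  -- negative terms moved across.
  Balanced : ℕ → ℕ → ℕ → Set
  Balanced D q q′ = ∀ c → δ (E (q + D)) c + δ (τ q) c + (δ (τ (q′ + D)) c + δ (E q′) c)
                        ≡ δ (E (q′ + D)) c + δ (τ q′) c + (δ (τ (q + D)) c + δ (E q) c)

  SameCount⇒Balanced : ∀ {D q q′} → SameCount D q q′ → Balanced D q q′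
  SameCount⇒Balanced {D} {q} {q′} same c = +-cancelˡ-≡ (Cnt D q (c + pred m) + Cnt D q c) _ _ (begin
    C⁻ + C + (X q + Y q′)     ≡⟨ rearrange C⁻ C (X q) (Y q′) ⟩
    C⁻ + X q + (C + Y q′)     ≡⟨ cong₂ _+_ (count-derivative D q c) (trans (cong (_+ Y q′) (same c)) (sym (count-derivative D q′ c))) ⟩
    C + Y q + (Cnt D q′ (c + pred m) + X q′) ≡⟨ cong (λ z → C + Y q + (z + X q′)) (sym (same (c + pred m))) ⟩
    C + Y q + (C⁻ + X q′)     ≡⟨ rearrange′ C⁻ C (X q′) (Y q) ⟩
    C⁻ + C + (X q′ + Y q)     ∎)
    where
    open ≡-Reasoning
    C⁻ = Cnt D q (c + pred m)
    C = Cnt D q c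
    X Y : ℕ → ℕ
    X q = δ (E (q + D)) c + δ (τ q) c
    Y q = δ (τ (q + D)) c + δ (E q) c
    rearrange : ∀ a b x y → a + b + (x + y) ≡ a + x + (b + y)
    rearrange = solve-∀
    rearrange′ : ∀ a b x y → b + y + (a + x) ≡ a + b + (x + y)
    rearrange′ = solve-∀

  ∑δ≡1 : ∀ {x} → x < m → ∑ m (δ x) ≡ 1
  ∑δ≡1 {x} x<m = trans (∑-single (δ x) m x<m (λ c c<m c≢x → δ-no {x} {c} (λ p → c≢x (sym (≋⇒≡ x<m c<m p)))))
    (δ-yes {x} {x} refl)

  ∑Cnt : ∀ n i → ∑ m (Cnt n i) ≡ n
  ∑Cnt n i = trans (∑-comm (λ c p → δ (τ (i + p)) c) m n)
    (trans (∑-cong n (λ p _ → ∑δ≡1 (τ<m (i + p)))) (trans (∑-const 1 n) (*-identityʳ n)))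

  -- Equal derivatives force the two count vectors to differ by a constant, which is 0 as their sums agree.
  Balanced⇒SameCount : ∀ {D q q′} → Balanced D q q′ → SameCount D q q′
  Balanced⇒SameCount {D} {q} {q′} bal c = +-cancelʳ-≡ (Cnt D q′ 0) _ _
    (trans (constant c) (cong (Cnt D q′ c +_) (zeroth)))
    where
    open ≡-Reasoning
    next : ∀ c → Cnt D q c + Cnt D q′ (suc c) ≡ Cnt D q′ c + Cnt D q (suc c)
    next c = +-cancelʳ-≡ (X q + Y q′) _ _ (begin
      C q + C⁺ q′ + (X q + Y q′)    ≡⟨ rearrange (C q) (C⁺ q′) (X q) (Y q′) ⟩
      C q + X q + (C⁺ q′ + Y q′)    ≡⟨ cong₂ _+_ (deriv q) (sym (deriv q′)) ⟩
      C⁺ q + Y q + (C q′ + X q′)    ≡⟨ rearrange′ (C⁺ q) (Y q) (C q′) (X q′) ⟩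
      C q′ + C⁺ q + (X q′ + Y q)    ≡⟨ cong (C q′ + C⁺ q +_) (sym (bal (suc c))) ⟩
      C q′ + C⁺ q + (X q + Y q′)    ∎)
      where
      X Y C C⁺ : ℕ → ℕ
      X q = δ (E (q + D)) (suc c) + δ (τ q) (suc c)
      Y q = δ (τ (q + D)) (suc c) + δ (E q) (suc c)
      C q = Cnt D q c
      C⁺ q = Cnt D q (suc c)
      rearrange : ∀ a b x y → a + b + (x + y) ≡ a + x + (b + y)
      rearrange = solve-∀
      rearrange′ : ∀ a y b x → a + y + (b + x) ≡ b + a + (x + y)
      rearrange′ = solve-∀
      c≋ : c ≋ suc c + pred m
      c≋ = trans (sym (+m-≋ c)) (≡⇒≋ (trans (cong (c +_) (sym (suc-pred m))) (+-suc c (pred m))))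
      deriv : ∀ q → C q + X q ≡ C⁺ q + Y q
      deriv q = trans (cong (_+ X q) (∑-cong D (λ p _ → δ-congʳ (τ (q + p)) c≋))) (count-derivative D q (suc c))
    constant : ∀ c → Cnt D q c + Cnt D q′ 0 ≡ Cnt D q′ c + Cnt D q 0
    constant zero    = +-comm (Cnt D q 0) _
    constant (suc c) = +-cancelˡ-≡ (Cnt D q c + Cnt D q′ c) _ _ (begin
      a + b + (a⁺ + z′)    ≡⟨ rearrange a b a⁺ z′ ⟩
      (a + z′) + (b + a⁺)  ≡⟨ cong₂ _+_ (constant c) (sym (next c)) ⟩
      (b + z) + (a + b⁺)   ≡⟨ rearrange′ b z a b⁺ ⟩
      a + b + (b⁺ + z)     ∎)
      where
      a = Cnt D q c
      b = Cnt D q′ c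
      a⁺ = Cnt D q (suc c)
      b⁺ = Cnt D q′ (suc c)
      z = Cnt D q 0
      z′ = Cnt D q′ 0
      rearrange : ∀ a b c d → a + b + (c + d) ≡ (a + d) + (b + c)
      rearrange = solve-∀
      rearrange′ : ∀ a b c d → a + b + (c + d) ≡ c + a + (d + b)
      rearrange′ = solve-∀
    total : ∀ q c₀ → ∑ m (λ c → Cnt D q c + c₀) ≡ D + m * c₀
    total q c₀ = trans (∑-+ (Cnt D q) (λ _ → c₀) m) (cong₂ _+_ (∑Cnt D q) (∑-const c₀ m))
    zeroth : Cnt D q 0 ≡ Cnt D q′ 0
    zeroth = sym (*-cancelˡ-≡ _ _ m (+-cancelˡ-≡ D _ _ (trans (sym (total q (Cnt D q′ 0)))
      (trans (∑-cong m (λ c _ → constant c)) (total q′ (Cnt D q 0))))))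

  -- Realizing prescribed letters

  τ-letter : ∀ {z} → z < m → τ z ≡ z
  τ-letter {z} z<m = trans (τ-block 0 z<m) (trans (cong (λ x → (x + z) % m) τ-zero) (m<n⇒m%n≡m z<m))

  pred<m : pred m < m
  pred<m = ≤-reflexive (suc-pred m)

  1+x+pred≋x : ∀ x → suc x + pred m ≋ x
  1+x+pred≋x x = trans (≡⇒≋ (trans (sym (+-suc x (pred m))) (cong (x +_) (suc-pred m)))) (+m-≋ x)

  -- Passing from position Q to Qm + (m-1) keeps the second letter of a pair and decreases the first one.
  consecutive-≋ : ∀ k y → ∃ λ Q → τ Q ≋ y + k * pred m × τ (suc Q) ≋ suc y
  consecutive-≋ zero y = y % m * m + 0 ,
    trans (τ-block-≋ (y % m) 0<m) (+-congʳ-≋ 0 letter) ,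
    trans (≡⇒≋ (cong τ (sym (+-suc (y % m * m) 0)))) (trans (τ-block-≋ (y % m) 2≤m)
      (trans (+-congʳ-≋ 1 letter) (≡⇒≋ (+-comm y 1))))
    where
    letter : τ (y % m) ≋ y
    letter = trans (≡⇒≋ (τ-letter (m%n<n y m))) (%-≋ y)
  consecutive-≋ (suc k) y with consecutive-≋ k y
  ... | Q , p , p′ = Q * m + pred m ,
    trans (τ-block-≋ Q pred<m) (trans (+-congʳ-≋ (pred m) p) (≡⇒≋ (trans (+-assoc y _ _) (cong (y +_) (+-comm _ (pred m)))))) ,
    trans (≡⇒≋ (cong τ next)) (trans (τ-block-≋ (suc Q) 0<m) (trans (≡⇒≋ (+-identityʳ _)) p′))
    where
    next : suc (Q * m + pred m) ≡ suc Q * m + 0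
    next = trans (sym (+-suc (Q * m) (pred m))) (trans (cong (Q * m +_) (suc-pred m)) (trans (+-comm (Q * m) m) (sym (+-identityʳ _))))

  consecutive : ∀ {x y} → x < m → y < m → ∃ λ Q → τ Q ≡ x × τ (suc Q) ≡ y
  -- The construction yields the pair (z - k, z + 1); it is used with z = y - 1 and k = y - 1 - x.
  consecutive {x} {y} x<m y<m with consecutive-≋ (y + pred m + neg x) (y + pred m)
  ... | Q , p , p′ = Q , ≋⇒≡ (τ<m Q) x<m (trans p first) , ≋⇒≡ (τ<m (suc Q)) y<m (trans p′ (1+x+pred≋x y))
    where
    k = y + pred m + neg x
    regroup : ∀ z k p → z + k * p + k ≡ z + k * suc p
    regroup = solve-∀
    first : y + pred m + k * pred m ≋ x
    first = +-cancelʳ-≋ k (trans (≡⇒≋ (trans (regroup (y + pred m) k (pred m)) (cong (λ z → y + pred m + k * z) (suc-pred m))))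
      (trans (+km-≋ (y + pred m) k) (sym (trans (≡⇒≋ (swap x (y + pred m) (neg x))) (trans (+-congˡ-≋ (y + pred m) (neg-≋ x)) (≡⇒≋ (+-identityʳ _)))))))
      where
      swap : ∀ x z n → x + (z + n) ≡ z + (n + x)
      swap = solve-∀

  -- The last letter of one block and the second letter of the next are two apart; they are one less
  -- and one more than the block letters, which are therefore chosen as x + 1 and y - 1.
  two-apart : ∀ {x y} → x < m → y < m → ∃ λ Q → τ Q ≡ x × τ (2 + Q) ≡ y
  two-apart {x} {y} x<m y<m with consecutive (m%n<n (suc x) m) (m%n<n (y + pred m) m)
  ... | Q , p , p′ = Q * m + pred m ,
    ≋⇒≡ (τ<m _) x<m (trans (τ-block-≋ Q pred<m) (trans (+-congʳ-≋ (pred m) (trans (≡⇒≋ p) (%-≋ (suc x)))) (1+x+pred≋x x))) ,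
    ≋⇒≡ (τ<m _) y<m (trans (≡⇒≋ (cong τ next)) (trans (τ-block-≋ (suc Q) 2≤m)
      (trans (+-congʳ-≋ 1 (trans (≡⇒≋ p′) (%-≋ (y + pred m)))) (trans (≡⇒≋ (+-comm (y + pred m) 1)) (1+x+pred≋x y)))))
    where
    next : 2 + (Q * m + pred m) ≡ suc Q * m + 1
    next = trans (cong suc (trans (sym (+-suc (Q * m) (pred m))) (trans (cong (Q * m +_) (suc-pred m)) (+-comm (Q * m) m))))
      (+-comm 1 (suc Q * m))

  -- Here m ≤ ρ + D < 3m, so q and q + D lie in blocks at distance one or two, which `consecutive`
  -- and `two-apart` cover.
  realize : ∀ {D ρ x y} → D ≤ 2 * m → ρ < m → m ≤ ρ + D → x < m → y < m →
    ∃ λ q → q % m ≡ ρ × E q ≡ x × E (q + D) ≡ y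
  realize {D} {ρ} {x} {y} D≤2m ρ<m m≤ρ+D x<m y<m with ρ + D <? 2 * m
  ... | yes ρ+D<2m = found (consecutive x<m y<m)
    where
    s = ρ + D ∸ m
    s<m : s < m
    s<m = +-cancelˡ-< m s m (subst₂ _<_ (sym (m+[n∸m]≡n m≤ρ+D)) (cong (m +_) (+-identityʳ m)) ρ+D<2m)
    found : (∃ λ Q → τ Q ≡ x × τ (suc Q) ≡ y) → _
    found (Q , p , p′) = Q * m + ρ , %-unique m Q ρ<m , trans (cong τ (/-unique m Q ρ<m)) p ,
      trans (cong τ (trans (cong (_/ m) end) (/-unique m (suc Q) s<m))) p′
      where
      regroup : ∀ Q m s → Q * m + (m + s) ≡ suc Q * m + s
      regroup = solve-∀
      end : Q * m + ρ + D ≡ suc Q * m + s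
      end = trans (+-assoc (Q * m) ρ D) (trans (cong (Q * m +_) (sym (m+[n∸m]≡n m≤ρ+D))) (regroup Q m s))
  ... | no ρ+D≮2m = found (two-apart x<m y<m)
    where
    2m≤ρ+D = ≮⇒≥ ρ+D≮2m
    s = ρ + D ∸ 2 * m
    s<m : s < m
    s<m = +-cancelˡ-< (2 * m) s m (subst₂ _<_ (sym (m+[n∸m]≡n 2m≤ρ+D)) (+-comm m (2 * m)) (+-mono-<-≤ ρ<m D≤2m))
    found : (∃ λ Q → τ Q ≡ x × τ (2 + Q) ≡ y) → _
    found (Q , p , p′) = Q * m + ρ , %-unique m Q ρ<m , trans (cong τ (/-unique m Q ρ<m)) p ,
      trans (cong τ (trans (cong (_/ m) end) (/-unique m (2 + Q) s<m))) p′
      where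
      regroup : ∀ Q m s → Q * m + (2 * m + s) ≡ (2 + Q) * m + s
      regroup = solve-∀
      end : Q * m + ρ + D ≡ (2 + Q) * m + s
      end = trans (+-assoc (Q * m) ρ D) (trans (cong (Q * m +_) (sym (m+[n∸m]≡n 2m≤ρ+D))) (regroup Q m s))

  E<m : ∀ i → E i < m
  E<m i = τ<m (i / m)

  τ≋E : ∀ i → τ i ≋ E i + i
  τ≋E i = trans (≡⇒≋ (τ-/ i)) (trans (%-≋ _) (+-congˡ-≋ (E i) (%-≋ i)))

  jump⇒≤ : ∀ {D q} → E q ≢ E (q + D) → m ≤ q % m + D
  jump⇒≤ {D} {q} h = ≮⇒≥ λ lt → h (cong τ (sym (trans (cong (_/ m) (trans (cong (_+ D) (divMod≡ q)) (+-assoc _ (q % m) D))) (/-unique m (q / m) lt))))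

  -- Both end blocks partial

  EndRel : ℕ → ℕ → ℕ → Set
  EndRel D q q′ = τ q ≡ τ q′ × τ (q + D) ≡ τ (q′ + D) × SameCount D q q′

  EndRel⇒ : ∀ {D q q′} → EndRel D q q′ → ∀ c → δ (E (q + D)) c + δ (E q′) c ≡ δ (E (q′ + D)) c + δ (E q) c
  EndRel⇒ {D} {q} {q′} (p , p′ , same) c = +-cancelʳ-≡ (δ (τ q) c + δ (τ (q + D)) c) _ _
    (trans (rearrange (δ (E (q + D)) c) (δ (E q′) c) (δ (τ q) c) (δ (τ (q + D)) c))
    (trans (cong (λ z → δ (E (q + D)) c + δ (τ q) c + (δ z c + δ (E q′) c)) p′)
    (trans (SameCount⇒Balanced same c)
    (trans (cong (λ z → δ (E (q′ + D)) c + δ z c + (δ (τ (q + D)) c + δ (E q) c)) (sym p))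
           (sym (rearrange (δ (E (q′ + D)) c) (δ (E q) c) (δ (τ q) c) (δ (τ (q + D)) c)))))))
    where
    rearrange : ∀ a b c d → a + b + (c + d) ≡ a + c + (d + b)
    rearrange = solve-∀

  ⇒EndRel : ∀ {D q q′} → τ q ≡ τ q′ → τ (q + D) ≡ τ (q′ + D) →
    (∀ c → δ (E (q + D)) c + δ (E q′) c ≡ δ (E (q′ + D)) c + δ (E q) c) → EndRel D q q′
  ⇒EndRel {D} {q} {q′} p p′ h = p , p′ , Balanced⇒SameCount λ c →
    trans (cong (λ z → δ (E (q + D)) c + δ (τ q) c + (δ z c + δ (E q′) c)) (sym p′))
    (trans (sym (rearrange (δ (E (q + D)) c) (δ (E q′) c) (δ (τ q) c) (δ (τ (q + D)) c)))
    (trans (cong (_+ (δ (τ q) c + δ (τ (q + D)) c)) (h c))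
    (trans (rearrange (δ (E (q′ + D)) c) (δ (E q) c) (δ (τ q) c) (δ (τ (q + D)) c))
           (cong (λ z → δ (E (q′ + D)) c + δ z c + (δ (τ (q + D)) c + δ (E q) c)) p))))
    where
    rearrange : ∀ a b c d → a + b + (c + d) ≡ a + c + (d + b)
    rearrange = solve-∀

  δ-injective : ∀ {a b} → (∀ c → δ a c ≡ δ b c) → a ≋ b
  δ-injective {a} {b} h = δ≡1⇒≋ {a} {b} (trans (h b) (δ-yes {b} {b} refl))

  -- The formal difference [a] - [b] has no cancellation when the letters differ, so both can be
  -- read off.
  exchange : ∀ {a b a′ b′} → (∀ c → δ a c + δ b′ c ≡ δ a′ c + δ b c) → ¬ a ≋ b → b ≋ b′ × a ≋ a′
  exchange {a} {b} {a′} {b′} h a≋̸b = sym b′≋b , δ-injective (λ c → +-cancelʳ-≡ (δ b′ c) _ _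
      (trans (h c) (cong (δ a′ c +_) (δ-congˡ c (sym b′≋b)))))
    where
    at-b : δ b′ b ≡ δ a′ b + 1
    at-b = trans (cong (_+ δ b′ b) (sym (δ-no {a} {b} a≋̸b))) (trans (h b) (cong (δ a′ b +_) (δ-yes {b} {b} refl)))
    b′≋b : b′ ≋ b
    b′≋b = δ≡1⇒≋ {b′} {b} (≤-antisym (δ≤1 b′ b) (≤-trans (m≤n+m 1 (δ a′ b)) (≤-reflexive (sym at-b))))

  same-letter : ∀ {i j} → E i ≡ E j → τ i ≡ τ j → i % m ≡ j % m
  same-letter {i} {j} p p′ = +-cancelˡ-≋ (E i) (trans (sym (τ≋E i)) (trans (≡⇒≋ p′) (trans (τ≋E j) (≡⇒≋ (cong (_+ j) (sym p))))))

  -- The offsets from which D steps leave the block are the last min(D, m) ones.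
  ∑-threshold : ∀ D K → ∑ m (λ ρ → if does (m ≤? ρ + D) then K else 0) ≡ (D ⊓ m) * K
  ∑-threshold D K with D ≤? m
  ... | yes D≤m = trans (cong (λ n → ∑ n f) (sym (m∸n+n≡m D≤m))) (trans (∑-split f (m ∸ D) D)
    (trans (cong₂ _+_ (∑-zero (m ∸ D) (λ ρ ρ< → cong (if_then K else 0) (dec-false (m ≤? ρ + D)
             (<⇒≱ (subst (ρ + D <_) (m∸n+n≡m D≤m) (+-monoˡ-< D ρ<))))))
           (trans (∑-cong D (λ ρ _ → cong (if_then K else 0) (dec-true (m ≤? m ∸ D + ρ + D)
             (≤-trans (≤-reflexive (sym (m∸n+n≡m D≤m))) (+-monoˡ-≤ D (m≤m+n (m ∸ D) ρ)))))) (∑-const K D)))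
           (cong (_* K) (sym (m≤n⇒m⊓n≡m D≤m)))))
    where f = λ ρ → if does (m ≤? ρ + D) then K else 0
  ... | no D≰m = trans (∑-cong m (λ ρ _ → cong (if_then K else 0) (dec-true (m ≤? ρ + D) (≤-trans m≤D (m≤n+m D ρ)))))
    (trans (∑-const K m) (cong (_* K) (sym (m≥n⇒m⊓n≡n m≤D))))
    where m≤D = ≰⇒≥ D≰m

  ∑-others : ∀ {x} → x < m → ∑ m (λ y → 1 ∸ δ x y) ≡ pred m
  ∑-others {x} x<m = +-cancelʳ-≡ 1 _ _ (trans (cong (∑ m (λ y → 1 ∸ δ x y) +_) (sym (∑δ≡1 x<m)))
    (trans (sym (∑-+ (λ y → 1 ∸ δ x y) (δ x) m)) (trans (∑-cong m (λ y _ → m∸n+n≡m (δ≤1 x y)))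
    (trans (∑-const 1 m) (trans (*-identityʳ m) (trans (sym (suc-pred m)) (+-comm 1 (pred m))))))))

  module _ {D : ℕ} (1≤D : 1 ≤ D) (D≤2m : D ≤ 2 * m) where

    Flat : ℕ → Set
    Flat q = E q ≡ E (q + D)

    flat-transfer : ∀ {q q′} → EndRel D q q′ → Flat q → Flat q′
    flat-transfer {q} {q′} r f = ≋⇒≡ (E<m q′) (E<m (q′ + D)) (δ-injective (λ c → +-cancelˡ-≡ (δ (E q) c) _ _
      (trans (cong (λ z → δ z c + δ (E q′) c) f) (trans (EndRel⇒ r c) (+-comm (δ (E (q′ + D)) c) (δ (E q) c))))))

    EndRel-sym : ∀ {q q′} → EndRel D q q′ → EndRel D q′ q
    EndRel-sym (p , p′ , s) = sym p , sym p′ , λ c → sym (s c)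

    -- For flat q the difference [E(q + D)] - [E q] vanishes and τ(q + D) ≡ τ q + D, so τ q alone
    -- names the class.
    flat-classes : ClassesOn (λ q → ⊤ × Flat q) (EndRel D) m
    flat-classes = subst (ClassesOn _ _) (trans (∑-const 1 m) (*-identityʳ m))
      (partition τ m (λ _ → 1) (λ q _ → τ<m q) (λ _ _ _ _ → proj₁) (λ a a<m → at a a<m))
      where
      at : ∀ a → a < m → ClassesOn (λ q → (⊤ × Flat q) × τ q ≡ a) (EndRel D) 1
      -- From offset m - 1 any D ≥ 1 crosses a boundary, as `realize` requires, and the block of a +
      -- 1 ends in a.
      at a a<m with realize {D} {pred m} D≤2m pred<m (≤-trans (≤-reflexive (sym (trans (+-comm (pred m) 1) (suc-pred m)))) (+-monoʳ-≤ (pred m) 1≤D))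
                     (m%n<n (suc a) m) (m%n<n (suc a) m)
      ... | q , ρ≡ , x≡ , y≡ = single q ((tt , trans x≡ (sym y≡)) , letter) related
        where
        letter : τ q ≡ a
        letter = ≋⇒≡ (τ<m q) a<m (trans (τ≋E q) (trans (+-cong-≋ {E q} {suc a} {q} {pred m} (trans (≡⇒≋ x≡) (%-≋ (suc a)))
          (trans ρ≡ (sym (m<n⇒m%n≡m pred<m)))) (1+x+pred≋x a)))
        related : ∀ q q′ → (⊤ × Flat q) × τ q ≡ a → (⊤ × Flat q′) × τ q′ ≡ a → EndRel D q q′
        related q q′ ((_ , f) , p) ((_ , f′) , p′) = ⇒EndRel (trans p (sym p′))
          (τ-cong (trans (flat-end q f) (trans (≡⇒≋ (cong (_+ D) (trans p (sym p′)))) (sym (flat-end q′ f′)))))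
          (λ c → trans (cong₂ (λ u v → δ u c + δ v c) (sym f) f′) (+-comm (δ (E q) c) (δ (E (q′ + D)) c)))
          where
          flat-end : ∀ q → Flat q → τ (q + D) ≋ τ q + D
          flat-end q f = trans (τ≋E (q + D)) (trans (≡⇒≋ (trans (cong (_+ (q + D)) (sym f)) (sym (+-assoc (E q) q D))))
            (+-congʳ-≋ D (sym (τ≋E q))))

    jump-invariant : ∀ {q q′} → ¬ Flat q → EndRel D q q′ → E q ≡ E q′ × E (q + D) ≡ E (q′ + D)
    jump-invariant {q} {q′} ¬f r with exchange {E (q + D)} {E q} {E (q′ + D)} {E q′} (EndRel⇒ r)
        (λ p → ¬f (sym (≋⇒≡ (E<m (q + D)) (E<m q) p)))
    ... | p , p′ = ≋⇒≡ (E<m q) (E<m q′) p , ≋⇒≡ (E<m (q + D)) (E<m (q′ + D)) p′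

    -- By `exchange` both E q and E(q + D) are invariants, and E q with τ q fixes the offset: m
    -- letters E q, min(D, m) offsets, and m - 1 letters E(q + D) other than E q.
    jump-classes : ClassesOn (λ q → ⊤ × ¬ Flat q) (EndRel D) (m * ((D ⊓ m) * pred m))
    jump-classes = subst (ClassesOn _ _) (trans (∑-cong m (λ _ _ → ∑-threshold D (pred m))) (∑-const ((D ⊓ m) * pred m) m))
      (partition E m (λ _ → ∑ m (λ ρ → if does (m ≤? ρ + D) then pred m else 0)) (λ q _ → E<m q)
        (λ q q′ p _ r → proj₁ (jump-invariant (proj₂ p) r)) (λ x x<m →
      partition (_% m) m (λ ρ → if does (m ≤? ρ + D) then pred m else 0) (λ q _ → m%n<n q m)
        (λ q q′ (p , _) _ r → same-letter (proj₁ (jump-invariant (proj₂ p) r)) (proj₁ r)) (λ ρ ρ<m → at x x<m ρ ρ<m)))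
      where
      at : ∀ x → x < m → ∀ ρ → ρ < m →
        ClassesOn (λ q → ((⊤ × ¬ Flat q) × E q ≡ x) × q % m ≡ ρ) (EndRel D) (if does (m ≤? ρ + D) then pred m else 0)
      at x x<m ρ ρ<m with m ≤? ρ + D
      ... | no m≰ = subst (ClassesOn _ _) (cong (if_then pred m else 0) (sym (dec-false (m ≤? ρ + D) m≰)))
        (empty λ { q (((_ , ¬f) , _) , refl) → m≰ (jump⇒≤ ¬f) })
      ... | yes m≤ = subst (ClassesOn _ _) (trans (∑-others x<m) (cong (if_then pred m else 0) (sym (dec-true (m ≤? ρ + D) m≤))))
        (partition (λ q → E (q + D)) m (λ y → 1 ∸ δ x y) (λ q _ → E<m (q + D))
          (λ q q′ ((p , _) , _) _ r → proj₂ (jump-invariant (proj₂ p) r)) at-y)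
        where
        at-y : ∀ y → y < m → ClassesOn (λ q → (((⊤ × ¬ Flat q) × E q ≡ x) × q % m ≡ ρ) × E (q + D) ≡ y) (EndRel D) (1 ∸ δ x y)
        at-y y y<m with x ≟ y
        ... | yes refl = subst (ClassesOn _ _) (cong (1 ∸_) (sym (δ-yes {x} {x} refl)))
          (empty λ { q ((((_ , ¬f) , p) , _) , p′) → ¬f (trans p (sym p′)) })
        ... | no x≢y with realize {D} {ρ} D≤2m ρ<m m≤ x<m y<m
        ...   | q , ρ≡ , x≡ , y≡ = subst (ClassesOn _ _) (cong (1 ∸_) (sym (δ-no {x} {y} (λ p → x≢y (≋⇒≡ x<m y<m p)))))
          (single q ((((tt , λ f → x≢y (trans (sym x≡) (trans f y≡))) , x≡) , ρ≡) , y≡) related)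
          where
          related : ∀ q q′ → (((⊤ × ¬ Flat q) × E q ≡ x) × q % m ≡ ρ) × E (q + D) ≡ y →
            (((⊤ × ¬ Flat q′) × E q′ ≡ x) × q′ % m ≡ ρ) × E (q′ + D) ≡ y → EndRel D q q′
          related q q′ (((_ , p) , o) , p₂) (((_ , p′) , o′) , p₂′) = ⇒EndRel
            (τ-cong (trans (τ≋E q) (trans (+-cong-≋ {E q} {E q′} {q} {q′} (≡⇒≋ x≡x) o≡o) (sym (τ≋E q′)))))
            (τ-cong (trans (τ≋E (q + D)) (trans (+-cong-≋ {E (q + D)} {E (q′ + D)} {q + D} {q′ + D} (≡⇒≋ y≡y) (+-congʳ-≋ {q} {q′} D o≡o)) (sym (τ≋E (q′ + D))))))
            (λ c → cong₂ (λ u v → δ u c + δ v c) y≡y (sym x≡x))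
            where
            x≡x = trans p (sym p′)
            y≡y = trans p₂ (sym p₂′)
            o≡o = trans o (sym o′)

    end-classes : ClassesOn (λ _ → ⊤) (EndRel D) (m + m * ((D ⊓ m) * pred m))
    end-classes = split-by Flat (λ q → E q ≟ E (q + D)) (λ q q′ _ _ → flat-transfer)
      (λ q q′ _ _ r → flat-transfer (EndRel-sym r)) flat-classes jump-classes

  -- One end aligned

  -- For K < m, the number of unordered pairs from 1, ..., m - 1, repetition allowed, with minimum
  -- at most K: minimum p + 1 leaves m - (p + 1) choices for the maximum.
  triangle : ℕ → ℕ
  triangle K = ∑ K (λ p → m ∸ suc p)

  SamePair : ℕ → ℕ → ℕ → ℕ → Set
  SamePair u v u′ v′ = (u ≡ u′ × v ≡ v′) ⊎ (u ≡ v′ × v ≡ u′)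

  ⊓⊔⇒SamePair : ∀ u v u′ v′ → u ⊓ v ≡ u′ ⊓ v′ → u ⊔ v ≡ u′ ⊔ v′ → SamePair u v u′ v′
  ⊓⊔⇒SamePair u v u′ v′ p q with ≤-total u v | ≤-total u′ v′
  ... | inj₁ a | inj₁ b = inj₁ (trans (sym (m≤n⇒m⊓n≡m a)) (trans p (m≤n⇒m⊓n≡m b)) ,
                                trans (sym (m≤n⇒m⊔n≡n a)) (trans q (m≤n⇒m⊔n≡n b)))
  ... | inj₁ a | inj₂ b = inj₂ (trans (sym (m≤n⇒m⊓n≡m a)) (trans p (m≥n⇒m⊓n≡n b)) ,
                                trans (sym (m≤n⇒m⊔n≡n a)) (trans q (m≥n⇒m⊔n≡m b)))
  ... | inj₂ a | inj₁ b = inj₂ (trans (sym (m≥n⇒m⊔n≡m a)) (trans q (m≤n⇒m⊔n≡n b)) ,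
                                trans (sym (m≥n⇒m⊓n≡n a)) (trans p (m≤n⇒m⊓n≡m b)))
  ... | inj₂ a | inj₂ b = inj₁ (trans (sym (m≥n⇒m⊔n≡m a)) (trans q (m≥n⇒m⊔n≡m b)) ,
                                trans (sym (m≥n⇒m⊓n≡n a)) (trans p (m≥n⇒m⊓n≡n b)))

  SamePair⇒⊓ : ∀ {u v u′ v′} → SamePair u v u′ v′ → u ⊓ v ≡ u′ ⊓ v′
  SamePair⇒⊓ (inj₁ (refl , refl)) = refl
  SamePair⇒⊓ {u} {v} (inj₂ (refl , refl)) = ⊓-comm u v

  SamePair⇒⊔ : ∀ {u v u′ v′} → SamePair u v u′ v′ → u ⊔ v ≡ u′ ⊔ v′
  SamePair⇒⊔ (inj₁ (refl , refl)) = refl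
  SamePair⇒⊔ {u} {v} (inj₂ (refl , refl)) = ⊔-comm u v

  -- The common shape of both half-aligned cases: a key `b` and an unordered pair {u, v}, all pairs
  -- containing 0 being merged. A bound on `u` is enough to bound the minimum of the pair.
  module Triangular (S : ℕ → ℕ → Set) (b u v : ℕ → ℕ) (K : ℕ) (1≤K : 1 ≤ K) (K<m : K < m)
    (b<m : ∀ q → b q < m) (u<m : ∀ q → u q < m) (v<m : ∀ q → v q < m)
    (fwd : ∀ {q q′} → S q q′ → b q ≡ b q′ ×
      (((u q ≡ 0 ⊎ v q ≡ 0) × (u q′ ≡ 0 ⊎ v q′ ≡ 0)) ⊎ SamePair (u q) (v q) (u q′) (v q′)))
    (bwd : ∀ {q q′} → b q ≡ b q′ →
      (((u q ≡ 0 ⊎ v q ≡ 0) × (u q′ ≡ 0 ⊎ v q′ ≡ 0)) ⊎ SamePair (u q) (v q) (u q′) (v q′)) → S q q′)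
    (range : ∀ {q} → ¬ (u q ≡ 0 ⊎ v q ≡ 0) → u q ≤ K)
    (real : ∀ {β x y} → β < m → 1 ≤ x → x ≤ K → y < m → ∃ λ q → b q ≡ β × u q ≡ x × v q ≡ y) where

    Trivial : ℕ → Set
    Trivial q = u q ≡ 0 ⊎ v q ≡ 0

    trivial? : ∀ q → Dec (Trivial q)
    trivial? q = (u q ≟ 0) ⊎-dec (v q ≟ 0)

    trivial-transfer : ∀ {q q′} → S q q′ → Trivial q → Trivial q′
    trivial-transfer {q} {q′} s h with proj₂ (fwd s) | h
    ... | inj₁ (_ , h′)             | _      = h′
    ... | inj₂ (inj₁ (p , _))       | inj₁ z = inj₁ (trans (sym p) z)
    ... | inj₂ (inj₁ (_ , p))       | inj₂ z = inj₂ (trans (sym p) z)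
    ... | inj₂ (inj₂ (p , _))       | inj₁ z = inj₂ (trans (sym p) z)
    ... | inj₂ (inj₂ (_ , p))       | inj₂ z = inj₁ (trans (sym p) z)

    trivial-transfer′ : ∀ {q q′} → S q q′ → Trivial q′ → Trivial q
    trivial-transfer′ {q} {q′} s h with proj₂ (fwd s) | h
    ... | inj₁ (h′ , _)             | _      = h′
    ... | inj₂ (inj₁ (p , _))       | inj₁ z = inj₁ (trans p z)
    ... | inj₂ (inj₁ (_ , p))       | inj₂ z = inj₂ (trans p z)
    ... | inj₂ (inj₂ (p , _))       | inj₂ z = inj₁ (trans p z)
    ... | inj₂ (inj₂ (_ , p))       | inj₁ z = inj₂ (trans p z)

    pair-invariant : ∀ {q q′} → ¬ Trivial q → S q q′ → SamePair (u q) (v q) (u q′) (v q′)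
    pair-invariant ¬t s with proj₂ (fwd s)
    ... | inj₁ (t , _) = contradiction t ¬t
    ... | inj₂ p = p

    1≤⊓ : ∀ {q} → ¬ Trivial q → 1 ≤ u q ⊓ v q
    1≤⊓ {q} ¬t = ⊓-glb (n≢0⇒n>0 (¬t ∘ inj₁)) (n≢0⇒n>0 (¬t ∘ inj₂))

    suc-pred-⊓ : ∀ {q} → ¬ Trivial q → suc (pred (u q ⊓ v q)) ≡ u q ⊓ v q
    suc-pred-⊓ {q} ¬t = suc-pred (u q ⊓ v q) {{>-nonZero (1≤⊓ ¬t)}}

    Fibre : ℕ → ℕ → Set
    Fibre β q = ⊤ × b q ≡ β

    nontrivial-classes : ∀ β → β < m → ClassesOn (λ q → Fibre β q × ¬ Trivial q) S (triangle K)
    nontrivial-classes β β<m = partition (λ q → pred (u q ⊓ v q)) K (λ p → m ∸ suc p)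
      (λ { q (_ , ¬t) → ≤-trans (≤-reflexive (suc-pred-⊓ ¬t)) (≤-trans (m⊓n≤m (u q) (v q)) (range ¬t)) })
      (λ { q q′ (_ , ¬t) _ s → cong pred (SamePair⇒⊓ (pair-invariant ¬t s)) })
      (λ p p<K → subst (ClassesOn _ _) (trans (∑-const 1 (m ∸ suc p)) (*-identityʳ _))
        (partition (λ q → u q ⊔ v q ∸ suc p) (m ∸ suc p) (λ _ → 1)
          (λ { q ((_ , ¬t) , p≡) → ∸-monoˡ-< (⊔-lub (u<m q) (v<m q)) (low ¬t p≡) })
          (λ { q q′ ((_ , ¬t) , _) _ s → cong (_∸ suc p) (SamePair⇒⊔ (pair-invariant ¬t s)) })
          (λ w w< → at p p<K w w<)))
      where
      low : ∀ {p q} → ¬ Trivial q → pred (u q ⊓ v q) ≡ p → suc p ≤ u q ⊔ v q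
      low {p} {q} ¬t refl = ≤-trans (≤-reflexive (suc-pred-⊓ ¬t)) (m⊓n≤m⊔n (u q) (v q))
      at : ∀ p → p < K → ∀ w → w < m ∸ suc p →
        ClassesOn (λ q → ((Fibre β q × ¬ Trivial q) × pred (u q ⊓ v q) ≡ p) × u q ⊔ v q ∸ suc p ≡ w) S 1
      at p p<K w w< with real {β} {suc p} {suc p + w} β<m (s≤s z≤n) p<K
          (subst (suc p + w <_) (m+[n∸m]≡n (≤-trans p<K (<⇒≤ K<m))) (+-monoʳ-< (suc p) w<))
      ... | q , b≡ , u≡ , v≡ = single q
        ((((tt , b≡) , λ { (inj₁ z) → contradiction (trans (sym u≡) z) (λ ()) ; (inj₂ z) → contradiction (trans (sym v≡) z) (λ ()) }) ,
          cong pred (trans (cong₂ _⊓_ u≡ v≡) (m≤n⇒m⊓n≡m (m≤m+n (suc p) w)))) ,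
         trans (cong (_∸ suc p) (trans (cong₂ _⊔_ u≡ v≡) (m≤n⇒m⊔n≡n (m≤m+n (suc p) w)))) (m+n∸m≡n (suc p) w))
        (λ { q q′ ((((_ , e₁) , ¬t) , e₂) , e₃) ((((_ , e₁′) , ¬t′) , e₂′) , e₃′) → bwd (trans e₁ (sym e₁′))
          (inj₂ (⊓⊔⇒SamePair (u q) (v q) (u q′) (v q′)
            (trans (sym (suc-pred-⊓ ¬t)) (trans (cong suc (trans e₂ (sym e₂′))) (suc-pred-⊓ ¬t′)))
            (∸-cancelʳ-≡ (low ¬t e₂) (low ¬t′ e₂′) (trans e₃ (sym e₃′))))) })

    triangular-classes : ClassesOn (λ _ → ⊤) S (m * (1 + triangle K))
    triangular-classes = subst (ClassesOn _ _) (∑-const (1 + triangle K) m)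
      (partition b m (λ _ → 1 + triangle K) (λ q _ → b<m q) (λ _ _ _ _ s → proj₁ (fwd s)) (λ β β<m →
        split-by Trivial trivial? (λ _ _ _ _ → trivial-transfer) (λ _ _ _ _ → trivial-transfer′)
          (trivial-class β β<m) (nontrivial-classes β β<m)))
      where
      trivial-class : ∀ β → β < m → ClassesOn (λ q → Fibre β q × Trivial q) S 1
      -- `real` prescribes `u` only from 1 on, so the zero is placed in `v`.
      trivial-class β β<m with real {β} {1} {0} β<m ≤-refl 1≤K 0<m
      ... | q , b≡ , _ , v≡ = single q ((tt , b≡) , inj₂ v≡)
        (λ { q q′ ((_ , e₁) , h) ((_ , e₁′) , h′) → bwd (trans e₁ (sym e₁′)) (inj₁ (h , h′)) })

  diff : ℕ → ℕ → ℕ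
  diff x o = (x + neg o) % m

  diff<m : ∀ x o → diff x o < m
  diff<m x o = m%n<n (x + neg o) m

  diff-≋ : ∀ x o → diff x o + o ≋ x
  diff-≋ x o = trans (+-congʳ-≋ o (%-≋ (x + neg o))) (trans (≡⇒≋ (+-assoc x (neg o) o))
    (trans (+-congˡ-≋ x (neg-≋ o)) (≡⇒≋ (+-identityʳ x))))

  diff-unique : ∀ {d x o} → d < m → d + o ≋ x → diff x o ≡ d
  diff-unique {d} {x} {o} d<m h = ≋⇒≡ (diff<m x o) d<m (+-cancelʳ-≋ o (trans (diff-≋ x o) (sym h)))

  pair-exchange : ∀ {a b a′ b′} → (∀ c → δ a c + δ b c ≡ δ a′ c + δ b′ c) → (a ≋ a′ × b ≋ b′) ⊎ (a ≋ b′ × b ≋ a′)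
  pair-exchange {a} {b} {a′} {b′} h with a ≋? a′
  ... | yes p = inj₁ (p , δ-injective (λ c → +-cancelˡ-≡ (δ a c) _ _ (trans (h c) (cong (_+ δ b′ c) (δ-congˡ c (sym p))))))
  ... | no ¬p = inj₂ (sym b′≋a , δ-injective (λ c → +-cancelˡ-≡ (δ a c) _ _
          (trans (h c) (trans (+-comm (δ a′ c) (δ b′ c)) (cong (_+ δ a′ c) (δ-congˡ c b′≋a))))))
    where
    at-a : 1 + δ b a ≡ δ b′ a
    at-a = trans (cong (_+ δ b a) (sym (δ-yes {a} {a} refl))) (trans (h a) (cong (_+ δ b′ a) (δ-no {a′} {a} (¬p ∘ sym))))
    b′≋a : b′ ≋ a
    b′≋a = δ≡1⇒≋ {b′} {a} (≤-antisym (δ≤1 b′ a) (≤-trans (m≤m+n 1 (δ b a)) (≤-reflexive at-a)))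

  -- If g is neither a nor b, it survives as the negative term of [a] + [b] - [g]. Hence g′ = g, and
  -- the two pairs have equal sums.
  triple-exchange : ∀ {a b g a′ b′ g′} → (∀ c → δ a c + δ b c + δ g′ c ≡ δ a′ c + δ b′ c + δ g c) →
    ¬ g ≋ a → ¬ g ≋ b → (a ≋ a′ × b ≋ b′) ⊎ (a ≋ b′ × b ≋ a′)
  triple-exchange {a} {b} {g} {a′} {b′} {g′} h g≋̸a g≋̸b = pair-exchange (λ c → +-cancelʳ-≡ (δ g′ c) _ _
      (trans (h c) (cong (δ a′ c + δ b′ c +_) (δ-congˡ c (sym g′≋g)))))
    where
    at-g : δ g′ g ≡ δ a′ g + δ b′ g + 1
    at-g = trans (cong₂ (λ x y → x + y + δ g′ g) (sym (δ-no {a} {g} (g≋̸a ∘ sym))) (sym (δ-no {b} {g} (g≋̸b ∘ sym))))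
      (trans (h g) (cong (δ a′ g + δ b′ g +_) (δ-yes {g} {g} refl)))
    g′≋g : g′ ≋ g
    g′≋g = δ≡1⇒≋ {g′} {g} (≤-antisym (δ≤1 g′ g) (≤-trans (m≤n+m 1 (δ a′ g + δ b′ g)) (≤-reflexive (sym at-g))))

  -- The class of q is the key b(q) together with the formal sum [α] + [β] - [γ], where α + β = γ + o
  -- and o depends on b(q) only; it degenerates to [o] when α or β equals o.
  module Signature (b o α β γ : ℕ → ℕ) (w : ℕ → ℕ → ℕ)
    (o-cong : ∀ {q q′} → b q ≡ b q′ → o q ≋ o q′)
    (relation : ∀ q → α q + β q ≋ γ q + o q)
    (w-zero : ∀ {o x} → w o x ≡ 0 → x ≋ o) (zero-w : ∀ {o x} → x ≋ o → w o x ≡ 0)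
    (w-cong : ∀ {o x o′ x′} → o ≋ o′ → x ≋ x′ → w o x ≡ w o′ x′)
    (w-inj : ∀ {o x o′ x′} → o ≋ o′ → w o x ≡ w o′ x′ → x ≋ x′) where

    u v : ℕ → ℕ
    u q = w (o q) (α q)
    v q = w (o q) (β q)

    Signed : ℕ → ℕ → Set
    Signed q q′ = ∀ c → δ (α q) c + δ (β q) c + δ (γ q′) c ≡ δ (α q′) c + δ (β q′) c + δ (γ q) c

    γ≋α⇒β≋o : ∀ {q} → γ q ≋ α q → β q ≋ o q
    γ≋α⇒β≋o {q} h = +-cancelˡ-≋ (α q) (trans (relation q) (+-congʳ-≋ (o q) h))

    γ≋β⇒α≋o : ∀ {q} → γ q ≋ β q → α q ≋ o q
    γ≋β⇒α≋o {q} h = +-cancelʳ-≋ (β q) (trans (relation q) (trans (+-congʳ-≋ (o q) h) (≡⇒≋ (+-comm (β q) (o q)))))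

    α≋o⇒β≋γ : ∀ {q} → α q ≋ o q → β q ≋ γ q
    α≋o⇒β≋γ {q} h = +-cancelˡ-≋ (o q) (trans (+-congʳ-≋ (β q) (sym h)) (trans (relation q) (≡⇒≋ (+-comm (γ q) (o q)))))

    β≋o⇒α≋γ : ∀ {q} → β q ≋ o q → α q ≋ γ q
    β≋o⇒α≋γ {q} h = +-cancelʳ-≋ (o q) (trans (+-congˡ-≋ (α q) (sym h)) (relation q))

    Trivial : ℕ → Set
    Trivial q = u q ≡ 0 ⊎ v q ≡ 0

    trivial? : ∀ q → Dec (Trivial q)
    trivial? q = (u q ≟ 0) ⊎-dec (v q ≟ 0)

    ¬γ≋α : ∀ {q} → ¬ Trivial q → ¬ γ q ≋ α q
    ¬γ≋α ¬t h = ¬t (inj₂ (zero-w (γ≋α⇒β≋o h)))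

    ¬γ≋β : ∀ {q} → ¬ Trivial q → ¬ γ q ≋ β q
    ¬γ≋β ¬t h = ¬t (inj₁ (zero-w (γ≋β⇒α≋o h)))

    pair-cong : ∀ {q q′} → o q ≋ o q′ → (α q ≋ α q′ × β q ≋ β q′) ⊎ (α q ≋ β q′ × β q ≋ α q′) →
      SamePair (u q) (v q) (u q′) (v q′)
    pair-cong h (inj₁ (p , p′)) = inj₁ (w-cong h p , w-cong h p′)
    pair-cong h (inj₂ (p , p′)) = inj₂ (w-cong h p , w-cong h p′)

    -- By `relation`, γ = α forces β = o and γ = β forces α = o. A nontrivial q thus has no
    -- cancellation, and `triple-exchange` applies from that side.
    Signed⇒ : ∀ {q q′} → b q ≡ b q′ → Signed q q′ →
      (Trivial q × Trivial q′) ⊎ SamePair (u q) (v q) (u q′) (v q′)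
    Signed⇒ {q} {q′} b≡ h with trivial? q | trivial? q′
    ... | yes p | yes p′ = inj₁ (p , p′)
    ... | no ¬p | _      = inj₂ (pair-cong (o-cong b≡) (triple-exchange h (¬γ≋α ¬p) (¬γ≋β ¬p)))
    ... | yes _ | no ¬p  = inj₂ (SamePair-sym (pair-cong (sym (o-cong b≡))
                             (triple-exchange (λ c → sym (h c)) (¬γ≋α ¬p) (¬γ≋β ¬p))))
      where
      SamePair-sym : ∀ {u v u′ v′} → SamePair u v u′ v′ → SamePair u′ v′ u v
      SamePair-sym (inj₁ (p , p′)) = inj₁ (sym p , sym p′)
      SamePair-sym (inj₂ (p , p′)) = inj₂ (sym p′ , sym p)

    trivial-sum : ∀ {q} → Trivial q → ∀ c → δ (α q) c + δ (β q) c ≡ δ (γ q) c + δ (o q) c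
    trivial-sum {q} (inj₁ z) c = trans (cong₂ _+_ (δ-congˡ c (w-zero z)) (δ-congˡ c (α≋o⇒β≋γ (w-zero z)))) (+-comm (δ (o q) c) (δ (γ q) c))
    trivial-sum {q} (inj₂ z) c = cong₂ _+_ (δ-congˡ c (β≋o⇒α≋γ (w-zero z))) (δ-congˡ c (w-zero z))

    γ-cong : ∀ {q q′} → o q ≋ o q′ → α q + β q ≋ α q′ + β q′ → γ q ≋ γ q′
    γ-cong {q} {q′} h p = +-cancelʳ-≋ (o q) (trans (sym (relation q)) (trans p (trans (relation q′) (+-congˡ-≋ (γ q′) (sym h)))))

    ⇒Signed : ∀ {q q′} → b q ≡ b q′ →
      (Trivial q × Trivial q′) ⊎ SamePair (u q) (v q) (u q′) (v q′) → Signed q q′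
    ⇒Signed {q} {q′} b≡ (inj₁ (p , p′)) c = trans (cong (_+ δ (γ q′) c) (trivial-sum p c))
      (trans (rearrange (δ (γ q) c) (δ (o q) c) (δ (γ q′) c))
      (cong (_+ δ (γ q) c) (trans (cong (δ (γ q′) c +_) (δ-congˡ c (o-cong b≡))) (sym (trivial-sum p′ c)))))
      where
      rearrange : ∀ x y z → x + y + z ≡ z + y + x
      rearrange = solve-∀
    ⇒Signed {q} {q′} b≡ (inj₂ (inj₁ (p , p′))) c =
      cong₂ _+_ (cong₂ _+_ (δ-congˡ c α≋) (δ-congˡ c β≋)) (δ-congˡ c (sym (γ-cong (o-cong b≡) (+-cong-≋ α≋ β≋))))
      where
      α≋ = w-inj (o-cong b≡) p
      β≋ = w-inj (o-cong b≡) p′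
    ⇒Signed {q} {q′} b≡ (inj₂ (inj₂ (p , p′))) c =
      cong₂ _+_ (trans (cong₂ _+_ (δ-congˡ c α≋) (δ-congˡ c β≋)) (+-comm (δ (β q′) c) (δ (α q′) c)))
        (δ-congˡ c (sym (γ-cong (o-cong b≡) (trans (+-cong-≋ α≋ β≋) (≡⇒≋ (+-comm (β q′) (α q′)))))))
      where
      α≋ = w-inj (o-cong b≡) p
      β≋ = w-inj (o-cong b≡) p′

  module RightEnd (ν : ℕ) (1≤ν : 1 ≤ ν) (ν≤2m : ν ≤ 2 * m) where

    RightRel : ℕ → ℕ → Set
    RightRel q q′ = τ (q + ν) ≡ τ (q′ + ν) × SameCount ν q q′

    swap : ∀ x y z → x + (y + z) ≡ y + (x + z)
    swap = solve-∀

    -- Here `ν * pred m` stands for -ν, which makes o congruent to E(q + ν) + q.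
    o : ℕ → ℕ
    o q = τ (q + ν) + ν * pred m

    o+ν≋ : ∀ x → x + ν * pred m + ν ≋ x
    o+ν≋ x = trans (≡⇒≋ (trans (regroup x ν (pred m)) (cong (λ z → x + ν * z) (suc-pred m)))) (+km-≋ x ν)
      where
      regroup : ∀ x n p → x + n * p + n ≡ x + n * suc p
      regroup = solve-∀

    o≋ : ∀ q → o q ≋ E (q + ν) + q
    o≋ q = +-cancelʳ-≋ ν (trans (o+ν≋ (τ (q + ν))) (trans (τ≋E (q + ν)) (≡⇒≋ (sym (+-assoc (E (q + ν)) q ν)))))

    open Signature (λ q → τ (q + ν)) o (λ q → E (q + ν)) τ E (λ o x → diff x o)
      (λ p → ≡⇒≋ (cong (_+ ν * pred m) p))
      (λ q → trans (+-congˡ-≋ (E (q + ν)) (τ≋E q)) (trans (≡⇒≋ (swap (E (q + ν)) (E q) q)) (+-congˡ-≋ (E q) (sym (o≋ q)))))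
      (λ {o} {x} p → trans (sym (diff-≋ x o)) (≡⇒≋ (cong (_+ o) p)))
      (λ p → diff-unique 0<m (sym p))
      (λ {o} {x} {o′} {x′} p p′ → diff-unique (diff<m x′ o′) (trans (+-congˡ-≋ (diff x′ o′) p) (trans (diff-≋ x′ o′) (sym p′))))
      (λ {o} {x} {o′} {x′} p p′ → trans (sym (diff-≋ x o)) (trans (+-cong-≋ (≡⇒≋ p′) p) (diff-≋ x′ o′)))

    rearrange : ∀ a b c d → a + b + (c + d) ≡ c + (a + b + d)
    rearrange = solve-∀

    RightRel⇒Signed : ∀ {q q′} → RightRel q q′ → Signed q q′
    RightRel⇒Signed {q} {q′} (p , same) c = +-cancelˡ-≡ (δ (τ (q + ν)) c) _ _
      (trans (sym (rearrange (δ (E (q + ν)) c) (δ (τ q) c) (δ (τ (q + ν)) c) (δ (E q′) c)))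
      (trans (cong (λ z → δ (E (q + ν)) c + δ (τ q) c + (δ z c + δ (E q′) c)) p)
      (trans (SameCount⇒Balanced same c) (rearrange (δ (E (q′ + ν)) c) (δ (τ q′) c) (δ (τ (q + ν)) c) (δ (E q) c)))))

    Signed⇒RightRel : ∀ {q q′} → τ (q + ν) ≡ τ (q′ + ν) → Signed q q′ → RightRel q q′
    Signed⇒RightRel {q} {q′} p s = p , Balanced⇒SameCount (λ c →
      trans (cong (λ z → δ (E (q + ν)) c + δ (τ q) c + (δ z c + δ (E q′) c)) (sym p))
      (trans (rearrange (δ (E (q + ν)) c) (δ (τ q) c) (δ (τ (q + ν)) c) (δ (E q′) c))
      (trans (cong (δ (τ (q + ν)) c +_) (s c)) (sym (rearrange (δ (E (q′ + ν)) c) (δ (τ q′) c) (δ (τ (q + ν)) c) (δ (E q) c))))))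

    u+q≋0 : ∀ q → u q + q ≋ 0
    u+q≋0 q = +-cancelˡ-≋ (E (q + ν)) (trans (≡⇒≋ (swap (E (q + ν)) (u q) q)) (trans (+-congˡ-≋ (u q) (sym (o≋ q)))
      (trans (diff-≋ (E (q + ν)) (o q)) (≡⇒≋ (sym (+-identityʳ _))))))

    -- `u` is -q modulo m, the distance from q to the next block boundary when q is not at one; a
    -- nontrivial q meets that boundary within `ν` steps.
    range : ∀ {q} → ¬ Trivial q → u q ≤ ν ⊓ pred m
    range {q} ¬t = ⊓-glb u≤ν (<⇒≤pred (diff<m _ _))
      where
      q%m≢0 : q % m ≢ 0
      q%m≢0 z = ¬t (inj₁ (≋⇒≡ (diff<m _ _) 0<m (trans (≡⇒≋ (sym (+-identityʳ (u q))))
        (trans (+-congˡ-≋ (u q) (sym (trans z (sym (m<n⇒m%n≡m 0<m))))) (u+q≋0 q)))))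
      u≡ : u q ≡ neg q
      u≡ = ≋⇒≡ (diff<m _ _) (∸-monoʳ-< (n≢0⇒n>0 q%m≢0) (<⇒≤ (m%n<n q m))) (+-cancelʳ-≋ q (trans (u+q≋0 q) (sym (neg-≋ q))))
      u≤ν : u q ≤ ν
      u≤ν = ≤-trans (≤-reflexive u≡) (m≤n+o⇒m∸n≤o m (q % m) (jump⇒≤ (λ p → ¬γ≋α ¬t (≡⇒≋ p))))

    real : ∀ {β x y} → β < m → 1 ≤ x → x ≤ ν ⊓ pred m → y < m → ∃ λ q → τ (q + ν) ≡ β × u q ≡ x × v q ≡ y
    -- u ≡ -q gives the offset m - x; u = E(q + ν) - o and v = E q + q - o give the two block
    -- letters.
    real {β} {x} {y} β<m 1≤x x≤ y<m with realize {ν} {m ∸ x} {(x + y + o₀) % m} {(x + o₀) % m} ν≤2m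
        (∸-monoʳ-< 1≤x x≤m) (≤-trans (≤-reflexive (sym (m∸n+n≡m x≤m))) (+-monoʳ-≤ (m ∸ x) (≤-trans x≤ (m⊓n≤m ν (pred m)))))
        (m%n<n _ m) (m%n<n _ m)
      where
      o₀ = β + ν * pred m
      x≤m : x ≤ m
      x≤m = ≤-trans x≤ (≤-trans (m⊓n≤n ν (pred m)) (<⇒≤ pred<m))
    ... | q , ρ≡ , X≡ , Y≡ = q , b≡ , u≡ , v≡
      where
      o₀ = β + ν * pred m
      x<m : x < m
      x<m = ≤-trans (s≤s (≤-trans x≤ (m⊓n≤n ν (pred m)))) pred<m
      x+q≋0 : x + q ≋ 0
      x+q≋0 = trans (+-congˡ-≋ x (trans ρ≡ (sym (m<n⇒m%n≡m (∸-monoʳ-< 1≤x (<⇒≤ x<m)))))) (trans (≡⇒≋ (m+[n∸m]≡n (<⇒≤ x<m))) (+m-≋ 0))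
      b≡ : τ (q + ν) ≡ β
      b≡ = ≋⇒≡ (τ<m _) β<m (trans (τ≋E (q + ν)) (trans (+-congʳ-≋ (q + ν) (trans (≡⇒≋ Y≡) (%-≋ (x + o₀))))
        (trans (≡⇒≋ (regroup x o₀ q ν)) (trans (+-congʳ-≋ (o₀ + ν) x+q≋0) (o+ν≋ β)))))
        where
        regroup : ∀ x o q n → x + o + (q + n) ≡ x + q + (o + n)
        regroup = solve-∀
      o≡ : o q ≡ o₀
      o≡ = cong (_+ ν * pred m) b≡
      u≡ : u q ≡ x
      u≡ = diff-unique x<m (trans (≡⇒≋ (cong (x +_) o≡)) (sym (trans (≡⇒≋ Y≡) (%-≋ (x + o₀)))))
      v≡ : v q ≡ y
      v≡ = diff-unique y<m (trans (≡⇒≋ (cong (y +_) o≡)) (sym (trans (τ≋E q) (trans (+-congʳ-≋ q (trans (≡⇒≋ X≡) (%-≋ (x + y + o₀))))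
        (trans (≡⇒≋ (regroup x y o₀ q)) (+-congʳ-≋ (y + o₀) x+q≋0))))))
        where
        regroup : ∀ x y o q → x + y + o + q ≡ x + q + (y + o)
        regroup = solve-∀

    right-classes : ClassesOn (λ _ → ⊤) RightRel (m * (1 + triangle (ν ⊓ pred m)))
    right-classes = Triangular.triangular-classes RightRel (λ q → τ (q + ν)) u v (ν ⊓ pred m)
      (⊓-glb 1≤ν (<⇒≤pred 2≤m)) (≤-trans (s≤s (m⊓n≤n ν (pred m))) pred<m)
      (λ q → τ<m (q + ν)) (λ q → diff<m _ _) (λ q → diff<m _ _)
      (λ s → proj₁ s , Signed⇒ (proj₁ s) (RightRel⇒Signed s))
      (λ p h → Signed⇒RightRel p (⇒Signed p h)) range real

  module LeftEnd (ν : ℕ) (1≤ν : 1 ≤ ν) (D≤2m : suc ν ≤ 2 * m) where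

    -- The first block, once completed, counts as a block, so a factor ending on a boundary spans ν
    -- + 1 of them.
    D : ℕ
    D = suc ν

    LeftRel : ℕ → ℕ → Set
    LeftRel q q′ = τ q ≡ τ q′ × SameCount D q q′

    o : ℕ → ℕ
    o q = τ q + D

    o≋ : ∀ q → o q ≋ E q + (q + D)
    o≋ q = trans (+-congʳ-≋ D (τ≋E q)) (≡⇒≋ (+-assoc (E q) q D))

    swap : ∀ x y z → x + (y + z) ≡ y + (x + z)
    swap = solve-∀

    open Signature τ o E (λ q → τ (q + D)) (λ q → E (q + D)) (λ o x → diff o x)
      (λ p → ≡⇒≋ (cong (_+ D) p))
      (λ q → trans (+-congˡ-≋ (E q) (τ≋E (q + D))) (trans (≡⇒≋ (swap (E q) (E (q + D)) (q + D))) (+-congˡ-≋ (E (q + D)) (sym (o≋ q)))))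
      (λ {o} {x} p → trans (≡⇒≋ (cong (_+ x) (sym p))) (diff-≋ o x))
      (λ p → diff-unique 0<m p)
      (λ {o} {x} {o′} {x′} p p′ → diff-unique (diff<m o′ x′) (trans (+-congˡ-≋ (diff o′ x′) p′) (trans (diff-≋ o′ x′) (sym p))))
      (λ {o} {x} {o′} {x′} p p′ → +-cancelˡ-≋ (diff o x) (trans (diff-≋ o x) (trans p
        (trans (sym (diff-≋ o′ x′)) (≡⇒≋ (cong (_+ x′) (sym p′)))))))

    rearrange : ∀ a b c d → a + b + (c + d) ≡ b + (d + c + a)
    rearrange = solve-∀

    LeftRel⇒Signed : ∀ {q q′} → LeftRel q q′ → Signed q q′
    LeftRel⇒Signed {q} {q′} (p , same) c = sym (+-cancelˡ-≡ (δ (τ q) c) _ _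
      (trans (sym (rearrange (δ (E (q + D)) c) (δ (τ q) c) (δ (τ (q′ + D)) c) (δ (E q′) c)))
      (trans (SameCount⇒Balanced same c)
      (trans (cong (λ z → δ (E (q′ + D)) c + δ z c + (δ (τ (q + D)) c + δ (E q) c)) (sym p))
             (rearrange (δ (E (q′ + D)) c) (δ (τ q) c) (δ (τ (q + D)) c) (δ (E q) c))))))

    Signed⇒LeftRel : ∀ {q q′} → τ q ≡ τ q′ → Signed q q′ → LeftRel q q′
    Signed⇒LeftRel {q} {q′} p s = p , Balanced⇒SameCount (λ c →
      trans (rearrange (δ (E (q + D)) c) (δ (τ q) c) (δ (τ (q′ + D)) c) (δ (E q′) c))
      (trans (cong (δ (τ q) c +_) (sym (s c)))
      (trans (sym (rearrange (δ (E (q′ + D)) c) (δ (τ q) c) (δ (τ (q + D)) c) (δ (E q) c)))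
             (cong (λ z → δ (E (q′ + D)) c + δ z c + (δ (τ (q + D)) c + δ (E q) c)) p))))

    u≋ : ∀ q → u q ≋ q + D
    u≋ q = +-cancelˡ-≋ (E q) (trans (≡⇒≋ (+-comm (E q) (u q))) (trans (diff-≋ (o q) (E q)) (o≋ q)))

    -- With the difference taken as o - x, `u` is q + D modulo m, the offset of q + D in its block.
    -- If D ≤ m and a boundary is crossed, this offset is below D = ν + 1.
    range : ∀ {q} → ¬ Trivial q → u q ≤ ν ⊓ pred m
    range {q} ¬t = ⊓-glb u≤ν (<⇒≤pred (diff<m _ _))
      where
      m≤ : m ≤ q % m + D
      m≤ = jump⇒≤ (λ p → ¬γ≋α ¬t (≡⇒≋ (sym p)))
      s = q % m + D ∸ m
      u≤ν : u q ≤ ν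
      u≤ν with D ≤? m
      ... | no D≰m = ≤-trans (<⇒≤ (diff<m _ _)) (≤-pred (≰⇒> D≰m))
      ... | yes D≤m = ≤-pred (subst (_< D) (sym u≡) s<D)
        where
        s<D : s < D
        s<D = +-cancelˡ-< m s D (subst (_< m + D) (sym (m+[n∸m]≡n m≤)) (+-monoˡ-< D (m%n<n q m)))
        u≡ : u q ≡ s
        u≡ = ≋⇒≡ (diff<m _ _) (≤-trans s<D D≤m) (trans (u≋ q) (trans (+-congʳ-≋ {q} {q % m} D (sym (%-≋ q)))
          (trans (≡⇒≋ (trans (sym (m+[n∸m]≡n m≤)) (+-comm m s))) (+m-≋ s))))

    -- For D ≤ m the bound x ≤ ν < D keeps ρ = x + (m - D) below m; for D > m every offset crosses a
    -- boundary.
    phase : ∀ {x} → x ≤ ν → x < m → ∃ λ ρ → ρ < m × m ≤ ρ + D × ρ + D ≋ x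
    phase {x} x≤ν x<m with D ≤? m
    ... | yes D≤m = x + (m ∸ D) , subst (x + (m ∸ D) <_) (m+[n∸m]≡n D≤m) (+-monoˡ-< (m ∸ D) (s≤s x≤ν)) ,
      ≤-trans (m≤n+m m x) (≤-reflexive (sym total)) , trans (≡⇒≋ total) (+m-≋ x)
      where
      total : x + (m ∸ D) + D ≡ x + m
      total = trans (+-assoc x (m ∸ D) D) (cong (x +_) (m∸n+n≡m D≤m))
    ... | no D≰m = diff x D , diff<m x D , ≤-trans (<⇒≤ (≰⇒> D≰m)) (m≤n+m D (diff x D)) , diff-≋ x D

    real : ∀ {β x y} → β < m → 1 ≤ x → x ≤ ν ⊓ pred m → y < m → ∃ λ q → τ q ≡ β × u q ≡ x × v q ≡ y
    real {β} {x} {y} β<m 1≤x x≤ y<m with phase (≤-trans x≤ (m⊓n≤m ν (pred m))) (≤-trans (s≤s (≤-trans x≤ (m⊓n≤n ν (pred m)))) pred<m)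
    ... | ρ , ρ<m , m≤ρ+D , ρ+D≋x with realize {D} {ρ} D≤2m ρ<m m≤ρ+D (diff<m (β + D) x) (diff<m (diff (β + D) x) y)
    ...   | q , ρ≡ , X≡ , Y≡ = q , b≡ , u≡ , v≡
      where
      x<m : x < m
      x<m = ≤-trans (s≤s (≤-trans x≤ (m⊓n≤n ν (pred m)))) pred<m
      q+D≋x : q + D ≋ x
      q+D≋x = trans (+-congʳ-≋ {q} {ρ} D (trans ρ≡ (sym (m<n⇒m%n≡m ρ<m)))) ρ+D≋x
      b≡ : τ q ≡ β
      b≡ = ≋⇒≡ (τ<m q) β<m (+-cancelʳ-≋ D (trans (o≋ q) (trans (+-cong-≋ {E q} (≡⇒≋ X≡) q+D≋x) (diff-≋ (β + D) x))))
      o≡ : o q ≡ β + D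
      o≡ = cong (_+ D) b≡
      u≡ : u q ≡ x
      u≡ = diff-unique x<m (trans (≡⇒≋ (trans (cong (x +_) X≡) (+-comm x (diff (β + D) x)))) (trans (diff-≋ (β + D) x) (≡⇒≋ (sym o≡))))
      v≡ : v q ≡ y
      v≡ = diff-unique y<m (trans (+-congˡ-≋ y (trans (τ≋E (q + D)) (+-cong-≋ {E (q + D)} (≡⇒≋ Y≡) q+D≋x)))
        (trans (≡⇒≋ (regroup y (diff (diff (β + D) x) y) x)) (trans (+-congʳ-≋ x (diff-≋ (diff (β + D) x) y))
        (trans (diff-≋ (β + D) x) (≡⇒≋ (sym o≡))))))
        where
        regroup : ∀ y d x → y + (d + x) ≡ d + y + x
        regroup = solve-∀

    left-classes : ClassesOn (λ _ → ⊤) LeftRel (m * (1 + triangle (ν ⊓ pred m)))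
    left-classes = Triangular.triangular-classes LeftRel τ u v (ν ⊓ pred m)
      (⊓-glb 1≤ν (<⇒≤pred 2≤m)) (≤-trans (s≤s (m⊓n≤n ν (pred m))) pred<m)
      τ<m (λ q → diff<m _ _) (λ q → diff<m _ _)
      (λ s → proj₁ s , Signed⇒ (proj₁ s) (LeftRel⇒Signed s))
      (λ p h → Signed⇒LeftRel p (⇒Signed p h)) range real

  -- Assembly over the phases modulo M

  PhaseRel : ℕ → ℕ → ℕ → ℕ → ℕ → Set
  PhaseRel r ℓ s q q′ = (r ≢ 0 → τ q ≡ τ q′) × (s ≢ 0 → τ (q + ℓ) ≡ τ (q′ + ℓ)) × SameCount ℓ q q′

  module Phases (e n : ℕ) (2M≤n : 2 * m ^ e ≤ n) where

    private instance
      M≢0 : NonZero (m ^ e)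
      M≢0 = m^n≢0 m e

    R : ℕ → ℕ → Set
    R i j = BinEq m (suc e) (window n i) (window n j)

    module _ {r ℓ s : ℕ} (r<M : r < m ^ e) (s<M : s < m ^ e) (len : r + n ≡ ℓ * m ^ e + s) where

      R⇒PhaseRel : ∀ q q′ → R (q * m ^ e + r) (q′ * m ^ e + r) → PhaseRel r ℓ s q q′
      R⇒PhaseRel q q′ h with BinEq⇒Match e 2M≤n h
      ... | mkMatch q₁ q₁′ r₁ ℓ₁ s₁ start start′ len₁ r₁<M s₁<M first last middle
        with div-unique (m ^ e) {q} {r} {q₁} {r₁} r<M r₁<M start | div-unique (m ^ e) {q′} {r} {q₁′} {r₁} r<M r₁<M start′
      ... | refl , refl | refl , _ with div-unique (m ^ e) {ℓ} {s} {ℓ₁} {s₁} s<M s₁<M (trans (sym len) len₁)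
      ... | refl , refl = first , last , middle

      PhaseRel⇒R : ∀ q q′ → PhaseRel r ℓ s q q′ → R (q * m ^ e + r) (q′ * m ^ e + r)
      PhaseRel⇒R q q′ (first , last , middle) =
        Match⇒BinEq e (mkMatch q q′ r ℓ s refl refl len r<M s<M first last middle)

      residue-classes : ∀ {S N} → (∀ {q q′} → PhaseRel r ℓ s q q′ → S q q′) → (∀ {q q′} → S q q′ → PhaseRel r ℓ s q q′) →
        ClassesOn (λ _ → ⊤) S N → ClassesOn (λ i → ⊤ × i % m ^ e ≡ r) R N
      residue-classes f g = reindex (λ q → q * m ^ e + r)
        (λ { i (_ , refl) → i / m ^ e , trans (m≡m%n+[m/n]*n i (m ^ e)) (+-comm (i % m ^ e) _) })
        (λ q → tt , %-unique (m ^ e) q r<M)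
        (λ q q′ h → f (R⇒PhaseRel q q′ h)) (λ q q′ s → PhaseRel⇒R q q′ (g s))

    all-classes : (N : ℕ → ℕ) → (∀ r → r < m ^ e → ClassesOn (λ i → ⊤ × i % m ^ e ≡ r) R (N r)) →
      ClassesOn (λ _ → ⊤) R (∑ (m ^ e) N)
    all-classes N = partition (_% m ^ e) (m ^ e) N (λ i _ → m%n<n i (m ^ e)) (λ i j _ _ → invariant i j)
      where
      invariant : ∀ i j → R i j → i % m ^ e ≡ j % m ^ e
      invariant i j h with BinEq⇒Match e 2M≤n h
      ... | mkMatch q q′ r _ _ refl refl _ r<M _ _ _ _ = trans (%-unique (m ^ e) q r<M) (sym (%-unique (m ^ e) q′ r<M))

  endCount : ℕ → ℕ
  endCount D = m + m * ((D ⊓ m) * pred m)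

  halfCount : ℕ → ℕ
  halfCount ν = m * (1 + triangle (ν ⊓ pred m))

  NumClasses-factor : ∀ {k n N} → ClassesOn (λ _ → ⊤) (λ i j → BinEq m k (window n i) (window n j)) N →
    BinComplexity m k n N
  NumClasses-factor {k} {n} (classes rep rep∈ inj cover) = ClassesOn⇒NumClasses {BinEq m k} {factor m n} (classes rep rep∈
    (λ a b h → inj a b (subst₂ (BinEq m k) (factor≡window n (rep a)) (factor≡window n (rep b)) h))
    (λ i p → proj₁ (cover i p) , subst₂ (BinEq m k) (sym (factor≡window n i)) (sym (factor≡window n (rep (proj₁ (cover i p))))) (proj₂ (cover i p))))

  SameCount? : ∀ n i j → Dec (SameCount n i j)
  SameCount? n i j with allUpTo? (λ c → Cnt n i c ≟ Cnt n j c) m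
  ... | yes h = yes λ c → trans (reduce i c) (trans (h (m%n<n c m)) (sym (reduce j c)))
    where
    reduce : ∀ i c → Cnt n i c ≡ Cnt n i (c % m)
    reduce i c = ∑-cong n (λ p _ → δ-congʳ (τ (i + p)) (sym (%-≋ c)))
  ... | no ¬h = no λ h → ¬h (λ {c} _ → h c)

  -- `EndRel` refines `SameCount`, so its representatives cover all abelian classes and can be
  -- thinned.
  EndRel⇒SameCount-classes : ∀ {ν K} → ClassesOn (λ _ → ⊤) (EndRel ν) K → ∃ λ N → ClassesOn (λ _ → ⊤) (SameCount ν) N
  EndRel⇒SameCount-classes {ν} {K} (classes rep _ _ cover) = proj₁ thinned ,
    restate (λ _ _ → tt) (λ i _ → proj₁ (cover i tt) , proj₂ (proj₂ (proj₂ (cover i tt)))) (proj₂ thinned)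
    where
    thinned : ∃ λ N → ClassesOn (λ i → ∃ λ a → SameCount ν i (rep a)) (SameCount ν) N
    thinned = finitely-many {SameCount ν} (λ _ → refl) (λ h c → sym (h c)) (λ h h′ c → trans (h c) (h′ c))
      (SameCount? ν) K rep

  abelian-complexity : ∀ {ν N} → ClassesOn (λ _ → ⊤) (SameCount ν) N → BinComplexity m 1 ν N
  abelian-complexity (classes rep rep∈ inj cover) = NumClasses-factor (classes rep rep∈
    (λ a b h → inj a b (BinEq1⇒SameCount h)) (λ i p → proj₁ (cover i p) , SameCount⇒BinEq1 (proj₂ (cover i p))))

  aligned-complexity : ∀ e {ν N} → 2 ≤ ν → ν ≤ 2 * m → ClassesOn (λ _ → ⊤) (SameCount ν) N →
    BinComplexity m (suc e) (ν * m ^ e) ((m ^ e ∸ 1) * endCount ν + N)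
  aligned-complexity e {ν} {N} 2≤ν ν≤2m abelian = subst (BinComplexity m (suc e) (ν * M)) total
    (NumClasses-factor (all-classes count at))
    where
    M = m ^ e
    open Phases e (ν * M) (*-monoˡ-≤ M 2≤ν)
    -- Phase 0 aligns both ends and leaves the abelian classes of ν letters; in every other phase s
    -- = r and both ends are partial.
    count : ℕ → ℕ
    count zero    = N
    count (suc r) = endCount ν
    at : ∀ r → r < M → ClassesOn (λ i → ⊤ × _%_ i M {{m^n≢0 m e}} ≡ r) R (count r)
    at zero    r<M = residue-classes {0} {ν} {0} r<M r<M (sym (+-identityʳ _))
      (λ (_ , _ , same) → same) (λ same → (λ 0≢0 → contradiction refl 0≢0) , (λ 0≢0 → contradiction refl 0≢0) , same) abelian
    at (suc r) r<M = residue-classes {suc r} {ν} {suc r} r<M r<M (+-comm (suc r) (ν * M))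
      (λ (first , last , same) → first (λ ()) , last (λ ()) , same) (λ (p , p′ , same) → (λ _ → p) , (λ _ → p′) , same)
      (end-classes (<⇒≤ 2≤ν) ν≤2m)
    total : ∑ M count ≡ (M ∸ 1) * endCount ν + N
    total = trans (cong (λ n → ∑ n count) (sym (m+[n∸m]≡n (m^>0 e)))) (trans (∑-head count (M ∸ 1))
      (trans (cong (N +_) (∑-const (endCount ν) (M ∸ 1))) (+-comm N _)))

  unaligned-complexity : ∀ e {ν μ} → 2 ≤ ν → suc ν ≤ 2 * m → 0 < μ → μ < m ^ e →
    BinComplexity m (suc e) (ν * m ^ e + μ)
      ((μ ∸ 1) * endCount (suc ν) + (m ^ e ∸ μ ∸ 1) * endCount ν + (halfCount ν + halfCount ν))
  unaligned-complexity e {ν} {μ} 2≤ν ν<2m 0<μ μ<M = subst (BinComplexity m (suc e) (ν * M + μ)) total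
    (NumClasses-factor (all-classes count at))
    where
    M = m ^ e
    A = M ∸ μ ∸ 1
    B = μ ∸ 1
    1≤ν = <⇒≤ 2≤ν
    ν≤2m = <⇒≤ ν<2m
    suc-A+μ : suc A + μ ≡ M
    suc-A+μ = trans (cong (_+ μ) (m+[n∸m]≡n (m<n⇒0<n∸m μ<M))) (m∸n+n≡m (<⇒≤ μ<M))
    open Phases e (ν * M + μ) (≤-trans (*-monoˡ-≤ M 2≤ν) (m≤m+n _ μ))
    -- The phases from 1 on, indexed from 0. The first `A` have r + μ < M and ν blocks before the
    -- end; phase M - μ aligns the right end after ν + 1 blocks; the remaining μ - 1 have ν + 1
    -- blocks and two partial ends.
    later : ℕ → ℕ
    later r = if does (r <? A) then endCount ν else (if does (r ≟ A) then halfCount ν else endCount (suc ν))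
    count : ℕ → ℕ
    count zero    = halfCount ν
    count (suc r) = later r
    later-< : ∀ {r} → r < A → later r ≡ endCount ν
    later-< {r} h = cong (if_then endCount ν else (if does (r ≟ A) then halfCount ν else endCount (suc ν))) (dec-true (r <? A) h)
    later-≡ : ∀ {r} → r ≡ A → later r ≡ halfCount ν
    later-≡ {r} refl = cong₂ (λ x y → if x then endCount ν else (if y then halfCount ν else endCount (suc ν)))
      (dec-false (A <? A) (<-irrefl refl)) (dec-true (A ≟ A) refl)
    later-> : ∀ {r} → A < r → later r ≡ endCount (suc ν)
    later-> {r} h = cong₂ (λ x y → if x then endCount ν else (if y then halfCount ν else endCount (suc ν)))
      (dec-false (r <? A) (<⇒≯ h)) (dec-false (r ≟ A) (>⇒≢ h))
    shift : ∀ r n μ → r + (n + μ) ≡ n + (r + μ)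
    shift = solve-∀
    at : ∀ r → r < M → ClassesOn (λ i → ⊤ × _%_ i M {{m^n≢0 m e}} ≡ r) R (count r)
    at zero    r<M = residue-classes {0} {ν} {μ} r<M μ<M refl
      (λ (_ , last , same) → last (>⇒≢ 0<μ) , same)
      (λ (p , same) → (λ 0≢0 → contradiction refl 0≢0) , (λ _ → p) , same)
      (RightEnd.right-classes ν 1≤ν ν≤2m)
    at (suc r) r<M with <-cmp r A
    ... | tri< r<A _ _ = subst (ClassesOn _ R) (sym (later-< r<A)) (residue-classes {suc r} {ν} {suc r + μ} r<M
      (subst (suc r + μ <_) suc-A+μ (+-monoˡ-< μ (s≤s r<A))) (shift (suc r) (ν * M) μ)
      (λ (first , last , same) → first (λ ()) , last (λ ()) , same) (λ (p , p′ , same) → (λ _ → p) , (λ _ → p′) , same)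
      (end-classes 1≤ν ν≤2m))
    ... | tri≈ _ refl _ = subst (ClassesOn _ R) (sym (later-≡ refl)) (residue-classes {suc A} {suc ν} {0} r<M (m^>0 e)
      (trans (shift (suc A) (ν * M) μ) (trans (cong (ν * M +_) suc-A+μ) (trans (+-comm (ν * M) M) (sym (+-identityʳ _)))))
      (λ (first , _ , same) → first (λ ()) , same)
      (λ (p , same) → (λ _ → p) , (λ 0≢0 → contradiction refl 0≢0) , same)
      (LeftEnd.left-classes ν 1≤ν ν<2m))
    ... | tri> _ _ A<r = subst (ClassesOn _ R) (sym (later-> A<r)) (residue-classes {suc r} {suc ν} {r ∸ A} r<M
      (≤-trans (s≤s (m∸n≤m r A)) (<⇒≤ r<M))
      (trans (shift (suc r) (ν * M) μ) (trans (cong (ν * M +_) (trans (cong (λ z → suc z + μ) (sym (m∸n+n≡m (<⇒≤ A<r))))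
        (trans (regroup (r ∸ A) A μ) (cong (_+ (r ∸ A)) suc-A+μ)))) (regroup′ (ν * M) M (r ∸ A))))
      (λ (first , last , same) → first (λ ()) , last (>⇒≢ (m<n⇒0<n∸m A<r)) , same) (λ (p , p′ , same) → (λ _ → p) , (λ _ → p′) , same)
      (end-classes (s≤s z≤n) ν<2m))
      where
      regroup : ∀ d a μ → suc (d + a) + μ ≡ suc a + μ + d
      regroup = solve-∀
      regroup′ : ∀ n M d → n + (M + d) ≡ M + n + d
      regroup′ = solve-∀
    M≡ : M ≡ suc (A + suc B)
    M≡ = trans (sym suc-A+μ) (cong (λ z → suc (A + z)) (sym (m+[n∸m]≡n 0<μ)))
    total : ∑ M count ≡ B * endCount (suc ν) + A * endCount ν + (halfCount ν + halfCount ν)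
    total = trans (cong (λ n → ∑ n count) M≡) (trans (∑-head count (A + suc B)) (trans (cong (halfCount ν +_)
      (trans (∑-split later A (suc B)) (cong₂ _+_ (trans (∑-cong A (λ r → later-<)) (∑-const (endCount ν) A))
        (trans (∑-head (λ i → later (A + i)) B) (cong₂ _+_ (later-≡ (+-identityʳ A))
          (trans (∑-cong B (λ i _ → later-> (m<m+n A (s≤s z≤n)))) (∑-const (endCount (suc ν)) B)))))))
      (rearrange (halfCount ν) (A * endCount ν) (B * endCount (suc ν)))))
      where
      rearrange : ∀ h a b → h + (a + (h + b)) ≡ b + a + (h + h)
      rearrange = solve-∀

  -- Closed forms of the counts

  +∸-cancel : ∀ {a b c} → a ≡ c + b → a ∸ b ≡ c
  +∸-cancel {a} {b} {c} refl = m+n∸n≡m c b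

  endCount≡e : ∀ D → endCount D ≡ e m D
  endCount≡e D with D <? m
  ... | yes D<m = trans (trans (cong (λ z → m + m * (z * pred m)) (m≤n⇒m⊓n≡m (<⇒≤ D<m)))
      (trans (factored m (D * pred m)) (cong (m *_) (sym (+∸-cancel {1 + D * m} {D} (trans (cong (λ z → 1 + D * z) (sym (suc-pred m))) (expand D (pred m))))))))
    (cong (if_then m * (1 + D * m ∸ D) else m ^ 3 ∸ m ^ 2 + m) (sym (dec-true (D <? m) D<m)))
    where
    factored : ∀ m x → m + m * x ≡ m * (1 + x)
    factored = solve-∀
    expand : ∀ D p → 1 + D * suc p ≡ 1 + D * p + D
    expand = solve-∀
  ... | no D≮m = trans (trans (cong (λ z → m + m * (z * pred m)) (m≥n⇒m⊓n≡n (≮⇒≥ D≮m)))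
      (trans (+-comm m _) (cong (_+ m) (sym (+∸-cancel {m ^ 3} {m ^ 2} (trans (cong (λ z → m * (m * (z * 1))) (sym (suc-pred m))) (expand m (pred m))))))))
    (cong (if_then m * (1 + D * m ∸ D) else m ^ 3 ∸ m ^ 2 + m) (sym (dec-false (D <? m) D≮m)))
    where
    expand : ∀ m p → m * (m * (suc p * 1)) ≡ m * (m * p) + m * (m * 1)
    expand = solve-∀

  triangle-closed : ∀ K → K ≤ m → 2 * triangle K + K * suc K ≡ 2 * K * m
  triangle-closed zero    _   = refl
  triangle-closed (suc K) K<m = trans (rearrange (triangle K) (m ∸ suc K) K)
    (trans (cong₂ (λ x y → x + 2 * y) (triangle-closed K (<⇒≤ K<m)) (m∸n+n≡m K<m)) (collect K m))
    where
    rearrange : ∀ t d K → 2 * (t + d) + suc K * suc (suc K) ≡ 2 * t + K * suc K + 2 * (d + suc K)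
    rearrange = solve-∀
    collect : ∀ K m → 2 * K * m + 2 * m ≡ 2 * suc K * m
    collect = solve-∀

  -- By `triangle-closed`, twice the triangle is 2Km - K(K + 1). The case K = ν gives the formula
  -- for ν < m; otherwise K = m - 1 and it is m(m - 1).
  2halfCount≡y : ∀ {ν} → 1 ≤ ν → halfCount ν + halfCount ν ≡ y m ν
  2halfCount≡y {suc n} _ with suc n <? m
  ... | yes ν<m = trans (cong (λ z → m * (1 + triangle z) + m * (1 + triangle z)) (m≤n⇒m⊓n≡m (<⇒≤pred ν<m)))
    (trans (sym (+∸-cancel {2 * m * (1 + ν * m ∸ ν)} {m * ν * n} (trans (cong (2 * m *_) (+∸-cancel {1 + ν * m} {ν} (trans (cong (λ z → 1 + ν * z) (sym (suc-pred m))) (expand ν (pred m))))) closed)))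
    (cong (if_then 2 * m * (1 + ν * m ∸ ν) ∸ m * ν * n else m ^ 3 ∸ m ^ 2 + 2 * m) (sym (dec-true (ν <? m) ν<m))))
    where
    ν = suc n
    expand : ∀ ν p → 1 + ν * suc p ≡ 1 + ν * p + ν
    expand = solve-∀
    closed : 2 * m * (1 + ν * pred m) ≡ m * (1 + triangle ν) + m * (1 + triangle ν) + m * ν * n
    closed = +-cancelʳ-≡ (m * (ν * suc ν)) _ _ (trans (lhs m (pred m) n)
      (trans (cong (λ z → 2 * m + m * (2 * ν * z) + m * ν * n) (suc-pred m))
      (trans (cong (λ z → 2 * m + m * z + m * ν * n) (sym (triangle-closed ν (<⇒≤ ν<m)))) (rhs m (triangle ν) n))))
      where
      lhs : ∀ m p n → 2 * m * (1 + suc n * p) + m * (suc n * suc (suc n)) ≡ 2 * m + m * (2 * suc n * suc p) + m * suc n * n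
      lhs = solve-∀
      rhs : ∀ m t n → 2 * m + m * (2 * t + suc n * suc (suc n)) + m * suc n * n
        ≡ m * (1 + t) + m * (1 + t) + m * suc n * n + m * (suc n * suc (suc n))
      rhs = solve-∀
  ... | no ν≮m = trans (cong (λ z → m * (1 + triangle z) + m * (1 + triangle z)) (m≥n⇒m⊓n≡n (≤-trans (<⇒≤ pred<m) (≮⇒≥ ν≮m))))
    (trans (trans closed (cong (_+ 2 * m) (sym (+∸-cancel {m ^ 3} {m ^ 2} (trans (cong (λ z → m * (m * (z * 1))) (sym (suc-pred m))) (expand m (pred m)))))))
    (cong (if_then 2 * m * (1 + ν * m ∸ ν) ∸ m * ν * n else m ^ 3 ∸ m ^ 2 + 2 * m) (sym (dec-false (ν <? m) ν≮m))))
    where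
    ν = suc n
    p = pred m
    expand : ∀ m p → m * (m * (suc p * 1)) ≡ m * (m * p) + m * (m * 1)
    expand = solve-∀
    closed : m * (1 + triangle p) + m * (1 + triangle p) ≡ m * (m * p) + 2 * m
    closed = +-cancelʳ-≡ (m * (p * m)) _ _ (trans (cong (λ z → m * (1 + triangle p) + m * (1 + triangle p) + m * (p * z)) (sym (suc-pred m)))
      (trans (lhs m (triangle p) p) (trans (cong (λ z → 2 * m + m * z) (triangle-closed p (<⇒≤ pred<m))) (rhs m p))))
      where
      lhs : ∀ m t p → m * (1 + t) + m * (1 + t) + m * (p * suc p) ≡ 2 * m + m * (2 * t + p * suc p)
      lhs = solve-∀
      rhs : ∀ m p → 2 * m + m * (2 * p * m) ≡ m * (m * p) + 2 * m + m * (p * m)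
      rhs = solve-∀

theorem1p12 : ∀ (m k : ℕ) → 2 ≤ m → 2 ≤ k →
    (∀ (ν : ℕ) → 2 ≤ ν → ν ≤ 2 * m ∸ 1 →
    Σ ℕ λ N → BinComplexity m 1 ν N ×
    BinComplexity m k (ν * m ^ (k ∸ 1)) ((m ^ (k ∸ 1) ∸ 1) * e m ν + N))
    ×
    (∀ (ν μ : ℕ) → 2 ≤ ν → ν ≤ 2 * m ∸ 1 → 0 < μ → μ < m ^ (k ∸ 1) →
    BinComplexity m k (ν * m ^ (k ∸ 1) + μ)
    ((μ ∸ 1) * e m (ν + 1) + (m ^ (k ∸ 1) ∸ μ ∸ 1) * e m ν + y m ν))
theorem1p12 m (suc k) 2≤m _ = aligned , unaligned
  where
  instance
    m≢0 : NonZero m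
    m≢0 = >-nonZero (<⇒≤ 2≤m)
  open GeneralizedThueMorse m 2≤m
  <2m : ∀ {ν} → ν ≤ 2 * m ∸ 1 → suc ν ≤ 2 * m
  <2m h = ≤-trans (s≤s h) (≤-reflexive (m+[n∸m]≡n (≤-trans (<⇒≤ 2≤m) (m≤m+n m (m + 0)))))
  aligned : ∀ ν → 2 ≤ ν → ν ≤ 2 * m ∸ 1 → Σ ℕ λ N → BinComplexity m 1 ν N ×
    BinComplexity m (suc k) (ν * m ^ k) ((m ^ k ∸ 1) * e m ν + N)
  aligned ν 2≤ν ν< = from (EndRel⇒SameCount-classes (end-classes (<⇒≤ 2≤ν) (<⇒≤ (<2m ν<))))
    where
    from : (∃ λ N → ClassesOn (λ _ → ⊤) (SameCount ν) N) → Σ ℕ λ N → BinComplexity m 1 ν N ×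
      BinComplexity m (suc k) (ν * m ^ k) ((m ^ k ∸ 1) * e m ν + N)
    from (N , abelian) = N , abelian-complexity abelian ,
      subst (λ z → BinComplexity m (suc k) (ν * m ^ k) ((m ^ k ∸ 1) * z + N)) (endCount≡e ν)
        (aligned-complexity k 2≤ν (<⇒≤ (<2m ν<)) abelian)
  unaligned : ∀ ν μ → 2 ≤ ν → ν ≤ 2 * m ∸ 1 → 0 < μ → μ < m ^ k →
    BinComplexity m (suc k) (ν * m ^ k + μ) ((μ ∸ 1) * e m (ν + 1) + (m ^ k ∸ μ ∸ 1) * e m ν + y m ν)
  unaligned ν μ 2≤ν ν< 0<μ μ<M = subst (BinComplexity m (suc k) (ν * m ^ k + μ))
    (cong₂ _+_ (cong₂ (λ a b → (μ ∸ 1) * a + (m ^ k ∸ μ ∸ 1) * b)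
                      (trans (endCount≡e (suc ν)) (cong (e m) (+-comm 1 ν))) (endCount≡e ν))
               (2halfCount≡y (<⇒≤ 2≤ν)))
    (unaligned-complexity k 2≤ν (<2m ν<) 0<μ μ<M)
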